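{- Let $H$ be any fixed connected graph with at least two vertices. There exists a constant $c>0$ (depending on $H$) such that, for every positive integer $k$ and every $0<\varepsilon\le c\cdot\log k$, any $\varepsilon$-DP implicit representation scheme under the coloring representation (with $k$ colors) for $H$-Packing has approximation ratio at most $2/3$; that is, if for some $\alpha$ the scheme satisfies $\mathbb{E}[\text{number of copies of } H \text{ returned on } G]\ge\alpha k$ for every graph $G$ with $\mathrm{opt}(G)\ge k$, then $\alpha\le2/3$.
   Context: $H$-Packing: given a graph $G=(V,E)$, find a maximum-size collection of vertex-disjoint subgraphs of $G$, each isomorphic to $H$; $\mathrm{opt}(G)$ is the maximum number of copies. Neighbors: two graphs $G=(V,E)$, $G'=(V,E')$ on the same vertex set are neighbors if $|E\triangle E'|\le1$. A randomized algorithm $\mathcal{M}$ is $\varepsilon$-DP if for all neighboring $G\sim G'$ and all sets $\mathcal{S}$ of outcomes, $\Pr[\mathcal{M}(G)\in\mathcal{S}]\le e^{\varepsilon}\Pr[\mathcal{M}(G')\in\mathcal{S}]$. Scheme under the coloring representation: the encoder $\mathcal{E}(G;k)$ is a randomized algorithm, $\varepsilon$-DP for each fixed target size $k$ and with arbitrary running time, which outputs a vertex coloring $c:V\to[k]=\{1,\dots,k\}$. The decoder is fixed: $\mathcal{D}(G,c)$ iterates through each color $i\in[k]$ and selects one monochromatic copy of $H$ of color $i$ (a subgraph of $G$ isomorphic to $H$ all of whose vertices have color $i$) if one exists. Thus the number of copies returned equals the number of colors $i\in[k]$ for which a monochromatic copy of $H$ of color $i$ exists. The expectation is over the randomness of the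 encoder. -}

module Defs where

open import Data.Bool as Bool using (Bool; false; T)
open import Data.Fin as Fin using (Fin)
import Data.Fin.Properties as Fin
open import Data.Integer as ℤ using (+_; -[1+_])
import Data.Integer.Properties as ℤ
open import Data.List as List
  using (List; []; _∷_; allFin; cartesianProduct; cartesianProductWith; filter; filterᵇ; foldr; length; mapMaybe; upTo)
open import Data.List.Extrema.Nat using (max)
open import Data.Maybe as Maybe using (Maybe)
open import Data.Nat as ℕ using (ℕ; zero; suc)
import Data.Nat.Properties as ℕ
open import Data.Product using (∃; _×_; _,_; proj₁)
open import Data.Rational as ℚ using (ℚ; mkℚ; 0ℚ; 1ℚ; ∣_∣; toℚᵘ)
import Data.Rational.Properties as ℚ
open import Data.Rational.Solver using (module +-*-Solver)
import Data.Rational.Unnormalised as ℚᵘ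
import Data.Rational.Unnormalised.Properties as ℚᵘ
open import Data.Sum using (_⊎_; inj₁; inj₂)
open import Data.Vec as Vec using (Vec; []; _∷_; lookup)
open import Relation.Binary.Construct.Closure.ReflexiveTransitive using (Star)
open import Relation.Binary.PropositionalEquality
  using (_≡_; _≢_; refl; sym; trans; cong; cong₂; subst; module ≡-Reasoning)
open import Relation.Nullary using (Dec; ¬?)
open import Relation.Nullary.Decidable using (map′; dec⇒maybe; T?; _×-dec_; _→-dec_)
open import Relation.Unary using (Decidable)

ι : ℕ → ℚ
ι n = + n ℚ./ 1

inv : ℕ → ℚ
inv n = + 1 ℚ./ suc n

opaque
  ι≃ : ∀ n → toℚᵘ (ι n) ℚᵘ.≃ ℚᵘ.mkℚᵘ (+ n) 0
  ι≃ n = ℚ.toℚᵘ-fromℚᵘ (ℚᵘ.mkℚᵘ (+ n) 0)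

  inv≃ : ∀ n → toℚᵘ (inv n) ℚᵘ.≃ ℚᵘ.mkℚᵘ (+ 1) n
  inv≃ n = ℚ.toℚᵘ-fromℚᵘ (ℚᵘ.mkℚᵘ (+ 1) n)

  ι-+ : ∀ m n → ι (m ℕ.+ n) ≡ ι m ℚ.+ ι n
  ι-+ m n = ℚ.toℚᵘ-injective (ℚᵘ.≃-trans (ι≃ (m ℕ.+ n)) (ℚᵘ.≃-sym
    (ℚᵘ.≃-trans (ℚ.toℚᵘ-homo-+ (ι m) (ι n))
      (ℚᵘ.≃-trans (ℚᵘ.+-cong (ι≃ m) (ι≃ n)) (ℚᵘ.*≡* (cong (ℤ._* + 1) eq))))))
    where
    eq : + m ℤ.* + 1 ℤ.+ + n ℤ.* + 1 ≡ + (m ℕ.+ n)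
    eq rewrite ℤ.*-identityʳ (+ m) | ℤ.*-identityʳ (+ n) = refl

  ι-* : ∀ m n → ι (m ℕ.* n) ≡ ι m ℚ.* ι n
  ι-* m n = ℚ.toℚᵘ-injective (ℚᵘ.≃-trans (ι≃ (m ℕ.* n)) (ℚᵘ.≃-sym
    (ℚᵘ.≃-trans (ℚ.toℚᵘ-homo-* (ι m) (ι n))
      (ℚᵘ.≃-trans (ℚᵘ.*-cong (ι≃ m) (ι≃ n)) (ℚᵘ.*≡* (cong (ℤ._* + 1) (sym (ℤ.pos-* m n))))))))

  ι*inv : ∀ n → ι (suc n) ℚ.* inv n ≡ 1ℚ
  ι*inv n = ℚ.toℚᵘ-injective
    (ℚᵘ.≃-trans (ℚ.toℚᵘ-homo-* (ι (suc n)) (inv n))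
      (ℚᵘ.≃-trans (ℚᵘ.*-cong (ι≃ (suc n)) (inv≃ n)) (ℚᵘ.*≡* eq)))
    where
    eq : (+ suc n ℤ.* + 1) ℤ.* + 1 ≡ + 1 ℤ.* (+ (1 ℕ.* suc n))
    eq rewrite ℕ.*-identityʳ n | ℕ.*-identityʳ n | ℕ.+-identityʳ n | ℕ.+-identityʳ n = refl

  ι-mono : ∀ {m n} → m ℕ.≤ n → ι m ℚ.≤ ι n
  ι-mono {m} {n} m≤n = ℚ.toℚᵘ-cancel-≤
    (ℚᵘ.≤-respˡ-≃ (ℚᵘ.≃-sym (ι≃ m)) (ℚᵘ.≤-respʳ-≃ (ℚᵘ.≃-sym (ι≃ n))
      (ℚᵘ.*≤* (ℤ.*-monoʳ-≤-nonNeg (+ 1) (ℤ.+≤+ m≤n)))))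

  0≤ι : ∀ n → 0ℚ ℚ.≤ ι n
  0≤ι n = ι-mono {0} {n} ℕ.z≤n

  0<inv : ∀ n → 0ℚ ℚ.< inv n
  0<inv n = ℚ.toℚᵘ-cancel-< (ℚᵘ.<-respʳ-≃ (ℚᵘ.≃-sym (inv≃ n)) (ℚᵘ.*<* (ℤ.+<+ (ℕ.s≤s ℕ.z≤n))))

  0≤inv : ∀ n → 0ℚ ℚ.≤ inv n
  0≤inv n = ℚ.<⇒≤ (0<inv n)

  *-mono : ∀ {a b c d} → 0ℚ ℚ.≤ a → 0ℚ ℚ.≤ d → a ℚ.≤ b → c ℚ.≤ d → a ℚ.* c ℚ.≤ b ℚ.* d
  *-mono {a} {b} {c} {d} 0≤a 0≤d a≤b c≤d = ℚ.≤-trans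
    (ℚ.*-monoˡ-≤-nonNeg a {{ℚ.nonNegative 0≤a}} c≤d)
    (ℚ.*-monoʳ-≤-nonNeg d {{ℚ.nonNegative 0≤d}} a≤b)

  0≤* : ∀ {a b} → 0ℚ ℚ.≤ a → 0ℚ ℚ.≤ b → 0ℚ ℚ.≤ a ℚ.* b
  0≤* {a} {b} 0≤a 0≤b = subst (ℚ._≤ a ℚ.* b) (ℚ.*-zeroˡ b) (*-mono ℚ.≤-refl 0≤b 0≤a ℚ.≤-refl)

  0<* : ∀ {a b} → 0ℚ ℚ.< a → 0ℚ ℚ.< b → 0ℚ ℚ.< a ℚ.* b
  0<* {a} {b} 0<a 0<b = subst (ℚ._< a ℚ.* b) (ℚ.*-zeroˡ b) (ℚ.*-monoˡ-<-pos b {{ℚ.positive 0<b}} 0<a)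

  above : ∀ q → ∃ λ n → q ℚ.≤ ι n
  above q@(mkℚ (+ n) d _) = n , ℚ.toℚᵘ-cancel-≤ (ℚᵘ.≤-respʳ-≃ (ℚᵘ.≃-sym (ι≃ n))
    (ℚᵘ.*≤* (ℤ.*-monoˡ-≤-nonNeg (+ n) (ℤ.+≤+ (ℕ.s≤s ℕ.z≤n)))))
  above q@(mkℚ (-[1+ n ]) d _) = 0 , ℚ.toℚᵘ-cancel-≤ (ℚᵘ.*≤* ℤ.-≤+)

  below : ∀ {ε} → 0ℚ ℚ.< ε → ∃ λ d → inv d ℚ.≤ ε
  below {mkℚ (+ zero) d _} (ℚ.*<* (ℤ.+<+ ()))
  below {mkℚ (+ suc p) d _} _ = d , ℚ.toℚᵘ-cancel-≤ (ℚᵘ.≤-respˡ-≃ (ℚᵘ.≃-sym (inv≃ d))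
    (ℚᵘ.*≤* (ℤ.*-monoʳ-≤-nonNeg (+ suc d) (ℤ.+≤+ (ℕ.s≤s {0} {p} ℕ.z≤n)))))
  below {mkℚ (-[1+ p ]) d _} (ℚ.*<* ())

  shrink : ∀ {ε} → 0ℚ ℚ.< ε → (a : ℕ) → ∃ λ δ → 0ℚ ℚ.< δ × ι a ℚ.* δ ℚ.≤ ε
  shrink {ε} 0<ε a = ε ℚ.* inv a , 0<* 0<ε (0<inv a) , (begin
    ι a ℚ.* (ε ℚ.* inv a)        ≤⟨ ℚ.*-monoʳ-≤-nonNeg _ {{ℚ.nonNegative (0≤* (ℚ.<⇒≤ 0<ε) (0≤inv a))}} (ι-mono (ℕ.n≤1+n a)) ⟩
    ι (suc a) ℚ.* (ε ℚ.* inv a)  ≡⟨ solve 3 (λ x e i → x :* (e :* i) := (x :* i) :* e) refl (ι (suc a)) ε (inv a) ⟩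
    (ι (suc a) ℚ.* inv a) ℚ.* ε  ≡⟨ cong (ℚ._* ε) (ι*inv a) ⟩
    1ℚ ℚ.* ε                     ≡⟨ ℚ.*-identityˡ ε ⟩
    ε                            ∎)
    where
    open ℚ.≤-Reasoning
    open +-*-Solver

  archimedean : ∀ K {ε} → 0ℚ ℚ.< ε → ∃ λ n → K ℚ.≤ ι n ℚ.* ε
  archimedean K {ε} 0<ε with above K | below 0<ε
  ... | a , K≤a | d , d≤ε = a ℕ.* suc d , (begin
    K                              ≤⟨ K≤a ⟩
    ι a                            ≡⟨ ℚ.*-identityʳ (ι a) ⟨
    ι a ℚ.* 1ℚ                     ≡⟨ cong (ι a ℚ.*_) (ι*inv d) ⟨
    ι a ℚ.* (ι (suc d) ℚ.* inv d)  ≡⟨ ℚ.*-assoc (ι a) (ι (suc d)) (inv d) ⟨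
    ι a ℚ.* ι (suc d) ℚ.* inv d    ≡⟨ cong (ℚ._* inv d) (ι-* a (suc d)) ⟨
    ι (a ℕ.* suc d) ℚ.* inv d      ≤⟨ *-mono (0≤ι (a ℕ.* suc d)) (ℚ.<⇒≤ 0<ε) ℚ.≤-refl d≤ε ⟩
    ι (a ℕ.* suc d) ℚ.* ε          ∎)
    where
    open ℚ.≤-Reasoning


dist : ℚ → ℚ → ℚ
dist p q = ∣ p ℚ.- q ∣

opaque
  dist-sym : ∀ p q → dist p q ≡ dist q p
  dist-sym p q = trans (sym (ℚ.∣-p∣≡∣p∣ (p ℚ.- q)))
    (cong ∣_∣ (solve 2 (λ p q → :- (p :- q) := q :- p) refl p q))
    where open +-*-Solver

  triangle : ∀ p q r → dist p r ℚ.≤ dist p q ℚ.+ dist q r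
  triangle p q r = subst (λ x → ∣ x ∣ ℚ.≤ dist p q ℚ.+ dist q r)
    (solve 3 (λ p q r → (p :- q) :+ (q :- r) := p :- r) refl p q r)
    (ℚ.∣p+q∣≤∣p∣+∣q∣ (p ℚ.- q) (q ℚ.- r))
    where open +-*-Solver

  ι2 : ∀ δ → δ ℚ.+ δ ≡ ι 2 ℚ.* δ
  ι2 δ = solve 1 (λ d → d :+ d := con (ι 2) :* d) refl δ
    where open +-*-Solver


IsCauchy : (ℕ → ℚ) → Set
IsCauchy s = ∀ ε → 0ℚ ℚ.< ε → ∃ λ N → ∀ m n → N ℕ.≤ m → N ℕ.≤ n → ∣ s m ℚ.- s n ∣ ℚ.≤ ε

opaque
  const-cauchy : ∀ q → IsCauchy (λ _ → q)
  const-cauchy q ε 0<ε = 0 , λ _ _ _ _ →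
    ℚ.≤-trans (ℚ.≤-reflexive (cong ∣_∣ (ℚ.+-inverseʳ q))) (ℚ.<⇒≤ 0<ε)

  +-cauchy : ∀ {s t} → IsCauchy s → IsCauchy t → IsCauchy (λ n → s n ℚ.+ t n)
  +-cauchy {s} {t} cs ct ε 0<ε with shrink 0<ε 2
  ... | δ , 0<δ , 2δ≤ε with cs δ 0<δ | ct δ 0<δ
  ... | M , hM | N , hN = M ℕ.⊔ N , λ m n M≤m M≤n → begin
    ∣ (s m ℚ.+ t m) ℚ.- (s n ℚ.+ t n) ∣
      ≡⟨ cong ∣_∣ (solve 4 (λ a b c d → (a :+ b) :- (c :+ d) := (a :- c) :+ (b :- d)) refl (s m) (t m) (s n) (t n)) ⟩
    ∣ (s m ℚ.- s n) ℚ.+ (t m ℚ.- t n) ∣  ≤⟨ ℚ.∣p+q∣≤∣p∣+∣q∣ (s m ℚ.- s n) (t m ℚ.- t n) ⟩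
    dist (s m) (s n) ℚ.+ dist (t m) (t n)
      ≤⟨ ℚ.+-mono-≤ (hM m n (ℕ.m⊔n≤o⇒m≤o M N M≤m) (ℕ.m⊔n≤o⇒m≤o M N M≤n))
                    (hN m n (ℕ.m⊔n≤o⇒n≤o M N M≤m) (ℕ.m⊔n≤o⇒n≤o M N M≤n)) ⟩
    δ ℚ.+ δ                              ≡⟨ ι2 δ ⟩
    ι 2 ℚ.* δ                            ≤⟨ 2δ≤ε ⟩
    ε                                    ∎
    where
    open ℚ.≤-Reasoning
    open +-*-Solver

opaque
  bounded : ∀ {s} → IsCauchy s → ∃ λ B → ∃ λ N → ∀ n → N ℕ.≤ n → ∣ s n ∣ ℚ.≤ ι B
  bounded {s} cs with cs 1ℚ (ℚ.positive⁻¹ 1ℚ)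
  ... | N , hN with above (1ℚ ℚ.+ ∣ s N ∣)
  ... | B , h≤B = B , N , λ n N≤n → begin
    ∣ s n ∣                         ≡⟨ cong ∣_∣ (solve 2 (λ a b → a := (a :- b) :+ b) refl (s n) (s N)) ⟩
    ∣ (s n ℚ.- s N) ℚ.+ s N ∣       ≤⟨ ℚ.∣p+q∣≤∣p∣+∣q∣ (s n ℚ.- s N) (s N) ⟩
    ∣ s n ℚ.- s N ∣ ℚ.+ ∣ s N ∣     ≤⟨ ℚ.+-monoˡ-≤ ∣ s N ∣ (hN n N N≤n ℕ.≤-refl) ⟩
    1ℚ ℚ.+ ∣ s N ∣                  ≤⟨ h≤B ⟩
    ι B                             ∎
    where
    open ℚ.≤-Reasoning
    open +-*-Solver

opaque
  dist-* : ∀ a b c d → dist (a ℚ.* b) (c ℚ.* d) ℚ.≤ ∣ a ∣ ℚ.* dist b d ℚ.+ dist a c ℚ.* ∣ d ∣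
  dist-* a b c d = begin
    ∣ a ℚ.* b ℚ.- c ℚ.* d ∣
      ≡⟨ cong ∣_∣ (solve 4 (λ a b c d → a :* b :- c :* d := a :* (b :- d) :+ (a :- c) :* d) refl a b c d) ⟩
    ∣ a ℚ.* (b ℚ.- d) ℚ.+ (a ℚ.- c) ℚ.* d ∣
      ≤⟨ ℚ.∣p+q∣≤∣p∣+∣q∣ (a ℚ.* (b ℚ.- d)) ((a ℚ.- c) ℚ.* d) ⟩
    ∣ a ℚ.* (b ℚ.- d) ∣ ℚ.+ ∣ (a ℚ.- c) ℚ.* d ∣
      ≡⟨ cong₂ ℚ._+_ (ℚ.∣p*q∣≡∣p∣*∣q∣ a (b ℚ.- d)) (ℚ.∣p*q∣≡∣p∣*∣q∣ (a ℚ.- c) d) ⟩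
    ∣ a ∣ ℚ.* dist b d ℚ.+ dist a c ℚ.* ∣ d ∣ ∎
    where
    open ℚ.≤-Reasoning
    open +-*-Solver

  *-cauchy : ∀ {s t} → IsCauchy s → IsCauchy t → IsCauchy (λ n → s n ℚ.* t n)
  *-cauchy {s} {t} cs ct ε 0<ε with bounded {s} cs | bounded {t} ct
  ... | A , K , hA | B , L , hB with shrink 0<ε (A ℕ.+ B)
  ... | δ , 0<δ , δ≤ε with cs δ 0<δ | ct δ 0<δ
  ... | M , hM | N , hN = (K ℕ.⊔ L) ℕ.⊔ (M ℕ.⊔ N) , λ m n ≤m ≤n → begin
    dist (s m ℚ.* t m) (s n ℚ.* t n)
      ≤⟨ dist-* (s m) (t m) (s n) (t n) ⟩
    ∣ s m ∣ ℚ.* dist (t m) (t n) ℚ.+ dist (s m) (s n) ℚ.* ∣ t n ∣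
      ≤⟨ ℚ.+-mono-≤
           (*-mono (ℚ.0≤∣p∣ (s m)) (ℚ.<⇒≤ 0<δ) (hA m (≤K ≤m)) (hN m n (≤N ≤m) (≤N ≤n)))
           (*-mono (ℚ.0≤∣p∣ (s m ℚ.- s n)) (0≤ι B) (hM m n (≤M ≤m) (≤M ≤n)) (hB n (≤L ≤n))) ⟩
    ι A ℚ.* δ ℚ.+ δ ℚ.* ι B
      ≡⟨ solve 3 (λ a d b → a :* d :+ d :* b := (a :+ b) :* d) refl (ι A) δ (ι B) ⟩
    (ι A ℚ.+ ι B) ℚ.* δ
      ≡⟨ cong (ℚ._* δ) (ι-+ A B) ⟨
    ι (A ℕ.+ B) ℚ.* δ
      ≤⟨ δ≤ε ⟩
    ε ∎
    where
    open ℚ.≤-Reasoning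
    open +-*-Solver
    KL≤ : ∀ {n} → (K ℕ.⊔ L) ℕ.⊔ (M ℕ.⊔ N) ℕ.≤ n → K ℕ.⊔ L ℕ.≤ n
    KL≤ = ℕ.m⊔n≤o⇒m≤o (K ℕ.⊔ L) (M ℕ.⊔ N)
    MN≤ : ∀ {n} → (K ℕ.⊔ L) ℕ.⊔ (M ℕ.⊔ N) ℕ.≤ n → M ℕ.⊔ N ℕ.≤ n
    MN≤ = ℕ.m⊔n≤o⇒n≤o (K ℕ.⊔ L) (M ℕ.⊔ N)
    ≤K : ∀ {n} → (K ℕ.⊔ L) ℕ.⊔ (M ℕ.⊔ N) ℕ.≤ n → K ℕ.≤ n
    ≤K p = ℕ.m⊔n≤o⇒m≤o K L (KL≤ p)
    ≤L : ∀ {n} → (K ℕ.⊔ L) ℕ.⊔ (M ℕ.⊔ N) ℕ.≤ n → L ℕ.≤ n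
    ≤L p = ℕ.m⊔n≤o⇒n≤o K L (KL≤ p)
    ≤M : ∀ {n} → (K ℕ.⊔ L) ℕ.⊔ (M ℕ.⊔ N) ℕ.≤ n → M ℕ.≤ n
    ≤M p = ℕ.m⊔n≤o⇒m≤o M N (MN≤ p)
    ≤N : ∀ {n} → (K ℕ.⊔ L) ℕ.⊔ (M ℕ.⊔ N) ℕ.≤ n → N ℕ.≤ n
    ≤N p = ℕ.m⊔n≤o⇒n≤o M N (MN≤ p)

-- q^j / j!
term : ℕ → ℚ → ℚ
term zero    q = 1ℚ
term (suc j) q = term j q ℚ.* q ℚ.* inv j

-- the partial sum Σ_{j ≤ n} q^j / j!
expSum : ℕ → ℚ → ℚ
expSum zero    q = 1ℚ
expSum (suc n) q = expSum n q ℚ.+ term (suc n) q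

opaque
  0≤term : ∀ B j → 0ℚ ℚ.≤ term j (ι B)
  0≤term B zero    = ℚ.<⇒≤ (ℚ.positive⁻¹ 1ℚ)
  0≤term B (suc j) = 0≤* (0≤* (0≤term B j) (0≤ι B)) (0≤inv j)

  ∣inv∣ : ∀ j → ∣ inv j ∣ ≡ inv j
  ∣inv∣ j = ℚ.0≤p⇒∣p∣≡p (0≤inv j)

  ∣term∣ : ∀ {q} B → ∣ q ∣ ℚ.≤ ι B → ∀ j → ∣ term j q ∣ ℚ.≤ term j (ι B)
  ∣term∣ B q≤B zero = ℚ.≤-refl
  ∣term∣ {q} B q≤B (suc j) = begin
    ∣ term j q ℚ.* q ℚ.* inv j ∣          ≡⟨ ℚ.∣p*q∣≡∣p∣*∣q∣ (term j q ℚ.* q) (inv j) ⟩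
    ∣ term j q ℚ.* q ∣ ℚ.* ∣ inv j ∣      ≡⟨ cong₂ ℚ._*_ (ℚ.∣p*q∣≡∣p∣*∣q∣ (term j q) q) (∣inv∣ j) ⟩
    ∣ term j q ∣ ℚ.* ∣ q ∣ ℚ.* inv j
      ≤⟨ ℚ.*-monoʳ-≤-nonNeg (inv j) {{ℚ.nonNegative (0≤inv j)}}
           (*-mono (ℚ.0≤∣p∣ (term j q)) (0≤ι B) (∣term∣ B q≤B j) q≤B) ⟩
    term j (ι B) ℚ.* ι B ℚ.* inv j        ∎
    where open ℚ.≤-Reasoning

  term-step : ∀ q j → term j q ℚ.* q ≡ ι (suc j) ℚ.* term (suc j) q
  term-step q j = begin
    term j q ℚ.* q                               ≡⟨ ℚ.*-identityʳ (term j q ℚ.* q) ⟨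
    term j q ℚ.* q ℚ.* 1ℚ                        ≡⟨ cong (term j q ℚ.* q ℚ.*_) (ι*inv j) ⟨
    term j q ℚ.* q ℚ.* (ι (suc j) ℚ.* inv j)
      ≡⟨ solve 4 (λ t q a i → t :* q :* (a :* i) := a :* (t :* q :* i)) refl (term j q) q (ι (suc j)) (inv j) ⟩
    ι (suc j) ℚ.* (term j q ℚ.* q ℚ.* inv j)     ∎
    where
    open ≡-Reasoning
    open +-*-Solver

  dist-self : ∀ q → dist q q ≡ 0ℚ
  dist-self q = cong ∣_∣ (ℚ.+-inverseʳ q)

  dist-*ʳ : ∀ p q {r} → 0ℚ ℚ.≤ r → dist (p ℚ.* r) (q ℚ.* r) ≡ dist p q ℚ.* r
  dist-*ʳ p q {r} 0≤r = begin
    ∣ p ℚ.* r ℚ.- q ℚ.* r ∣     ≡⟨ cong ∣_∣ (solve 3 (λ p q r → p :* r :- q :* r := (p :- q) :* r) refl p q r) ⟩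
    ∣ (p ℚ.- q) ℚ.* r ∣         ≡⟨ ℚ.∣p*q∣≡∣p∣*∣q∣ (p ℚ.- q) r ⟩
    ∣ p ℚ.- q ∣ ℚ.* ∣ r ∣       ≡⟨ cong (dist p q ℚ.*_) (ℚ.0≤p⇒∣p∣≡p 0≤r) ⟩
    dist p q ℚ.* r              ∎
    where
    open ≡-Reasoning
    open +-*-Solver

  dist-+ : ∀ a b c d → dist (a ℚ.+ b) (c ℚ.+ d) ℚ.≤ dist a c ℚ.+ dist b d
  dist-+ a b c d = subst (λ x → ∣ x ∣ ℚ.≤ dist a c ℚ.+ dist b d)
    (solve 4 (λ a b c d → (a :- c) :+ (b :- d) := (a :+ b) :- (c :+ d)) refl a b c d)
    (ℚ.∣p+q∣≤∣p∣+∣q∣ (a ℚ.- c) (b ℚ.- d))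
    where open +-*-Solver

  term-lipschitz : ∀ {x y} B → ∣ x ∣ ℚ.≤ ι B → ∣ y ∣ ℚ.≤ ι B → ∀ j →
    dist (term (suc j) x) (term (suc j) y) ℚ.≤ dist x y ℚ.* term j (ι B)

  term-lipschitz′ : ∀ {x y} B → ∣ x ∣ ℚ.≤ ι B → ∣ y ∣ ℚ.≤ ι B → ∀ j →
    dist (term j x) (term j y) ℚ.* ι B ℚ.≤ dist x y ℚ.* (ι j ℚ.* term j (ι B))
  term-lipschitz′ {x} {y} B x≤ y≤ zero = ℚ.≤-reflexive
    (trans (ℚ.*-zeroˡ (ι B)) (sym (ℚ.*-zeroʳ (dist x y))))
  term-lipschitz′ {x} {y} B x≤ y≤ (suc j) = begin
    dist (term (suc j) x) (term (suc j) y) ℚ.* ι B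
      ≤⟨ ℚ.*-monoʳ-≤-nonNeg (ι B) {{ℚ.nonNegative (0≤ι B)}} (term-lipschitz B x≤ y≤ j) ⟩
    dist x y ℚ.* term j (ι B) ℚ.* ι B
      ≡⟨ ℚ.*-assoc (dist x y) (term j (ι B)) (ι B) ⟩
    dist x y ℚ.* (term j (ι B) ℚ.* ι B)
      ≡⟨ cong (dist x y ℚ.*_) (term-step (ι B) j) ⟩
    dist x y ℚ.* (ι (suc j) ℚ.* term (suc j) (ι B)) ∎
    where open ℚ.≤-Reasoning

  term-lipschitz {x} {y} B x≤ y≤ j = begin
    dist (term j x ℚ.* x ℚ.* inv j) (term j y ℚ.* y ℚ.* inv j)
      ≡⟨ dist-*ʳ (term j x ℚ.* x) (term j y ℚ.* y) (0≤inv j) ⟩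
    dist (term j x ℚ.* x) (term j y ℚ.* y) ℚ.* inv j
      ≤⟨ ℚ.*-monoʳ-≤-nonNeg (inv j) {{ℚ.nonNegative (0≤inv j)}} (begin
        dist (term j x ℚ.* x) (term j y ℚ.* y)
          ≤⟨ dist-* (term j x) x (term j y) y ⟩
        ∣ term j x ∣ ℚ.* dist x y ℚ.+ dist (term j x) (term j y) ℚ.* ∣ y ∣
          ≤⟨ ℚ.+-mono-≤
               (ℚ.*-monoʳ-≤-nonNeg (dist x y) {{ℚ.nonNegative (ℚ.0≤∣p∣ (x ℚ.- y))}} (∣term∣ B x≤ j))
               (ℚ.*-monoˡ-≤-nonNeg (dist (term j x) (term j y)) {{ℚ.nonNegative (ℚ.0≤∣p∣ (term j x ℚ.- term j y))}} y≤) ⟩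
        term j (ι B) ℚ.* dist x y ℚ.+ dist (term j x) (term j y) ℚ.* ι B
          ≤⟨ ℚ.+-monoʳ-≤ (term j (ι B) ℚ.* dist x y) (term-lipschitz′ B x≤ y≤ j) ⟩
        term j (ι B) ℚ.* dist x y ℚ.+ dist x y ℚ.* (ι j ℚ.* term j (ι B)) ∎) ⟩
    (term j (ι B) ℚ.* dist x y ℚ.+ dist x y ℚ.* (ι j ℚ.* term j (ι B))) ℚ.* inv j
      ≡⟨ solve 4 (λ t d a i → (t :* d :+ d :* (a :* t)) :* i := d :* t :* ((con 1ℚ :+ a) :* i)) refl
           (term j (ι B)) (dist x y) (ι j) (inv j) ⟩
    dist x y ℚ.* term j (ι B) ℚ.* ((1ℚ ℚ.+ ι j) ℚ.* inv j)
      ≡⟨ cong (λ a → dist x y ℚ.* term j (ι B) ℚ.* (a ℚ.* inv j)) (ι-+ 1 j) ⟨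
    dist x y ℚ.* term j (ι B) ℚ.* (ι (suc j) ℚ.* inv j)
      ≡⟨ cong (dist x y ℚ.* term j (ι B) ℚ.*_) (ι*inv j) ⟩
    dist x y ℚ.* term j (ι B) ℚ.* 1ℚ
      ≡⟨ ℚ.*-identityʳ (dist x y ℚ.* term j (ι B)) ⟩
    dist x y ℚ.* term j (ι B) ∎
    where
    open ℚ.≤-Reasoning
    open +-*-Solver

  expSum-lipschitz : ∀ {x y} B → ∣ x ∣ ℚ.≤ ι B → ∣ y ∣ ℚ.≤ ι B → ∀ n →
    dist (expSum (suc n) x) (expSum (suc n) y) ℚ.≤ dist x y ℚ.* expSum n (ι B)
  expSum-lipschitz {x} {y} B x≤ y≤ zero = begin
    dist (1ℚ ℚ.+ term 1 x) (1ℚ ℚ.+ term 1 y)            ≤⟨ dist-+ 1ℚ (term 1 x) 1ℚ (term 1 y) ⟩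
    dist 1ℚ 1ℚ ℚ.+ dist (term 1 x) (term 1 y)            ≡⟨ ℚ.+-identityˡ (dist (term 1 x) (term 1 y)) ⟩
    dist (term 1 x) (term 1 y)                           ≤⟨ term-lipschitz B x≤ y≤ 0 ⟩
    dist x y ℚ.* 1ℚ                                      ∎
    where open ℚ.≤-Reasoning
  expSum-lipschitz {x} {y} B x≤ y≤ (suc n) = begin
    dist (expSum (suc n) x ℚ.+ term (suc (suc n)) x) (expSum (suc n) y ℚ.+ term (suc (suc n)) y)
      ≤⟨ dist-+ (expSum (suc n) x) (term (suc (suc n)) x) (expSum (suc n) y) (term (suc (suc n)) y) ⟩
    dist (expSum (suc n) x) (expSum (suc n) y) ℚ.+ dist (term (suc (suc n)) x) (term (suc (suc n)) y)
      ≤⟨ ℚ.+-mono-≤ (expSum-lipschitz B x≤ y≤ n) (term-lipschitz B x≤ y≤ (suc n)) ⟩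
    dist x y ℚ.* expSum n (ι B) ℚ.+ dist x y ℚ.* term (suc n) (ι B)
      ≡⟨ ℚ.*-distribˡ-+ (dist x y) (expSum n (ι B)) (term (suc n) (ι B)) ⟨
    dist x y ℚ.* expSum (suc n) (ι B) ∎
    where open ℚ.≤-Reasoning

  term-halves : ∀ B {m} → B ℕ.+ B ℕ.≤ m →
    term (suc m) (ι B) ℚ.+ term (suc m) (ι B) ℚ.≤ term m (ι B)
  term-halves B {m} 2B≤m = begin
    term m (ι B) ℚ.* ι B ℚ.* inv m ℚ.+ term m (ι B) ℚ.* ι B ℚ.* inv m
      ≡⟨ solve 3 (λ t b i → t :* b :* i :+ t :* b :* i := t :* ((b :+ b) :* i)) refl (term m (ι B)) (ι B) (inv m) ⟩
    term m (ι B) ℚ.* ((ι B ℚ.+ ι B) ℚ.* inv m)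
      ≤⟨ ℚ.*-monoˡ-≤-nonNeg (term m (ι B)) {{ℚ.nonNegative (0≤term B m)}} (begin
        (ι B ℚ.+ ι B) ℚ.* inv m   ≡⟨ cong (ℚ._* inv m) (ι-+ B B) ⟨
        ι (B ℕ.+ B) ℚ.* inv m
          ≤⟨ ℚ.*-monoʳ-≤-nonNeg (inv m) {{ℚ.nonNegative (0≤inv m)}} (ι-mono (ℕ.m≤n⇒m≤1+n 2B≤m)) ⟩
        ι (suc m) ℚ.* inv m       ≡⟨ ι*inv m ⟩
        1ℚ                        ∎) ⟩
    term m (ι B) ℚ.* 1ℚ
      ≡⟨ ℚ.*-identityʳ (term m (ι B)) ⟩
    term m (ι B) ∎
    where
    open ℚ.≤-Reasoning
    open +-*-Solver

  tail : ∀ {x} B → ∣ x ∣ ℚ.≤ ι B → ∀ {n} → B ℕ.+ B ℕ.≤ n → ∀ d →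
    dist (expSum (d ℕ.+ n) x) (expSum n x) ℚ.+ term (d ℕ.+ n) (ι B) ℚ.≤ term n (ι B)
  tail {x} B x≤ {n} 2B≤n zero = ℚ.≤-reflexive
    (trans (cong (ℚ._+ term n (ι B)) (dist-self (expSum n x))) (ℚ.+-identityˡ (term n (ι B))))
  tail {x} B x≤ {n} 2B≤n (suc d) = begin
    dist (expSum (d ℕ.+ n) x ℚ.+ term (suc (d ℕ.+ n)) x) (expSum n x) ℚ.+ term (suc (d ℕ.+ n)) (ι B)
      ≤⟨ ℚ.+-monoˡ-≤ (term (suc (d ℕ.+ n)) (ι B)) (begin
        dist (expSum (d ℕ.+ n) x ℚ.+ term (suc (d ℕ.+ n)) x) (expSum n x)
          ≡⟨ cong ∣_∣ (solve 3 (λ e t f → (e :+ t) :- f := t :+ (e :- f)) refl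
               (expSum (d ℕ.+ n) x) (term (suc (d ℕ.+ n)) x) (expSum n x)) ⟩
        ∣ term (suc (d ℕ.+ n)) x ℚ.+ (expSum (d ℕ.+ n) x ℚ.- expSum n x) ∣
          ≤⟨ ℚ.∣p+q∣≤∣p∣+∣q∣ (term (suc (d ℕ.+ n)) x) (expSum (d ℕ.+ n) x ℚ.- expSum n x) ⟩
        ∣ term (suc (d ℕ.+ n)) x ∣ ℚ.+ dist (expSum (d ℕ.+ n) x) (expSum n x)
          ≤⟨ ℚ.+-monoˡ-≤ (dist (expSum (d ℕ.+ n) x) (expSum n x)) (∣term∣ B x≤ (suc (d ℕ.+ n))) ⟩
        term (suc (d ℕ.+ n)) (ι B) ℚ.+ dist (expSum (d ℕ.+ n) x) (expSum n x) ∎) ⟩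
    (term (suc (d ℕ.+ n)) (ι B) ℚ.+ dist (expSum (d ℕ.+ n) x) (expSum n x)) ℚ.+ term (suc (d ℕ.+ n)) (ι B)
      ≡⟨ solve 2 (λ t e → (t :+ e) :+ t := e :+ (t :+ t)) refl
           (term (suc (d ℕ.+ n)) (ι B)) (dist (expSum (d ℕ.+ n) x) (expSum n x)) ⟩
    dist (expSum (d ℕ.+ n) x) (expSum n x) ℚ.+ (term (suc (d ℕ.+ n)) (ι B) ℚ.+ term (suc (d ℕ.+ n)) (ι B))
      ≤⟨ ℚ.+-monoʳ-≤ (dist (expSum (d ℕ.+ n) x) (expSum n x))
           (term-halves B (ℕ.≤-trans 2B≤n (ℕ.m≤n+m n d))) ⟩
    dist (expSum (d ℕ.+ n) x) (expSum n x) ℚ.+ term (d ℕ.+ n) (ι B)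
      ≤⟨ tail B x≤ 2B≤n d ⟩
    term n (ι B) ∎
    where
    open ℚ.≤-Reasoning
    open +-*-Solver

  tail′ : ∀ {x} B → ∣ x ∣ ℚ.≤ ι B → ∀ {n} → B ℕ.+ B ℕ.≤ n → ∀ d →
    dist (expSum (d ℕ.+ n) x) (expSum n x) ℚ.≤ term n (ι B)
  tail′ {x} B x≤ {n} 2B≤n d = ℚ.≤-trans
    (ℚ.≤-trans (ℚ.≤-reflexive (sym (ℚ.+-identityʳ D))) (ℚ.+-monoʳ-≤ D (0≤term B (d ℕ.+ n))))
    (tail B x≤ 2B≤n d)
    where
    D : ℚ
    D = dist (expSum (d ℕ.+ n) x) (expSum n x)

  term-decay : ∀ B d → ι (suc d) ℚ.* term (d ℕ.+ (B ℕ.+ B)) (ι B) ℚ.≤ term (B ℕ.+ B) (ι B)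
  term-decay B zero = ℚ.≤-reflexive (ℚ.*-identityˡ (term (B ℕ.+ B) (ι B)))
  term-decay B (suc d) = begin
    ι (suc (suc d)) ℚ.* t′
      ≤⟨ ℚ.*-monoʳ-≤-nonNeg t′ {{ℚ.nonNegative (0≤term B (suc d ℕ.+ (B ℕ.+ B)))}}
           (ι-mono (ℕ.s≤s (ℕ.m≤n+m (suc d) d))) ⟩
    ι (suc d ℕ.+ suc d) ℚ.* t′
      ≡⟨ cong (ℚ._* t′) (ι-+ (suc d) (suc d)) ⟩
    (ι (suc d) ℚ.+ ι (suc d)) ℚ.* t′
      ≡⟨ solve 2 (λ a t → (a :+ a) :* t := a :* (t :+ t)) refl (ι (suc d)) t′ ⟩
    ι (suc d) ℚ.* (t′ ℚ.+ t′)
      ≤⟨ ℚ.*-monoˡ-≤-nonNeg (ι (suc d)) {{ℚ.nonNegative (0≤ι (suc d))}} (term-halves B (ℕ.m≤n+m (B ℕ.+ B) d)) ⟩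
    ι (suc d) ℚ.* term (d ℕ.+ (B ℕ.+ B)) (ι B)
      ≤⟨ term-decay B d ⟩
    term (B ℕ.+ B) (ι B) ∎
    where
    open ℚ.≤-Reasoning
    open +-*-Solver
    t′ : ℚ
    t′ = term (suc d ℕ.+ (B ℕ.+ B)) (ι B)

  term-small : ∀ B {δ} → 0ℚ ℚ.< δ → ∃ λ N → ∀ n → N ℕ.≤ n → term n (ι B) ℚ.≤ δ
  term-small B {δ} 0<δ with archimedean (term (B ℕ.+ B) (ι B)) 0<δ
  ... | d₀ , h = d₀ ℕ.+ (B ℕ.+ B) , small
    where
    open ℚ.≤-Reasoning
    small′ : ∀ d → d₀ ℕ.≤ d → term (d ℕ.+ (B ℕ.+ B)) (ι B) ℚ.≤ δ
    small′ d d₀≤d = ℚ.*-cancelˡ-≤-pos (ι (suc d))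
      {{ℚ.positive (ℚ.<-≤-trans (ℚ.positive⁻¹ 1ℚ) (ι-mono {1} {suc d} (ℕ.s≤s ℕ.z≤n)))}} (begin
        ι (suc d) ℚ.* term (d ℕ.+ (B ℕ.+ B)) (ι B)  ≤⟨ term-decay B d ⟩
        term (B ℕ.+ B) (ι B)                        ≤⟨ h ⟩
        ι d₀ ℚ.* δ
          ≤⟨ ℚ.*-monoʳ-≤-nonNeg δ {{ℚ.nonNegative (ℚ.<⇒≤ 0<δ)}} (ι-mono (ℕ.m≤n⇒m≤1+n d₀≤d)) ⟩
        ι (suc d) ℚ.* δ                             ∎)
    small : ∀ n → d₀ ℕ.+ (B ℕ.+ B) ℕ.≤ n → term n (ι B) ℚ.≤ δ
    small n p = subst (λ m → term m (ι B) ℚ.≤ δ) (ℕ.m∸n+n≡m (ℕ.≤-trans (ℕ.m≤n+m (B ℕ.+ B) d₀) p))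
      (small′ (n ℕ.∸ (B ℕ.+ B)) (ℕ.m+n≤o⇒m≤o∸n d₀ p))

  expSum-bounded : ∀ B → ∃ λ K → ∀ n → B ℕ.+ B ℕ.≤ n → expSum n (ι B) ℚ.≤ ι K
  expSum-bounded B with above (term (B ℕ.+ B) (ι B) ℚ.+ expSum (B ℕ.+ B) (ι B))
  ... | K , h = K , bound
    where
    open ℚ.≤-Reasoning
    open +-*-Solver
    p≤∣p∣ : ∀ p → p ℚ.≤ ∣ p ∣
    p≤∣p∣ p with ℚ.∣p∣≡p∨∣p∣≡-p p
    ... | inj₁ e = ℚ.≤-reflexive (sym e)
    ... | inj₂ e with ℚ.≤-total 0ℚ p
    ...   | inj₁ 0≤p = ℚ.≤-reflexive (sym (ℚ.0≤p⇒∣p∣≡p 0≤p))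
    ...   | inj₂ p≤0 = ℚ.≤-trans p≤0 (ℚ.0≤∣p∣ p)
    bound : ∀ n → B ℕ.+ B ℕ.≤ n → expSum n (ι B) ℚ.≤ ι K
    bound n p = subst (λ m → expSum m (ι B) ℚ.≤ ι K) (ℕ.m∸n+n≡m p) (begin
      expSum m (ι B)
        ≡⟨ solve 2 (λ e f → e := (e :- f) :+ f) refl (expSum m (ι B)) (expSum (B ℕ.+ B) (ι B)) ⟩
      (expSum m (ι B) ℚ.- expSum (B ℕ.+ B) (ι B)) ℚ.+ expSum (B ℕ.+ B) (ι B)
        ≤⟨ ℚ.+-monoˡ-≤ (expSum (B ℕ.+ B) (ι B)) (ℚ.≤-trans (p≤∣p∣ (expSum m (ι B) ℚ.- expSum (B ℕ.+ B) (ι B)))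
             (tail′ B (ℚ.≤-reflexive (ℚ.0≤p⇒∣p∣≡p (0≤ι B))) ℕ.≤-refl (n ℕ.∸ (B ℕ.+ B)))) ⟩
      term (B ℕ.+ B) (ι B) ℚ.+ expSum (B ℕ.+ B) (ι B)
        ≤⟨ h ⟩
      ι K ∎)
      where
      m : ℕ
      m = (n ℕ.∸ (B ℕ.+ B)) ℕ.+ (B ℕ.+ B)

opaque
  one-sided : ∀ {s} → (∀ ε → 0ℚ ℚ.< ε → ∃ λ N → ∀ n → N ℕ.≤ n → ∀ d → dist (s (d ℕ.+ n)) (s n) ℚ.≤ ε) →
    IsCauchy s
  one-sided {s} h ε 0<ε with h ε 0<ε
  ... | N , hN = N , λ m n N≤m N≤n → go m n N≤m N≤n (ℕ.≤-total n m)
    where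
    half : ∀ m n → N ℕ.≤ n → n ℕ.≤ m → dist (s m) (s n) ℚ.≤ ε
    half m n N≤n n≤m = subst (λ m → dist (s m) (s n) ℚ.≤ ε) (ℕ.m∸n+n≡m n≤m) (hN n N≤n (m ℕ.∸ n))
    go : ∀ m n → N ℕ.≤ m → N ℕ.≤ n → (n ℕ.≤ m) ⊎ (m ℕ.≤ n) → dist (s m) (s n) ℚ.≤ ε
    go m n N≤m N≤n (inj₁ n≤m) = half m n N≤n n≤m
    go m n N≤m N≤n (inj₂ m≤n) = subst (ℚ._≤ ε) (dist-sym (s n) (s m)) (half n m N≤m m≤n)

opaque
  exp-cauchy : ∀ {s} → IsCauchy s → IsCauchy (λ n → expSum n (s n))
  exp-cauchy {s} cs = one-sided {λ n → expSum n (s n)} oscillation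
    where
    open ℚ.≤-Reasoning
    open +-*-Solver
    oscillation : ∀ ε → 0ℚ ℚ.< ε → ∃ λ N → ∀ n → N ℕ.≤ n → ∀ d →
      dist (expSum (d ℕ.+ n) (s (d ℕ.+ n))) (expSum n (s n)) ℚ.≤ ε
    oscillation ε 0<ε with bounded {s} cs
    ... | B , N₁ , hB with expSum-bounded B | shrink 0<ε 2
    ... | K , hK | η , 0<η , 2η≤ε with shrink 0<η K | term-small B 0<η
    ... | δ , 0<δ , Kδ≤η | N₃ , h₃ with cs δ 0<δ
    ... | N₂ , h₂ = suc ((B ℕ.+ B) ℕ.+ (N₁ ℕ.+ (N₂ ℕ.+ N₃))) , main
      where
      main : ∀ n → suc ((B ℕ.+ B) ℕ.+ (N₁ ℕ.+ (N₂ ℕ.+ N₃))) ℕ.≤ n → ∀ d →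
        dist (expSum (d ℕ.+ n) (s (d ℕ.+ n))) (expSum n (s n)) ℚ.≤ ε
      main (suc n) (ℕ.s≤s p) d = begin
        dist (expSum m (s m)) (expSum (suc n) (s (suc n)))
          ≤⟨ triangle (expSum m (s m)) (expSum m (s (suc n))) (expSum (suc n) (s (suc n))) ⟩
        dist (expSum m (s m)) (expSum m (s (suc n))) ℚ.+ dist (expSum m (s (suc n))) (expSum (suc n) (s (suc n)))
          ≤⟨ ℚ.+-mono-≤ close (ℚ.≤-trans
               (tail′ B (hB (suc n) (ℕ.m≤n⇒m≤1+n N₁≤n)) (ℕ.m≤n⇒m≤1+n 2B≤n) d)
               (h₃ (suc n) (ℕ.m≤n⇒m≤1+n N₃≤n))) ⟩
        η ℚ.+ η
          ≡⟨ ι2 η ⟩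
        ι 2 ℚ.* η
          ≤⟨ 2η≤ε ⟩
        ε ∎
        where
        m : ℕ
        m = d ℕ.+ suc n
        2B≤n : B ℕ.+ B ℕ.≤ n
        2B≤n = ℕ.m+n≤o⇒m≤o (B ℕ.+ B) p
        rest : N₁ ℕ.+ (N₂ ℕ.+ N₃) ℕ.≤ n
        rest = ℕ.m+n≤o⇒n≤o (B ℕ.+ B) p
        N₁≤n : N₁ ℕ.≤ n
        N₁≤n = ℕ.m+n≤o⇒m≤o N₁ rest
        N₂≤n : N₂ ℕ.≤ n
        N₂≤n = ℕ.m+n≤o⇒m≤o N₂ (ℕ.m+n≤o⇒n≤o N₁ rest)
        N₃≤n : N₃ ℕ.≤ n
        N₃≤n = ℕ.m+n≤o⇒n≤o N₂ (ℕ.m+n≤o⇒n≤o N₁ rest)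
        up : ∀ {N} → N ℕ.≤ n → N ℕ.≤ d ℕ.+ n
        up N≤n = ℕ.≤-trans N≤n (ℕ.m≤n+m n d)
        close : dist (expSum m (s m)) (expSum m (s (suc n))) ℚ.≤ η
        close = subst (λ k → dist (expSum k (s k)) (expSum k (s (suc n))) ℚ.≤ η) (sym (ℕ.+-suc d n)) (begin
          dist (expSum (suc (d ℕ.+ n)) (s (suc (d ℕ.+ n)))) (expSum (suc (d ℕ.+ n)) (s (suc n)))
            ≤⟨ expSum-lipschitz B (hB (suc (d ℕ.+ n)) (ℕ.m≤n⇒m≤1+n (up N₁≤n))) (hB (suc n) (ℕ.m≤n⇒m≤1+n N₁≤n)) (d ℕ.+ n) ⟩
          dist (s (suc (d ℕ.+ n))) (s (suc n)) ℚ.* expSum (d ℕ.+ n) (ι B)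
            ≤⟨ *-mono (ℚ.0≤∣p∣ (s (suc (d ℕ.+ n)) ℚ.- s (suc n))) (0≤ι K)
                 (h₂ (suc (d ℕ.+ n)) (suc n) (ℕ.m≤n⇒m≤1+n (up N₂≤n)) (ℕ.m≤n⇒m≤1+n N₂≤n))
                 (hK (d ℕ.+ n) (up 2B≤n)) ⟩
          δ ℚ.* ι K
            ≡⟨ ℚ.*-comm δ (ι K) ⟩
          ι K ℚ.* δ
            ≤⟨ Kδ≤η ⟩
          η ∎)

-- Real numbers as Cauchy sequences of rationals, used up to _≃_.  All
-- operations act termwise.
record ℝ : Set where
  constructor mkℝ
  field
    seq    : ℕ → ℚ
    cauchy : IsCauchy seq

open ℝ public

infixl 6 _+_
infixl 7 _*_
infix  4 _≤_ _<_ _≃_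

fromℚ : ℚ → ℝ
fromℚ q = mkℝ (λ _ → q) (const-cauchy q)

fromℕ : ℕ → ℝ
fromℕ n = fromℚ (ι n)

0ℝ 1ℝ : ℝ
0ℝ = fromℕ 0
1ℝ = fromℕ 1

_+_ : ℝ → ℝ → ℝ
x + y = mkℝ (λ n → seq x n ℚ.+ seq y n) (+-cauchy {seq x} {seq y} (cauchy x) (cauchy y))

_*_ : ℝ → ℝ → ℝ
x * y = mkℝ (λ n → seq x n ℚ.* seq y n) (*-cauchy {seq x} {seq y} (cauchy x) (cauchy y))

-- The diagonal n ↦ Σ_{j ≤ n} xₙ^j / j! of the exponential series.
exp : ℝ → ℝ
exp x = mkℝ (λ n → expSum n (seq x n)) (exp-cauchy {seq x} (cauchy x))

_≤_ : ℝ → ℝ → Set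
x ≤ y = ∀ δ → 0ℚ ℚ.< δ → ∃ λ N → ∀ n → N ℕ.≤ n → seq x n ℚ.≤ seq y n ℚ.+ δ

_<_ : ℝ → ℝ → Set
x < y = ∃ λ δ → 0ℚ ℚ.< δ × ∃ λ N → ∀ n → N ℕ.≤ n → seq x n ℚ.+ δ ℚ.≤ seq y n

_≃_ : ℝ → ℝ → Set
x ≃ y = x ≤ y × y ≤ x

-- ℓ is the natural logarithm of x.
IsLog : ℝ → ℝ → Set
IsLog ℓ x = exp ℓ ≃ x

∑ : {A : Set} → List A → (A → ℝ) → ℝ
∑ xs f = foldr (λ a r → f a + r) 0ℝ xs

-- Finite simple graphs with vertex set Fin n.
record Graph (n : ℕ) : Set where
  field
    adj        : Fin n → Fin n → Bool
    adj-sym    : ∀ u v → adj u v ≡ adj v u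
    adj-irrefl : ∀ v → adj v v ≡ false

open Graph public

Adj : ∀ {n} → Graph n → Fin n → Fin n → Set
Adj G u v = T (adj G u v)

Connected : ∀ {n} → Graph n → Set
Connected G = ∀ u v → Star (Adj G) u v

-- E △ E′, each edge {u,v} being listed once, as the pair with u < v.
edgeDiff : ∀ {n} → Graph n → Graph n → List (Fin n × Fin n)
edgeDiff {n} G G′ =
  filter (λ { (u , v) → (u Fin.<? v) ×-dec ¬? (adj G u v Bool.≟ adj G′ u v) })
         (cartesianProduct (allFin n) (allFin n))

Neighbors : ∀ {n} → Graph n → Graph n → Set
Neighbors G G′ = length (edgeDiff G G′) ℕ.≤ 1

-- A subgraph of G isomorphic to H is given by an injective, edge-preserving
-- map φ : V(H) → V(G), namely as the image of H under φ.
IsCopy : ∀ {h n} → Graph h → Graph n → Vec (Fin n) h → Set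
IsCopy H G φ =
  (∀ u v → lookup φ u ≡ lookup φ v → u ≡ v) ×
  (∀ u v → Adj H u v → Adj G (lookup φ u) (lookup φ v))

VertexDisjoint : ∀ {h n m} → Vec (Vec (Fin n) h) m → Set
VertexDisjoint φs =
  ∀ i j → i ≢ j → ∀ u v → lookup (lookup φs i) u ≢ lookup (lookup φs j) v

Packing : ∀ {h n} → Graph h → Graph n → ℕ → Set
Packing {h} {n} H G m = ∃ λ (φs : Vec (Vec (Fin n) h) m) →
  (∀ i → IsCopy H G (lookup φs i)) × VertexDisjoint φs

isCopy? : ∀ {h n} (H : Graph h) (G : Graph n) → Decidable (IsCopy H G)
isCopy? H G φ =
  Fin.all? (λ u → Fin.all? λ v → (lookup φ u Fin.≟ lookup φ v) →-dec (u Fin.≟ v)) ×-dec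
  Fin.all? (λ u → Fin.all? λ v → T? (adj H u v) →-dec T? (adj G (lookup φ u) (lookup φ v)))

vertexDisjoint? : ∀ {h n m} → Decidable (VertexDisjoint {h} {n} {m})
vertexDisjoint? φs = Fin.all? λ i → Fin.all? λ j → ¬? (i Fin.≟ j) →-dec
  Fin.all? λ u → Fin.all? λ v → ¬? (lookup (lookup φs i) u Fin.≟ lookup (lookup φs j) v)

Searchable : Set → Set₁
Searchable A = ∀ {P : A → Set} → Decidable P → Dec (∃ P)

searchVec : ∀ {A} → Searchable A → ∀ m → Searchable (Vec A m)
searchVec any? zero    P? = map′ ([] ,_) (λ { ([] , p) → p }) (P? [])
searchVec any? (suc m) P? =
  map′ (λ { (x , xs , p) → x ∷ xs , p }) (λ { (x ∷ xs , p) → x , xs , p })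
       (any? λ x → searchVec any? m λ xs → P? (x ∷ xs))

packing? : ∀ {h n} (H : Graph h) (G : Graph n) → Decidable (Packing H G)
packing? {h} H G m = searchVec (searchVec Fin.any? h) m λ φs →
  Fin.all? (λ i → isCopy? H G (lookup φs i)) ×-dec vertexDisjoint? φs

-- When H has a vertex, a packing has at most n copies, so that no size
-- beyond n has to be considered.
opt : ∀ {h n} → Graph h → Graph n → ℕ
opt {n = n} H G = max 0 (filter (packing? H G) (upTo (suc n)))

Coloring : ℕ → ℕ → Set
Coloring n k = Vec (Fin k) n

colorings : ∀ n k → List (Coloring n k)
colorings zero    k = [] ∷ []
colorings (suc n) k = cartesianProductWith _∷_ (allFin k) (colorings n k)

MonochromaticCopy : ∀ {h n k} → Graph h → Graph n → Coloring n k → Fin k → Set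
MonochromaticCopy {h} {n} H G c i = ∃ λ (φ : Vec (Fin n) h) →
  IsCopy H G φ × (∀ u → lookup c (lookup φ u) ≡ i)

monochromaticCopy? : ∀ {h n k} (H : Graph h) (G : Graph n) (c : Coloring n k) →
  Decidable (MonochromaticCopy H G c)
monochromaticCopy? {h} H G c i = searchVec Fin.any? h λ φ →
  isCopy? H G φ ×-dec Fin.all? (λ u → lookup c (lookup φ u) Fin.≟ i)

decode : ∀ {h n k} → Graph h → Graph n → Coloring n k → List (Vec (Fin n) h)
decode {k = k} H G c =
  mapMaybe (λ i → Maybe.map proj₁ (dec⇒maybe (monochromaticCopy? H G c i))) (allFin k)

-- The law of a random coloring: the outcome space is finite, so it is given
-- by point masses, and an event is a Boolean predicate.
record Distribution (n k : ℕ) : Set where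
  field
    mass    : Coloring n k → ℝ
    mass≥0  : ∀ c → 0ℝ ≤ mass c
    total≃1 : ∑ (colorings n k) mass ≃ 1ℝ

open Distribution public

Pr : ∀ {n k} → Distribution n k → (Coloring n k → Bool) → ℝ
Pr {n} {k} μ S = ∑ (filterᵇ S (colorings n k)) (mass μ)

𝔼 : ∀ {n k} → Distribution n k → (Coloring n k → ℝ) → ℝ
𝔼 {n} {k} μ X = ∑ (colorings n k) (λ c → mass μ c * X c)

-- The encoder at target size k: an output law for every input graph, with no
-- computational restriction.
Encoder : ℕ → Set
Encoder k = ∀ n → Graph n → Distribution n k

DifferentiallyPrivate : ∀ {k} → ℝ → Encoder k → Set
DifferentiallyPrivate {k} ε 𝓔 = ∀ n (G G′ : Graph n) → Neighbors G G′ →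
  (S : Coloring n k → Bool) → Pr (𝓔 n G) S ≤ exp ε * Pr (𝓔 n G′) S

HasRatio : ∀ {h k} → Graph h → Encoder k → ℝ → Set
HasRatio {k = k} H 𝓔 α = ∀ n (G : Graph n) → k ℕ.≤ opt H G →
  α * fromℕ k ≤ 𝔼 (𝓔 n G) (λ c → fromℕ (length (decode H G c)))

module Submission where

-- Place k disjoint copies of H ("blocks") at random: the first vertex of block b
-- goes to a random cell of a row of N cells, its other vertices to a common
-- random column of the remaining rows. Every copy of H in this graph is a whole
-- block, as H is connected, so a color is counted by the decoder only if it is
-- shared by the cells of the first two vertices of some block. Moving one block
-- changes a bounded number D of edges, hence probabilities by a factor at most
-- exp (D ε) ≤ 1 + (k − 1) / 50, by convexity of exp and the choice of c. So, up to
-- that factor, a block is independent of the coloring, and it is monochromatic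
-- in color i with probability at most (s i / 2N)², where s i is the number of
-- cells of color i in the first two rows. For any set S of colors, the expected
-- number of counted colors is thus at most the expectation of
--   ∣S∣ + k (1 + (k − 1) / 50) ∑_{i ∉ S} (s i / 2N)²,
-- and for a suitable S, depending on the coloring, this is at most 3k/5. Taking
-- the two coordinates of the blocks independent and uniform costs a factor 9/10
-- for possible collisions when N = 10 k², and (3/5) / (9/10) = 2/3.

open import Algebra.Bundles using (CommutativeSemiring)
open import Algebra.Structures.Biased using (module IsCommutativeSemiringˡ)
open import Data.Bool as Bool using (Bool; true; false; T; not; _∧_; if_then_else_)
open import Data.Empty using (⊥; ⊥-elim)
open import Data.Fin as Fin using (Fin; zero; suc; combine)
import Data.Fin.Properties as Fin
open import Data.List as List
  using (List; []; _∷_; _++_; length; map; mapMaybe; filter; filterᵇ; allFin; cartesianProduct; cartesianProductWith; upTo)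
open import Data.List.Extrema.Nat using (max; v≤max⁺)
open import Data.List.Membership.Propositional using (_∈_; find; lose)
open import Data.List.Membership.Propositional.Properties
  using (∈-allFin; ∈-filter⁺; ∈-filter⁻; ∈-map⁺; ∈-map⁻; ∈-cartesianProduct⁺; ∈-upTo⁺; ∈-++⁺ˡ; ∈-++⁺ʳ; ∈-++⁻)
import Data.List.Properties as List
open import Data.List.Relation.Unary.All as All using (All; []; _∷_)
open import Data.List.Relation.Unary.All.Properties using (all-filter)
open import Data.List.Relation.Unary.AllPairs using ([]; _∷_)
open import Data.List.Relation.Unary.Any as Any using (Any; here; there)
open import Data.List.Relation.Unary.Any.Properties using (++⁺ˡ; ++⁺ʳ; ++⁻)
open import Data.List.Relation.Unary.Unique.Propositional using (Unique)
open import Data.List.Relation.Unary.Unique.Propositional.Properties using (allFin⁺; cartesianProduct⁺; filter⁺)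
open import Data.Maybe as Maybe using (Maybe; just; nothing)
open import Data.Nat as ℕ using (ℕ; zero; suc; z≤n; s≤s)
import Data.Nat.Properties as ℕ
open import Data.Nat.Tactic.RingSolver using (solve-∀)
open import Data.Product using (∃; _×_; _,_; proj₁; proj₂)
open import Data.Rational as ℚ using (ℚ; 0ℚ; 1ℚ; ∣_∣)
import Data.Rational.Properties as ℚ
open import Data.Rational.Solver using (module +-*-Solver)
open import Data.Sum using (_⊎_; inj₁; inj₂; swap; [_,_]′)
open import Data.Vec as Vec using (Vec; []; _∷_; lookup; tabulate; _[_]≔_)
open import Data.Vec.Membership.Propositional.Properties using (∈-lookup; ∈-toList⁺)
import Data.Vec.Properties as Vec
open import Function using (_∘_; id)
open import Function.Bundles using (mk⇔)
open import Level using (0ℓ)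
open import Relation.Binary.Bundles using (Preorder)
open import Relation.Binary.Construct.Closure.ReflexiveTransitive as Star using (Star)
open import Relation.Binary.PropositionalEquality
  using (_≡_; _≢_; refl; sym; trans; cong; cong₂; subst; subst₂; ≢-sym; module ≡-Reasoning)
import Relation.Binary.Reasoning.Preorder as PreorderReasoning
import Relation.Binary.Reasoning.Setoid as SetoidReasoning
open import Relation.Binary.Structures using (IsEquivalence)
open import Relation.Nullary using (Dec; yes; no; does; ¬_; ¬?)
open import Relation.Nullary.Decidable
  using (dec⇒maybe; _×-dec_; _⊎-dec_; toWitness; fromWitness; dec-true; dec-false; does-⇔; isYes≗does; T?)
open import Relation.Unary using (Decidable)

-- Finite sums

-- The first vertex of a block needs a coordinate of its own: if a block filled one column, giving
-- each column a single color would make every block monochromatic without looking at the graph.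
-- With two independent coordinates the encoder has to guess which cells of the two rows belong
-- together. A single c must serve all k, so the privacy factor has to be close to 1 at k = 2 but
-- may grow with k. The chord of exp provides this: 50 e^(Dε) ≤ 49 + e^(50Dε) ≤ 49 + k once 50Dε ≤
-- log k. At k = 1 the premises contradict each other, since log 1 = 0 < ε. The value 3k/5 arises as
-- follows. Let p i = s i / 2N, so that the p i add up to 1, and A = k (49 + k) / 50. A color costs
-- 1 inside S and A (p i)² outside it. The smaller of the two is at most √A p i, which adds up to
-- √A, and √A ≤ 3k/5 means 49 + k ≤ 18k, that is k ≥ 3. For k = 2 a case distinction on whether one
-- color has more than 7/10 of the cells replaces this estimate.

module Sum (R : CommutativeSemiring 0ℓ 0ℓ) where
  open CommutativeSemiring R renaming (Carrier to C; _+_ to _⊕_; _*_ to _⊗_)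
  open SetoidReasoning setoid

  Σ[_]_ : {A : Set} → List A → (A → C) → C
  Σ[ xs ] f = List.foldr (λ a r → f a ⊕ r) 0# xs

  interchange : ∀ a b c d → (a ⊕ b) ⊕ (c ⊕ d) ≈ (a ⊕ c) ⊕ (b ⊕ d)
  interchange a b c d = begin
    (a ⊕ b) ⊕ (c ⊕ d)  ≈⟨ +-assoc a b (c ⊕ d) ⟩
    a ⊕ (b ⊕ (c ⊕ d))  ≈⟨ +-congˡ (+-assoc b c d) ⟨
    a ⊕ ((b ⊕ c) ⊕ d)  ≈⟨ +-congˡ (+-congʳ (+-comm b c)) ⟩
    a ⊕ ((c ⊕ b) ⊕ d)  ≈⟨ +-congˡ (+-assoc c b d) ⟩
    a ⊕ (c ⊕ (b ⊕ d))  ≈⟨ +-assoc a c (b ⊕ d) ⟨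
    (a ⊕ c) ⊕ (b ⊕ d)  ∎

  Σ-cong : ∀ {A : Set} (xs : List A) {f g : A → C} → (∀ a → f a ≈ g a) → Σ[ xs ] f ≈ Σ[ xs ] g
  Σ-cong []       eq = Setoid-refl where Setoid-refl = CommutativeSemiring.refl R
  Σ-cong (x ∷ xs) eq = +-cong (eq x) (Σ-cong xs eq)

  Σ-zero : ∀ {A : Set} (xs : List A) → Σ[ xs ] (λ _ → 0#) ≈ 0#
  Σ-zero []       = CommutativeSemiring.refl R
  Σ-zero (x ∷ xs) = CommutativeSemiring.trans R (+-identityˡ _) (Σ-zero xs)

  Σ-+ : ∀ {A : Set} (xs : List A) (f g : A → C) → Σ[ xs ] (λ a → f a ⊕ g a) ≈ Σ[ xs ] f ⊕ Σ[ xs ] g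
  Σ-+ []       f g = CommutativeSemiring.sym R (+-identityˡ 0#)
  Σ-+ (x ∷ xs) f g = begin
    (f x ⊕ g x) ⊕ Σ[ xs ] (λ a → f a ⊕ g a)   ≈⟨ +-congˡ (Σ-+ xs f g) ⟩
    (f x ⊕ g x) ⊕ (Σ[ xs ] f ⊕ Σ[ xs ] g)     ≈⟨ interchange (f x) (g x) _ _ ⟩
    (f x ⊕ Σ[ xs ] f) ⊕ (g x ⊕ Σ[ xs ] g)     ∎

  Σ-*ˡ : ∀ {A : Set} (xs : List A) c (f : A → C) → Σ[ xs ] (λ a → c ⊗ f a) ≈ c ⊗ Σ[ xs ] f
  Σ-*ˡ []       c f = CommutativeSemiring.sym R (zeroʳ c)
  Σ-*ˡ (x ∷ xs) c f = begin
    c ⊗ f x ⊕ Σ[ xs ] (λ a → c ⊗ f a)   ≈⟨ +-congˡ (Σ-*ˡ xs c f) ⟩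
    c ⊗ f x ⊕ c ⊗ Σ[ xs ] f             ≈⟨ distribˡ c (f x) _ ⟨
    c ⊗ (f x ⊕ Σ[ xs ] f)               ∎

  Σ-*ʳ : ∀ {A : Set} (xs : List A) c (f : A → C) → Σ[ xs ] (λ a → f a ⊗ c) ≈ Σ[ xs ] f ⊗ c
  Σ-*ʳ xs c f = begin
    Σ[ xs ] (λ a → f a ⊗ c)   ≈⟨ Σ-cong xs (λ a → *-comm (f a) c) ⟩
    Σ[ xs ] (λ a → c ⊗ f a)   ≈⟨ Σ-*ˡ xs c f ⟩
    c ⊗ Σ[ xs ] f             ≈⟨ *-comm c _ ⟩
    Σ[ xs ] f ⊗ c             ∎

  Σ-swap : ∀ {A B : Set} (xs : List A) (ys : List B) (f : A → B → C) →
    Σ[ xs ] (λ a → Σ[ ys ] (f a)) ≈ Σ[ ys ] (λ b → Σ[ xs ] (λ a → f a b))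
  Σ-swap []       ys f = CommutativeSemiring.sym R (Σ-zero ys)
  Σ-swap (x ∷ xs) ys f = begin
    Σ[ ys ] (f x) ⊕ Σ[ xs ] (λ a → Σ[ ys ] (f a))           ≈⟨ +-congˡ (Σ-swap xs ys f) ⟩
    Σ[ ys ] (f x) ⊕ Σ[ ys ] (λ b → Σ[ xs ] (λ a → f a b))   ≈⟨ Σ-+ ys (f x) _ ⟨
    Σ[ ys ] (λ b → f x b ⊕ Σ[ xs ] (λ a → f a b))           ∎

  Σ-++ : ∀ {A : Set} (xs ys : List A) (f : A → C) → Σ[ xs ++ ys ] f ≈ Σ[ xs ] f ⊕ Σ[ ys ] f
  Σ-++ []       ys f = CommutativeSemiring.sym R (+-identityˡ _)
  Σ-++ (x ∷ xs) ys f = CommutativeSemiring.trans R (+-congˡ (Σ-++ xs ys f))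
    (CommutativeSemiring.sym R (+-assoc (f x) _ _))

  Σ-map : ∀ {A B : Set} (g : A → B) (xs : List A) (f : B → C) → Σ[ map g xs ] f ≈ Σ[ xs ] (f ∘ g)
  Σ-map g []       f = CommutativeSemiring.refl R
  Σ-map g (x ∷ xs) f = +-congˡ (Σ-map g xs f)

  Σ-product : ∀ {A B D : Set} (g : A → B → D) (xs : List A) (ys : List B) (f : D → C) →
    Σ[ cartesianProductWith g xs ys ] f ≈ Σ[ xs ] (λ a → Σ[ ys ] (f ∘ g a))
  Σ-product g []       ys f = CommutativeSemiring.refl R
  Σ-product g (x ∷ xs) ys f = begin
    Σ[ map (g x) ys ++ cartesianProductWith g xs ys ] f               ≈⟨ Σ-++ (map (g x) ys) _ f ⟩
    Σ[ map (g x) ys ] f ⊕ Σ[ cartesianProductWith g xs ys ] f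
      ≈⟨ +-cong (Σ-map (g x) ys f) (Σ-product g xs ys f) ⟩
    Σ[ ys ] (f ∘ g x) ⊕ Σ[ xs ] (λ a → Σ[ ys ] (f ∘ g a))             ∎

module ℕΣ = Sum ℕ.+-*-commutativeSemiring
open ℕΣ using (Σ[_]_)

ind : Bool → ℕ
ind b = if b then 1 else 0

-- Color classes and collisions

module Counting where
  open import Data.Nat using (_+_; _*_; _≤_; _<_)
  open import Data.Nat.Properties

  Σ-mono : ∀ {A : Set} (xs : List A) {f g : A → ℕ} → (∀ a → f a ≤ g a) → Σ[ xs ] f ≤ Σ[ xs ] g
  Σ-mono []       h = z≤n
  Σ-mono (x ∷ xs) h = +-mono-≤ (h x) (Σ-mono xs h)

  Σ-const : ∀ {A : Set} (xs : List A) c → Σ[ xs ] (λ _ → c) ≡ length xs * c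
  Σ-const []       c = refl
  Σ-const (x ∷ xs) c = cong (c +_) (Σ-const xs c)

  ∈⇒≤Σ : ∀ {A : Set} {xs : List A} {x} (f : A → ℕ) → x ∈ xs → f x ≤ Σ[ xs ] f
  ∈⇒≤Σ {xs = x ∷ xs} f (here refl) = m≤m+n (f x) _
  ∈⇒≤Σ {xs = y ∷ xs} f (there x∈xs) = ≤-trans (∈⇒≤Σ f x∈xs) (m≤n+m _ (f y))

  Σ-allFin-suc : ∀ n (f : Fin (suc n) → ℕ) → Σ[ allFin (suc n) ] f ≡ f zero + Σ[ allFin n ] (f ∘ suc)
  Σ-allFin-suc n f = cong (f zero +_)
    (trans (cong (λ xs → Σ[ xs ] f) (sym (List.map-tabulate id suc))) (ℕΣ.Σ-map suc (allFin n) f))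

  ⟦_≟_⟧ : ∀ {n} → Fin n → Fin n → ℕ
  ⟦ i ≟ j ⟧ = ind (does (i Fin.≟ j))

  Σ-⟦≟⟧ : ∀ {n} (j : Fin n) → Σ[ allFin n ] (λ i → ⟦ j ≟ i ⟧) ≡ 1
  Σ-⟦≟⟧ {suc n} zero    = trans (Σ-allFin-suc n (λ i → ⟦ zero ≟ i ⟧)) (cong suc (ℕΣ.Σ-zero (allFin n)))
  Σ-⟦≟⟧ {suc n} (suc j) = trans (Σ-allFin-suc n (λ i → ⟦ suc j ≟ i ⟧)) (Σ-⟦≟⟧ j)

  ⟦≟⟧-refl : ∀ {n} (i : Fin n) → ⟦ i ≟ i ⟧ ≡ 1
  ⟦≟⟧-refl i = cong ind (dec-true (i Fin.≟ i) refl)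

  -- The difference of the two sides is (b - a)(d - c).
  rearrangement : ∀ {a b c d} → a ≤ b → c ≤ d → a * d + b * c ≤ a * c + b * d
  rearrangement {a} {b} {c} {d} a≤b c≤d = subst₂ (λ b d → a * d + b * c ≤ a * c + b * d)
    (m+[n∸m]≡n a≤b) (m+[n∸m]≡n c≤d) (step a c (b ℕ.∸ a) (d ℕ.∸ c))
    where
    step : ∀ a c u v → a * (c + v) + (a + u) * c ≤ a * c + (a + u) * (c + v)
    step a c u v = subst (a * (c + v) + (a + u) * c ≤_) (eq a c u v) (m≤m+n _ (u * v))
      where
      eq : ∀ a c u v → a * (c + v) + (a + u) * c + u * v ≡ a * c + (a + u) * (c + v)
      eq = solve-∀

  4ab≤[a+b]² : ∀ a b → 4 * (a * b) ≤ (a + b) * (a + b)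
  4ab≤[a+b]² a b with ≤-total a b
  ... | inj₁ a≤b = subst₂ _≤_ (lhs a b) (rhs a b) (+-monoˡ-≤ (2 * (a * b)) (rearrangement a≤b a≤b))
    where
    lhs : ∀ a b → a * b + b * a + 2 * (a * b) ≡ 4 * (a * b)
    lhs = solve-∀
    rhs : ∀ a b → a * a + b * b + 2 * (a * b) ≡ (a + b) * (a + b)
    rhs = solve-∀
  ... | inj₂ b≤a = subst₂ _≤_ (lhs a b) (rhs a b) (+-monoˡ-≤ (2 * (a * b)) (rearrangement b≤a b≤a))
    where
    lhs : ∀ a b → b * a + a * b + 2 * (a * b) ≡ 4 * (a * b)
    lhs = solve-∀
    rhs : ∀ a b → b * b + a * a + 2 * (a * b) ≡ (a + b) * (a + b)
    rhs = solve-∀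

  -- The share of a color with s of the T cells in few-colors-or-agreements; x
  -- tells whether the color is counted outright.
  weight : ℕ → ℕ → Bool → ℕ → ℕ
  weight k T x s = 50 * (T * T) * ind x + k * (49 + k) * (ind (not x) * (s * s))

  weight-counted : ∀ k T s → weight k T true s ≡ 50 * (T * T)
  weight-counted k T s = eq (50 * (T * T)) (k * (49 + k)) (s * s)
    where
    eq : ∀ a b c → a * 1 + b * (0 * c) ≡ a
    eq = solve-∀

  weight-uncounted : ∀ k T s → weight k T false s ≡ k * (49 + k) * (s * s)
  weight-uncounted k T s = eq (50 * (T * T)) (k * (49 + k)) (s * s)
    where
    eq : ∀ a b c → a * 0 + b * (1 * c) ≡ b * c
    eq = solve-∀

  weight-linear : ∀ {k T s} → 3 ≤ k → (large? : Dec (5 * T ≤ 3 * k * s)) → weight k T (does large?) s ≤ 30 * k * T * s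
  weight-linear {k} {T} {s} _ (yes large) = begin
    weight k T true s     ≡⟨ weight-counted k T s ⟩
    50 * (T * T)          ≡⟨ eq₁ T ⟩
    10 * T * (5 * T)      ≤⟨ *-monoʳ-≤ (10 * T) large ⟩
    10 * T * (3 * k * s)  ≡⟨ eq₂ T k s ⟩
    30 * k * T * s        ∎
    where
    open ≤-Reasoning
    eq₁ : ∀ T → 50 * (T * T) ≡ 10 * T * (5 * T)
    eq₁ = solve-∀
    eq₂ : ∀ T k s → 10 * T * (3 * k * s) ≡ 30 * k * T * s
    eq₂ = solve-∀
  weight-linear {k} {T} {s} 3≤k (no small) = begin
    weight k T false s            ≡⟨ weight-uncounted k T s ⟩
    k * (49 + k) * (s * s)        ≡⟨ eq₁ k s ⟩
    k * s * ((49 + k) * s)        ≤⟨ *-monoʳ-≤ (k * s) (*-monoˡ-≤ s 49+k≤18k) ⟩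
    k * s * (18 * k * s)          ≡⟨ eq₂ k s ⟩
    6 * k * s * (3 * k * s)       ≤⟨ *-monoʳ-≤ (6 * k * s) (<⇒≤ (≰⇒> small)) ⟩
    6 * k * s * (5 * T)           ≡⟨ eq₃ T k s ⟩
    30 * k * T * s                ∎
    where
    open ≤-Reasoning
    49+k≤18k : 49 + k ≤ 18 * k
    49+k≤18k = begin
      49 + k         ≤⟨ +-monoˡ-≤ k (≤-trans (m≤m+n 49 2) (*-monoʳ-≤ 17 3≤k)) ⟩
      17 * k + k     ≡⟨ +-comm (17 * k) k ⟩
      18 * k         ∎
    eq₁ : ∀ k s → k * (49 + k) * (s * s) ≡ k * s * ((49 + k) * s)
    eq₁ = solve-∀
    eq₂ : ∀ k s → k * s * (18 * k * s) ≡ 6 * k * s * (3 * k * s)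
    eq₂ = solve-∀
    eq₃ : ∀ T k s → 6 * k * s * (5 * T) ≡ 30 * k * T * s
    eq₃ = solve-∀

  -- The other color has b at most 3/10 of the cells, and 102 · 9/100 < 10.
  dominant : ∀ a b → 7 * (a + b) < 10 * a → 102 * (b * b) ≤ 10 * ((a + b) * (a + b))
  dominant a b large = *-cancelˡ-≤ 9 (begin
    9 * (102 * (b * b))                            ≤⟨ m≤m+n _ (82 * (b * b)) ⟩
    9 * (102 * (b * b)) + 82 * (b * b)             ≡⟨ eq₁ b ⟩
    10 * (10 * b * (10 * b))                       ≤⟨ *-monoʳ-≤ 10 (*-mono-≤ small small) ⟩
    10 * (3 * (a + b) * (3 * (a + b)))             ≡⟨ eq₂ (a + b) ⟩
    9 * (10 * ((a + b) * (a + b)))                 ∎)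
    where
    open ≤-Reasoning
    eq₁ : ∀ b → 9 * (102 * (b * b)) + 82 * (b * b) ≡ 10 * (10 * b * (10 * b))
    eq₁ = solve-∀
    eq₂ : ∀ t → 10 * (3 * t * (3 * t)) ≡ 9 * (10 * (t * t))
    eq₂ = solve-∀
    small : 10 * b ≤ 3 * (a + b)
    small = +-cancelˡ-≤ (7 * (a + b)) _ _ (begin
      7 * (a + b) + 10 * b            ≤⟨ +-monoˡ-≤ (10 * b) (<⇒≤ large) ⟩
      10 * a + 10 * b                 ≡⟨ eq a b ⟩
      7 * (a + b) + 3 * (a + b)       ∎)
      where
      eq : ∀ a b → 10 * a + 10 * b ≡ 7 * (a + b) + 3 * (a + b)
      eq = solve-∀
  not-dominant : ∀ a b → ¬ (7 * (a + b) < 10 * a) → 3 * a ≤ 7 * b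
  not-dominant a b h = +-cancelˡ-≤ (7 * a) _ _ (begin
    7 * a + 3 * a    ≡⟨ eq a ⟩
    10 * a           ≤⟨ ≮⇒≥ h ⟩
    7 * (a + b)      ≡⟨ *-distribˡ-+ 7 a b ⟩
    7 * a + 7 * b    ∎)
    where
    open ≤-Reasoning
    eq : ∀ a → 7 * a + 3 * a ≡ 10 * a
    eq = solve-∀

  -- If one color dominates, it costs 50 T² and the other one at most 10 T². Otherwise both shares
  -- lie between 3/10 and 7/10, so a² + b² is at most 58/100 of T², and 102 · 58/100 < 60.
  weight-two : ∀ a b (a? : Dec (7 * (a + b) < 10 * a)) (b? : Dec (7 * (a + b) < 10 * b)) →
    weight 2 (a + b) (does a?) a + weight 2 (a + b) (does b?) b ≤ 60 * ((a + b) * (a + b))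
  weight-two a b (yes p) (yes q) = ⊥-elim (<-irrefl refl (begin-strict
    10 * (a + b)                    ≤⟨ m≤m+n _ (4 * (a + b)) ⟩
    10 * (a + b) + 4 * (a + b)      ≡⟨ eq (a + b) ⟩
    7 * (a + b) + 7 * (a + b)       <⟨ +-mono-< p q ⟩
    10 * a + 10 * b                 ≡⟨ *-distribˡ-+ 10 a b ⟨
    10 * (a + b)                    ∎))
    where
    open ≤-Reasoning
    eq : ∀ t → 10 * t + 4 * t ≡ 7 * t + 7 * t
    eq = solve-∀
  weight-two a b (yes p) (no _) = begin
    weight 2 (a + b) true a + weight 2 (a + b) false b
      ≡⟨ cong₂ _+_ (weight-counted 2 (a + b) a) (weight-uncounted 2 (a + b) b) ⟩
    50 * ((a + b) * (a + b)) + 102 * (b * b)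
      ≤⟨ +-monoʳ-≤ (50 * ((a + b) * (a + b))) (dominant a b p) ⟩
    50 * ((a + b) * (a + b)) + 10 * ((a + b) * (a + b))
      ≡⟨ *-distribʳ-+ ((a + b) * (a + b)) 50 10 ⟨
    60 * ((a + b) * (a + b)) ∎
    where open ≤-Reasoning
  weight-two a b (no _) (yes q) = begin
    weight 2 (a + b) false a + weight 2 (a + b) true b
      ≡⟨ cong₂ _+_ (weight-uncounted 2 (a + b) a) (weight-counted 2 (a + b) b) ⟩
    102 * (a * a) + 50 * ((a + b) * (a + b))
      ≤⟨ +-monoˡ-≤ (50 * ((a + b) * (a + b)))
           (subst (λ t → 102 * (a * a) ≤ 10 * (t * t)) (+-comm b a)
             (dominant b a (subst (λ t → 7 * t < 10 * b) (+-comm a b) q))) ⟩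
    10 * ((a + b) * (a + b)) + 50 * ((a + b) * (a + b))
      ≡⟨ *-distribʳ-+ ((a + b) * (a + b)) 10 50 ⟨
    60 * ((a + b) * (a + b)) ∎
    where open ≤-Reasoning
  weight-two a b (no p) (no q) = begin
    weight 2 (a + b) false a + weight 2 (a + b) false b
      ≡⟨ cong₂ _+_ (weight-uncounted 2 (a + b) a) (weight-uncounted 2 (a + b) b) ⟩
    102 * (a * a) + 102 * (b * b)
      ≡⟨ eq₁ a b ⟩
    60 * (a * a + b * b) + 2 * (3 * a * (7 * a) + 7 * b * (3 * b))
      -- With 102 split as 60 + 42, the rearrangement is (7b - 3a)(7a - 3b) ≥ 0, which bounds 42 (a²
      -- + b²) by 116 ab; 4 ab more complete the square.
      ≤⟨ +-monoʳ-≤ (60 * (a * a + b * b)) (*-monoʳ-≤ 2 (rearrangement (not-dominant a b p)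
           (not-dominant b a (λ r → q (subst (λ t → 7 * t < 10 * b) (+-comm b a) r))))) ⟩
    60 * (a * a + b * b) + 2 * (3 * a * (3 * b) + 7 * b * (7 * a))
      ≤⟨ m≤m+n _ (4 * (a * b)) ⟩
    60 * (a * a + b * b) + 2 * (3 * a * (3 * b) + 7 * b * (7 * a)) + 4 * (a * b)
      ≡⟨ eq₂ a b ⟩
    60 * ((a + b) * (a + b)) ∎
    where
    open ≤-Reasoning
    eq₁ : ∀ a b → 102 * (a * a) + 102 * (b * b) ≡ 60 * (a * a + b * b) + 2 * (3 * a * (7 * a) + 7 * b * (3 * b))
    eq₁ = solve-∀
    eq₂ : ∀ a b → 60 * (a * a + b * b) + 2 * (3 * a * (3 * b) + 7 * b * (7 * a)) + 4 * (a * b)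
      ≡ 60 * ((a + b) * (a + b))
    eq₂ = solve-∀

  choose-large : ∀ {k T} → 2 ≤ k → (s : Fin k → ℕ) → Σ[ allFin k ] s ≡ T →
    ∃ λ (S : Fin k → Bool) → Σ[ allFin k ] (λ i → weight k T (S i) (s i)) ≤ 30 * k * (T * T)
  choose-large {suc zero} (s≤s ()) s _
  choose-large {suc (suc zero)} {T} _ s Σs≡T = (λ i → does (7 * T <? 10 * s i)) ,
    two (s zero) (s (suc zero)) T (trans (cong (s zero +_) (sym (+-identityʳ (s (suc zero))))) Σs≡T)
    where
    two : ∀ a b T → a + b ≡ T →
      weight 2 T (does (7 * T <? 10 * a)) a + (weight 2 T (does (7 * T <? 10 * b)) b + 0) ≤ 30 * 2 * (T * T)
    two a b .(a + b) refl = subst (_≤ 60 * ((a + b) * (a + b)))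
      (cong (weight 2 (a + b) (does (7 * (a + b) <? 10 * a)) a +_) (sym (+-identityʳ _)))
      (weight-two a b (7 * (a + b) <? 10 * a) (7 * (a + b) <? 10 * b))
  choose-large {k@(suc (suc (suc _)))} {T} _ s Σs≡T = (λ i → does (5 * T ≤? 3 * k * s i)) ,
    three k (s≤s (s≤s (s≤s z≤n))) s Σs≡T
    where
    open ≤-Reasoning
    three : ∀ k → 3 ≤ k → (s : Fin k → ℕ) → Σ[ allFin k ] s ≡ T →
      Σ[ allFin k ] (λ i → weight k T (does (5 * T ≤? 3 * k * s i)) (s i)) ≤ 30 * k * (T * T)
    three k 3≤k s Σs≡T = begin
      Σ[ allFin k ] (λ i → weight k T (does (5 * T ≤? 3 * k * s i)) (s i))
        ≤⟨ Σ-mono (allFin k) (λ i → weight-linear 3≤k (5 * T ≤? 3 * k * s i)) ⟩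
      Σ[ allFin k ] (λ i → 30 * k * T * s i)
        ≡⟨ ℕΣ.Σ-*ˡ (allFin k) (30 * k * T) s ⟩
      30 * k * T * Σ[ allFin k ] s
        ≡⟨ cong (30 * k * T *_) Σs≡T ⟩
      30 * k * T * T
        ≡⟨ *-assoc (30 * k) T T ⟩
      30 * k * (T * T) ∎

  Σ-allFin-const : ∀ n c → Σ[ allFin n ] (λ _ → c) ≡ n * c
  Σ-allFin-const n c = trans (Σ-const (allFin n) c) (cong (_* c) (List.length-tabulate {n = n} id))

  Σ-product-* : ∀ {A B : Set} (xs : List A) (ys : List B) (f : A → ℕ) (g : B → ℕ) →
    Σ[ xs ] (λ x → Σ[ ys ] (λ y → f x * g y)) ≡ Σ[ xs ] f * Σ[ ys ] g
  Σ-product-* xs ys f g = trans (ℕΣ.Σ-cong xs (λ x → ℕΣ.Σ-*ˡ ys (f x) g)) (ℕΣ.Σ-*ʳ xs (Σ[ ys ] g) f)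

  module _ {k N : ℕ} (g g′ : Fin N → Fin k) where

    agree : (Fin k → Bool) → Fin N → Fin N → Bool
    agree S x y = does (g x Fin.≟ g′ y) ∧ not (S (g x))

    private
      a a′ : Fin k → ℕ
      a i = Σ[ allFin N ] (λ x → ⟦ g x ≟ i ⟧)
      a′ i = Σ[ allFin N ] (λ y → ⟦ g′ y ≟ i ⟧)

      class-sizes : (g : Fin N → Fin k) → Σ[ allFin k ] (λ i → Σ[ allFin N ] (λ x → ⟦ g x ≟ i ⟧)) ≡ N
      class-sizes g = begin
        Σ[ allFin k ] (λ i → Σ[ allFin N ] (λ x → ⟦ g x ≟ i ⟧))  ≡⟨ ℕΣ.Σ-swap (allFin k) (allFin N) _ ⟩
        Σ[ allFin N ] (λ x → Σ[ allFin k ] (λ i → ⟦ g x ≟ i ⟧))  ≡⟨ ℕΣ.Σ-cong (allFin N) (λ x → Σ-⟦≟⟧ (g x)) ⟩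
        Σ[ allFin N ] (λ _ → 1)                                  ≡⟨ Σ-allFin-const N 1 ⟩
        N * 1                                                    ≡⟨ *-identityʳ N ⟩
        N                                                        ∎
        where open ≡-Reasoning

      -- Writing an agreement as a sum over the shared color lets the sums be exchanged, after which
      -- the agreeing pairs split by color into products of class sizes.
      agree≤ : ∀ S x y → ind (agree S x y) ≤ Σ[ allFin k ] (λ i → ind (not (S i)) * (⟦ g x ≟ i ⟧ * ⟦ g′ y ≟ i ⟧))
      agree≤ S x y with g x Fin.≟ g′ y
      ... | no _     = z≤n
      ... | yes gx≡g′y = begin
        ind (not (S (g x)))
          ≡⟨ *-identityʳ _ ⟨
        ind (not (S (g x))) * 1
          ≡⟨ cong (ind (not (S (g x))) *_) (cong₂ _*_ (⟦≟⟧-refl (g x))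
               (trans (cong (λ j → ⟦ j ≟ g x ⟧) (sym gx≡g′y)) (⟦≟⟧-refl (g x)))) ⟨
        ind (not (S (g x))) * (⟦ g x ≟ g x ⟧ * ⟦ g′ y ≟ g x ⟧)
          ≤⟨ ∈⇒≤Σ (λ i → ind (not (S i)) * (⟦ g x ≟ i ⟧ * ⟦ g′ y ≟ i ⟧)) (∈-allFin (g x)) ⟩
        Σ[ allFin k ] (λ i → ind (not (S i)) * (⟦ g x ≟ i ⟧ * ⟦ g′ y ≟ i ⟧)) ∎
        where open ≤-Reasoning

      Σ-agree≤ : ∀ S → Σ[ allFin N ] (λ x → Σ[ allFin N ] (λ y → ind (agree S x y))) ≤
        Σ[ allFin k ] (λ i → ind (not (S i)) * (a i * a′ i))
      Σ-agree≤ S = begin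
        Σ[ allFin N ] (λ x → Σ[ allFin N ] (λ y → ind (agree S x y)))
          ≤⟨ Σ-mono (allFin N) (λ x → Σ-mono (allFin N) (agree≤ S x)) ⟩
        Σ[ allFin N ] (λ x → Σ[ allFin N ] (λ y → Σ[ allFin k ] (λ i → t i x y)))
          ≡⟨ ℕΣ.Σ-cong (allFin N) (λ x → ℕΣ.Σ-swap (allFin N) (allFin k) (λ y i → t i x y)) ⟩
        Σ[ allFin N ] (λ x → Σ[ allFin k ] (λ i → Σ[ allFin N ] (λ y → t i x y)))
          ≡⟨ ℕΣ.Σ-swap (allFin N) (allFin k) (λ x i → Σ[ allFin N ] (λ y → t i x y)) ⟩
        Σ[ allFin k ] (λ i → Σ[ allFin N ] (λ x → Σ[ allFin N ] (λ y → t i x y)))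
          ≡⟨ ℕΣ.Σ-cong (allFin k) collapse ⟩
        Σ[ allFin k ] (λ i → ind (not (S i)) * (a i * a′ i)) ∎
        where
        open ≤-Reasoning
        t : Fin k → Fin N → Fin N → ℕ
        t i x y = ind (not (S i)) * (⟦ g x ≟ i ⟧ * ⟦ g′ y ≟ i ⟧)
        collapse : ∀ i → Σ[ allFin N ] (λ x → Σ[ allFin N ] (t i x)) ≡ ind (not (S i)) * (a i * a′ i)
        collapse i = trans
          (ℕΣ.Σ-cong (allFin N) (λ x → ℕΣ.Σ-*ˡ (allFin N) (ind (not (S i))) (λ y → ⟦ g x ≟ i ⟧ * ⟦ g′ y ≟ i ⟧)))
          (trans (ℕΣ.Σ-*ˡ (allFin N) (ind (not (S i))) (λ x → Σ[ allFin N ] (λ y → ⟦ g x ≟ i ⟧ * ⟦ g′ y ≟ i ⟧)))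
            (cong (ind (not (S i)) *_) (Σ-product-* (allFin N) (allFin N) (λ x → ⟦ g x ≟ i ⟧) (λ y → ⟦ g′ y ≟ i ⟧))))

    -- Counting the colors of S outright leaves the pairs of cells that agree in
    -- a color outside S: by AM-GM, color i contributes at most s i * s i / 4 of
    -- them, where s i is the number of cells of color i.
    few-colors-or-agreements : 2 ≤ k → ∃ λ (S : Fin k → Bool) →
      50 * (N * N) * Σ[ allFin k ] (ind ∘ S) +
      k * (49 + k) * Σ[ allFin N ] (λ x → Σ[ allFin N ] (λ y → ind (agree S x y))) ≤ 30 * k * (N * N)
    few-colors-or-agreements 2≤k = S , *-cancelˡ-≤ 4 (begin
      4 * (50 * (N * N) * Σ[ allFin k ] (ind ∘ S) + c * Σ[ allFin N ] (λ x → Σ[ allFin N ] (λ y → ind (agree S x y))))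
        ≤⟨ *-monoʳ-≤ 4 (+-monoʳ-≤ (50 * (N * N) * Σ[ allFin k ] (ind ∘ S)) (*-monoʳ-≤ c (Σ-agree≤ S))) ⟩
      4 * (50 * (N * N) * Σ[ allFin k ] (ind ∘ S) + c * Σ[ allFin k ] (λ i → ind (not (S i)) * (a i * a′ i)))
        ≡⟨ cong (4 *_) (trans (ℕΣ.Σ-+ (allFin k) _ _) (cong₂ _+_ (ℕΣ.Σ-*ˡ (allFin k) (50 * (N * N)) (ind ∘ S))
             (ℕΣ.Σ-*ˡ (allFin k) c (λ i → ind (not (S i)) * (a i * a′ i))))) ⟨
      4 * Σ[ allFin k ] (λ i → 50 * (N * N) * ind (S i) + c * (ind (not (S i)) * (a i * a′ i)))
        ≡⟨ ℕΣ.Σ-*ˡ (allFin k) 4 _ ⟨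
      Σ[ allFin k ] (λ i → 4 * (50 * (N * N) * ind (S i) + c * (ind (not (S i)) * (a i * a′ i))))
        ≤⟨ Σ-mono (allFin k) (λ i → am-gm c N (ind (S i)) (ind (not (S i))) (a i) (a′ i)) ⟩
      Σ[ allFin k ] (λ i → weight k (N + N) (S i) (a i + a′ i))
        ≤⟨ proj₂ chosen ⟩
      30 * k * ((N + N) * (N + N))
        ≡⟨ eq₂ k N ⟩
      4 * (30 * k * (N * N)) ∎)
      where
      open ≤-Reasoning
      c : ℕ
      c = k * (49 + k)
      chosen : ∃ λ (S : Fin k → Bool) → Σ[ allFin k ] (λ i → weight k (N + N) (S i) (a i + a′ i)) ≤ 30 * k * ((N + N) * (N + N))
      chosen = choose-large 2≤k (λ i → a i + a′ i)
        (trans (ℕΣ.Σ-+ (allFin k) a a′) (cong₂ _+_ (class-sizes g) (class-sizes g′)))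
      S : Fin k → Bool
      S = proj₁ chosen
      eq₂ : ∀ k N → 30 * k * ((N + N) * (N + N)) ≡ 4 * (30 * k * (N * N))
      eq₂ = solve-∀
      am-gm : ∀ c N x y a b →
        4 * (50 * (N * N) * x + c * (y * (a * b))) ≤ 50 * ((N + N) * (N + N)) * x + c * (y * ((a + b) * (a + b)))
      am-gm c N x y a b = begin
        4 * (50 * (N * N) * x + c * (y * (a * b)))
          ≡⟨ eq₁ c N x y (a * b) ⟩
        50 * ((N + N) * (N + N)) * x + c * (y * (4 * (a * b)))
          ≤⟨ +-monoʳ-≤ (50 * ((N + N) * (N + N)) * x) (*-monoʳ-≤ c (*-monoʳ-≤ y (4ab≤[a+b]² a b))) ⟩
        50 * ((N + N) * (N + N)) * x + c * (y * ((a + b) * (a + b))) ∎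
        where
        eq₁ : ∀ c N x y p → 4 * (50 * (N * N) * x + c * (y * p)) ≡ 50 * ((N + N) * (N + N)) * x + c * (y * (4 * p))
        eq₁ = solve-∀

  -- Independent positions and their collisions

  vecs : ∀ {A : Set} → List A → ∀ m → List (Vec A m)
  vecs xs zero    = [] ∷ []
  vecs xs (suc m) = cartesianProductWith _∷_ xs (vecs xs m)

  module _ (N : ℕ) where

    cells : List (Fin N × Fin N)
    cells = cartesianProduct (allFin N) (allFin N)

    Σ-cells : (f : Fin N × Fin N → ℕ) → Σ[ cells ] f ≡ Σ[ allFin N ] (λ x → Σ[ allFin N ] (λ y → f (x , y)))
    Σ-cells f = ℕΣ.Σ-product _,_ (allFin N) (allFin N) f

    Σ-cells-const : ∀ c → Σ[ cells ] (λ _ → c) ≡ N * N * c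
    Σ-cells-const c = trans (Σ-cells (λ _ → c)) (trans (ℕΣ.Σ-cong (allFin N) (λ _ → Σ-allFin-const N c))
      (trans (Σ-allFin-const N (N * c)) (sym (*-assoc N N c))))

  module _ {N : ℕ} where

    clash : Fin N × Fin N → Fin N × Fin N → ℕ
    clash (x , y) (x′ , y′) = ⟦ x′ ≟ x ⟧ + ⟦ y′ ≟ y ⟧

    -- A pair of blocks sharing both coordinates counts twice, which keeps the count additive over
    -- pairs and coordinates.
    collisions : ∀ {m} → Vec (Fin N × Fin N) m → ℕ
    collisions []      = 0
    collisions (z ∷ f) = Σ[ Vec.toList f ] (clash z) + collisions f

    Σ-clash : ∀ w → Σ[ cells N ] (λ z → clash z w) ≡ N + N
    Σ-clash (x′ , y′) = begin
      Σ[ cells N ] (λ z → clash z (x′ , y′))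
        ≡⟨ Σ-cells N _ ⟩
      Σ[ allFin N ] (λ x → Σ[ allFin N ] (λ y → ⟦ x′ ≟ x ⟧ + ⟦ y′ ≟ y ⟧))
        ≡⟨ ℕΣ.Σ-cong (allFin N) (λ x → trans (ℕΣ.Σ-+ (allFin N) (λ _ → ⟦ x′ ≟ x ⟧) (λ y → ⟦ y′ ≟ y ⟧))
             (cong₂ _+_ (Σ-allFin-const N ⟦ x′ ≟ x ⟧) (Σ-⟦≟⟧ y′))) ⟩
      Σ[ allFin N ] (λ x → N * ⟦ x′ ≟ x ⟧ + 1)
        ≡⟨ ℕΣ.Σ-+ (allFin N) (λ x → N * ⟦ x′ ≟ x ⟧) (λ _ → 1) ⟩
      Σ[ allFin N ] (λ x → N * ⟦ x′ ≟ x ⟧) + Σ[ allFin N ] (λ _ → 1)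
        ≡⟨ cong₂ _+_ (trans (ℕΣ.Σ-*ˡ (allFin N) N (λ x → ⟦ x′ ≟ x ⟧)) (cong (N *_) (Σ-⟦≟⟧ x′))) (Σ-allFin-const N 1) ⟩
      N * 1 + N * 1
        ≡⟨ cong₂ _+_ (*-identityʳ N) (*-identityʳ N) ⟩
      N + N ∎
      where open ≡-Reasoning

    Σ-vecs-const : ∀ m c → Σ[ vecs (cells N) (suc m) ] (λ _ → c) ≡ N * N * Σ[ vecs (cells N) m ] (λ _ → c)
    Σ-vecs-const m c = trans (ℕΣ.Σ-product _∷_ (cells N) (vecs (cells N) m) (λ _ → c)) (Σ-cells-const N _)

    -- A uniform cell clashes 2/N times on average with each of m given cells, so one more block
    -- adds 2m/N to the mean, and m² + 2m ≤ (m + 1)².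
    Σ-collisions : ∀ m → N * Σ[ vecs (cells N) m ] collisions ≤ m * m * Σ[ vecs (cells N) m ] (λ _ → 1)
    Σ-collisions zero    = ≤-reflexive (*-zeroʳ N)
    Σ-collisions (suc m) = begin
      N * Σ[ vecs Z (suc m) ] collisions
        ≡⟨ cong (N *_) step ⟩
      N * (V * (m * (N + N)) + N * N * Σ[ vecs Z m ] collisions)
        ≡⟨ eq₁ N V m (Σ[ vecs Z m ] collisions) ⟩
      N * N * (m + m) * V + N * N * (N * Σ[ vecs Z m ] collisions)
        ≤⟨ +-monoʳ-≤ (N * N * (m + m) * V) (*-monoʳ-≤ (N * N) (Σ-collisions m)) ⟩
      N * N * (m + m) * V + N * N * (m * m * V)
        ≤⟨ m≤m+n _ (N * N * V) ⟩
      N * N * (m + m) * V + N * N * (m * m * V) + N * N * V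
        ≡⟨ eq₂ (N * N) V m ⟩
      suc m * suc m * (N * N * V)
        ≡⟨ cong (suc m * suc m *_) (Σ-vecs-const m 1) ⟨
      suc m * suc m * Σ[ vecs Z (suc m) ] (λ _ → 1) ∎
      where
      open ≤-Reasoning
      Z = cells N
      V : ℕ
      V = Σ[ vecs Z m ] (λ _ → 1)
      eq₁ : ∀ N V m c → N * (V * (m * (N + N)) + N * N * c) ≡ N * N * (m + m) * V + N * N * (N * c)
      eq₁ = solve-∀
      eq₂ : ∀ M V m → M * (m + m) * V + M * (m * m * V) + M * V ≡ suc m * suc m * (M * V)
      eq₂ = solve-∀
      fresh : (f : Vec (Fin N × Fin N) m) → Σ[ Z ] (λ z → Σ[ Vec.toList f ] (clash z)) ≡ 1 * (m * (N + N))
      fresh f = trans (ℕΣ.Σ-swap Z (Vec.toList f) clash)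
        (trans (ℕΣ.Σ-cong (Vec.toList f) Σ-clash) (trans (Σ-const (Vec.toList f) (N + N))
          (trans (cong (_* (N + N)) (Vec.length-toList f)) (sym (*-identityˡ _)))))
      step : Σ[ vecs Z (suc m) ] collisions ≡ V * (m * (N + N)) + N * N * Σ[ vecs Z m ] collisions
      step = trans (ℕΣ.Σ-product _∷_ Z (vecs Z m) collisions)
        (trans (ℕΣ.Σ-cong Z (λ z → ℕΣ.Σ-+ (vecs Z m) (λ f → Σ[ Vec.toList f ] (clash z)) collisions))
        (trans (ℕΣ.Σ-+ Z (λ z → Σ[ vecs Z m ] (λ f → Σ[ Vec.toList f ] (clash z))) (λ _ → Σ[ vecs Z m ] collisions))
          (cong₂ _+_
            (trans (ℕΣ.Σ-swap Z (vecs Z m) (λ z f → Σ[ Vec.toList f ] (clash z)))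
              (trans (ℕΣ.Σ-cong (vecs Z m) fresh) (ℕΣ.Σ-*ʳ (vecs Z m) (m * (N + N)) (λ _ → 1))))
            (Σ-cells-const N _))))

    collisions≡0⇒injective : ∀ {m} (f : Vec (Fin N × Fin N) m) → collisions f ≡ 0 → ∀ b b′ →
      proj₁ (lookup f b) ≡ proj₁ (lookup f b′) ⊎ proj₂ (lookup f b) ≡ proj₂ (lookup f b′) → b ≡ b′
    collisions≡0⇒injective (z ∷ f) none zero    zero     _  = refl
    collisions≡0⇒injective (z ∷ f) none (suc b) (suc b′) eq =
      cong suc (collisions≡0⇒injective f (m+n≡0⇒n≡0 (Σ[ Vec.toList f ] (clash z)) none) b b′ eq)
    collisions≡0⇒injective (z ∷ f) none zero    (suc b′) eq = ⊥-elim (fresh z f (m+n≡0⇒m≡0 _ none) b′ eq)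
      where
      fresh : ∀ {m} z (f : Vec (Fin N × Fin N) m) → Σ[ Vec.toList f ] (clash z) ≡ 0 → ∀ b →
        ¬ (proj₁ z ≡ proj₁ (lookup f b) ⊎ proj₂ z ≡ proj₂ (lookup f b))
      fresh z f none b (inj₁ eq) = 1≰0 (begin
        1                                        ≡⟨ trans (cong (λ x → ⟦ proj₁ (lookup f b) ≟ x ⟧) eq) (⟦≟⟧-refl (proj₁ (lookup f b))) ⟨
        ⟦ proj₁ (lookup f b) ≟ proj₁ z ⟧         ≤⟨ m≤m+n _ _ ⟩
        clash z (lookup f b)                     ≤⟨ ∈⇒≤Σ (clash z) (∈-toList⁺ (∈-lookup b f)) ⟩
        Σ[ Vec.toList f ] (clash z)              ≡⟨ none ⟩
        0                                        ∎)
        where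
        open ≤-Reasoning
        1≰0 : ¬ (1 ≤ 0)
        1≰0 ()
      fresh z f none b (inj₂ eq) = 1≰0 (begin
        1                                        ≡⟨ trans (cong (λ x → ⟦ proj₂ (lookup f b) ≟ x ⟧) eq) (⟦≟⟧-refl (proj₂ (lookup f b))) ⟨
        ⟦ proj₂ (lookup f b) ≟ proj₂ z ⟧         ≤⟨ m≤n+m _ ⟦ proj₁ (lookup f b) ≟ proj₁ z ⟧ ⟩
        clash z (lookup f b)                     ≤⟨ ∈⇒≤Σ (clash z) (∈-toList⁺ (∈-lookup b f)) ⟩
        Σ[ Vec.toList f ] (clash z)              ≡⟨ none ⟩
        0                                        ∎)
        where
        open ≤-Reasoning
        1≰0 : ¬ (1 ≤ 0)
        1≰0 ()
    collisions≡0⇒injective (z ∷ f) none (suc b) zero eq =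
      sym (collisions≡0⇒injective (z ∷ f) none zero (suc b) (swap-sym eq))
      where
      swap-sym : ∀ {A B : Set} {a a′ : A} {b b′ : B} → a ≡ a′ ⊎ b ≡ b′ → a′ ≡ a ⊎ b′ ≡ b
      swap-sym (inj₁ p) = inj₁ (sym p)
      swap-sym (inj₂ p) = inj₂ (sym p)

    collision-free : ∀ {m} → Vec (Fin N × Fin N) m → ℕ
    collision-free f = ind (does (collisions f ≟ 0))

    1≤free+collisions : ∀ {m} (f : Vec (Fin N × Fin N) m) → 1 ≤ collision-free f + collisions f
    1≤free+collisions f with collisions f
    ... | zero  = s≤s z≤n
    ... | suc c = s≤s z≤n

  -- Markov's inequality: the mean number of collisions is at most k²/N = 1/10.
  mostly-collision-free : ∀ k → 1 ≤ k → let N = 10 * (k * k) ; Ω = vecs (cells N) k in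
    9 * Σ[ Ω ] (λ _ → 1) ≤ 10 * Σ[ Ω ] collision-free
  mostly-collision-free k@(suc _) _ = +-cancelʳ-≤ V _ _ (begin
    9 * V + V                                       ≡⟨ +-comm (9 * V) V ⟩
    10 * V                                          ≤⟨ *-monoʳ-≤ 10 (Σ-mono Ω 1≤free+collisions) ⟩
    10 * Σ[ Ω ] (λ f → collision-free f + collisions f)
      ≡⟨ cong (10 *_) (ℕΣ.Σ-+ Ω collision-free collisions) ⟩
    10 * (Σ[ Ω ] collision-free + Σ[ Ω ] collisions)
      ≡⟨ *-distribˡ-+ 10 (Σ[ Ω ] collision-free) _ ⟩
    10 * Σ[ Ω ] collision-free + 10 * Σ[ Ω ] collisions
      ≤⟨ +-monoʳ-≤ (10 * Σ[ Ω ] collision-free) (*-cancelˡ-≤ (k * k) (≤-trans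
           (≤-reflexive (eq (k * k) (Σ[ Ω ] collisions))) (Σ-collisions {N} k))) ⟩
    10 * Σ[ Ω ] collision-free + V                  ∎)
    where
    open ≤-Reasoning
    N = 10 * (k * k)
    Ω = vecs (cells N) k
    V : ℕ
    V = Σ[ Ω ] (λ _ → 1)
    eq : ∀ K c → K * (10 * c) ≡ 10 * K * c
    eq = solve-∀

open Counting
open import Data.Integer using (+_)
open import Defs

-- The order on the reals

infix 4 _≐_ _≼_

-- Both relations unfold to statements about sequences from which the numbers
-- compared cannot be inferred; the records make them inferable.
record _≐_ (x y : ℝ) : Set where
  constructor pointwise
  field
    at : ∀ n → seq x n ≡ seq y n

record _≼_ (x y : ℝ) : Set where
  constructor ≼-intro
  field
    ≼⇒≤ : x ≤ y

open _≐_
open _≼_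

≐-isEquivalence : IsEquivalence _≐_
≐-isEquivalence = record
  { refl  = pointwise λ n → refl
  ; sym   = λ p → pointwise λ n → sym (at p n)
  ; trans = λ p q → pointwise λ n → trans (at p n) (at q n)
  }

-- Since sums and products act termwise, the semiring laws hold already for equality of the
-- representing sequences, term by term from ℚ, and no limit is involved.
ℝ-commutativeSemiring : CommutativeSemiring 0ℓ 0ℓ
ℝ-commutativeSemiring = record
  { Carrier = ℝ
  ; _≈_ = _≐_
  ; _+_ = _+_
  ; _*_ = _*_
  ; 0# = 0ℝ
  ; 1# = 1ℝ
  ; isCommutativeSemiring = IsCommutativeSemiringˡ.isCommutativeSemiring (record
    { +-isCommutativeMonoid = record
      { isMonoid = record
        { isSemigroup = record
          { isMagma = record
            { isEquivalence = ≐-isEquivalence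
            ; ∙-cong = λ p q → pointwise λ n → cong₂ ℚ._+_ (at p n) (at q n) }
          ; assoc = λ x y z → pointwise λ n → ℚ.+-assoc (seq x n) (seq y n) (seq z n) }
        ; identity = (λ x → pointwise λ n → ℚ.+-identityˡ (seq x n)) , (λ x → pointwise λ n → ℚ.+-identityʳ (seq x n)) }
      ; comm = λ x y → pointwise λ n → ℚ.+-comm (seq x n) (seq y n) }
    ; *-isCommutativeMonoid = record
      { isMonoid = record
        { isSemigroup = record
          { isMagma = record
            { isEquivalence = ≐-isEquivalence
            ; ∙-cong = λ p q → pointwise λ n → cong₂ ℚ._*_ (at p n) (at q n) }
          ; assoc = λ x y z → pointwise λ n → ℚ.*-assoc (seq x n) (seq y n) (seq z n) }
        ; identity = (λ x → pointwise λ n → ℚ.*-identityˡ (seq x n)) , (λ x → pointwise λ n → ℚ.*-identityʳ (seq x n)) }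
      ; comm = λ x y → pointwise λ n → ℚ.*-comm (seq x n) (seq y n) }
    ; distribʳ = λ x y z → pointwise λ n → ℚ.*-distribʳ-+ (seq x n) (seq y n) (seq z n)
    ; zeroˡ = λ x → pointwise λ n → ℚ.*-zeroˡ (seq x n)
    })
  }

module ℝΣ = Sum ℝ-commutativeSemiring
module ℛ = CommutativeSemiring ℝ-commutativeSemiring
module ℛ-Reasoning = SetoidReasoning ℛ.setoid

eventually⇒≤ : ∀ {x y} → (∃ λ N → ∀ n → N ℕ.≤ n → seq x n ℚ.≤ seq y n) → x ≤ y
eventually⇒≤ {x} {y} (N , h) δ 0<δ = N , λ n N≤n → ℚ.≤-trans (h n N≤n)
  (subst (ℚ._≤ seq y n ℚ.+ δ) (ℚ.+-identityʳ (seq y n)) (ℚ.+-monoʳ-≤ (seq y n) (ℚ.<⇒≤ 0<δ)))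

opaque
  ≤-trans : ∀ {x y z} → x ≤ y → y ≤ z → x ≤ z
  ≤-trans {x} {y} {z} p q ε 0<ε with shrink 0<ε 2
  ... | δ , 0<δ , 2δ≤ε with p δ 0<δ | q δ 0<δ
  ... | M , hM | N , hN = M ℕ.⊔ N , λ n ≤n → begin
    seq x n                  ≤⟨ hM n (ℕ.m⊔n≤o⇒m≤o M N ≤n) ⟩
    seq y n ℚ.+ δ            ≤⟨ ℚ.+-monoˡ-≤ δ (hN n (ℕ.m⊔n≤o⇒n≤o M N ≤n)) ⟩
    seq z n ℚ.+ δ ℚ.+ δ      ≡⟨ ℚ.+-assoc (seq z n) δ δ ⟩
    seq z n ℚ.+ (δ ℚ.+ δ)    ≡⟨ cong (seq z n ℚ.+_) (ι2 δ) ⟩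
    seq z n ℚ.+ ι 2 ℚ.* δ    ≤⟨ ℚ.+-monoʳ-≤ (seq z n) 2δ≤ε ⟩
    seq z n ℚ.+ ε            ∎
    where open ℚ.≤-Reasoning

  +-mono-≤ : ∀ {x y z w} → x ≤ y → z ≤ w → x + z ≤ y + w
  +-mono-≤ {x} {y} {z} {w} p q ε 0<ε with shrink 0<ε 2
  ... | δ , 0<δ , 2δ≤ε with p δ 0<δ | q δ 0<δ
  ... | M , hM | N , hN = M ℕ.⊔ N , λ n ≤n → begin
    seq x n ℚ.+ seq z n
      ≤⟨ ℚ.+-mono-≤ (hM n (ℕ.m⊔n≤o⇒m≤o M N ≤n)) (hN n (ℕ.m⊔n≤o⇒n≤o M N ≤n)) ⟩
    (seq y n ℚ.+ δ) ℚ.+ (seq w n ℚ.+ δ)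
      ≡⟨ solve 3 (λ a b d → (a :+ d) :+ (b :+ d) := a :+ b :+ (d :+ d)) refl (seq y n) (seq w n) δ ⟩
    seq y n ℚ.+ seq w n ℚ.+ (δ ℚ.+ δ)
      ≡⟨ cong (seq y n ℚ.+ seq w n ℚ.+_) (ι2 δ) ⟩
    seq y n ℚ.+ seq w n ℚ.+ ι 2 ℚ.* δ
      ≤⟨ ℚ.+-monoʳ-≤ (seq y n ℚ.+ seq w n) 2δ≤ε ⟩
    seq y n ℚ.+ seq w n ℚ.+ ε ∎
    where
    open ℚ.≤-Reasoning
    open +-*-Solver

  p≤∣p∣ : ∀ p → p ℚ.≤ ∣ p ∣
  p≤∣p∣ p with ℚ.≤-total 0ℚ p
  ... | inj₁ 0≤p = ℚ.≤-reflexive (sym (ℚ.0≤p⇒∣p∣≡p 0≤p))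
  ... | inj₂ p≤0 = ℚ.≤-trans p≤0 (ℚ.0≤∣p∣ p)

  -- Since y − x + η and z + θ are nonnegative, so is their product; η is
  -- chosen small against a bound of z, and then θ against bounds of x and y.
  *-monoʳ-≤ : ∀ {x y z} → 0ℝ ≤ z → x ≤ y → x * z ≤ y * z
  *-monoʳ-≤ {x} {y} {z} 0≤z x≤y ε 0<ε
    with bounded {seq x} (cauchy x) | bounded {seq y} (cauchy y) | bounded {seq z} (cauchy z) | shrink 0<ε 2
  ... | X , Nx , hx | Y , Ny , hy | Z , Nz , hz | δ , 0<δ , 2δ≤ε
    with shrink 0<δ Z
  ... | η , 0<η , Zη≤δ with above η
  ... | E , η≤E with shrink 0<δ (Y ℕ.+ X ℕ.+ E)
  ... | θ , 0<θ , θ≤δ with x≤y η 0<η | 0≤z θ 0<θ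
  ... | M , hM | N , hN = Nx ℕ.+ (Ny ℕ.+ (Nz ℕ.+ (M ℕ.+ N))) , λ n ≤n →
    let
      Nx≤ = ℕ.m+n≤o⇒m≤o Nx ≤n
      r₁ = ℕ.m+n≤o⇒n≤o Nx ≤n
      Ny≤ = ℕ.m+n≤o⇒m≤o Ny r₁
      r₂ = ℕ.m+n≤o⇒n≤o Ny r₁
      Nz≤ = ℕ.m+n≤o⇒m≤o Nz r₂
      r₃ = ℕ.m+n≤o⇒n≤o Nz r₂
    in estimate (seq x n) (seq y n) (seq z n) (hx n Nx≤) (hy n Ny≤) (hz n Nz≤)
         (hM n (ℕ.m+n≤o⇒m≤o M r₃)) (hN n (ℕ.m+n≤o⇒n≤o M r₃))
    where
    open ℚ.≤-Reasoning
    open +-*-Solver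
    estimate : ∀ a b c → ∣ a ∣ ℚ.≤ ι X → ∣ b ∣ ℚ.≤ ι Y → ∣ c ∣ ℚ.≤ ι Z → a ℚ.≤ b ℚ.+ η → 0ℚ ℚ.≤ c ℚ.+ θ →
      a ℚ.* c ℚ.≤ b ℚ.* c ℚ.+ ε
    estimate a b c a≤ b≤ c≤ a≤b 0≤c = begin
      a ℚ.* c
        ≡⟨ ℚ.+-identityʳ (a ℚ.* c) ⟨
      a ℚ.* c ℚ.+ 0ℚ
        ≤⟨ ℚ.+-monoʳ-≤ (a ℚ.* c) (0≤* 0≤w 0≤c) ⟩
      a ℚ.* c ℚ.+ (b ℚ.- a ℚ.+ η) ℚ.* (c ℚ.+ θ)
        ≡⟨ solve 5 (λ a b c η θ → a :* c :+ (b :- a :+ η) :* (c :+ θ)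
                     := b :* c :+ (η :* c :+ (b :+ :- a :+ η) :* θ)) refl a b c η θ ⟩
      b ℚ.* c ℚ.+ (η ℚ.* c ℚ.+ (b ℚ.+ ℚ.- a ℚ.+ η) ℚ.* θ)
        ≤⟨ ℚ.+-monoʳ-≤ (b ℚ.* c) (ℚ.+-mono-≤
             (ℚ.*-monoˡ-≤-nonNeg η {{ℚ.nonNegative (ℚ.<⇒≤ 0<η)}} (ℚ.≤-trans (p≤∣p∣ c) c≤))
             (ℚ.*-monoʳ-≤-nonNeg θ {{ℚ.nonNegative (ℚ.<⇒≤ 0<θ)}}
               (ℚ.+-mono-≤ (ℚ.+-mono-≤ (ℚ.≤-trans (p≤∣p∣ b) b≤)
                 (ℚ.≤-trans (p≤∣p∣ (ℚ.- a)) (ℚ.≤-trans (ℚ.≤-reflexive (ℚ.∣-p∣≡∣p∣ a)) a≤))) η≤E))) ⟩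
      b ℚ.* c ℚ.+ (η ℚ.* ι Z ℚ.+ (ι Y ℚ.+ ι X ℚ.+ ι E) ℚ.* θ)
        ≡⟨ cong₂ (λ s t → b ℚ.* c ℚ.+ (s ℚ.+ t ℚ.* θ)) (ℚ.*-comm η (ι Z))
             (trans (cong (ℚ._+ ι E) (sym (ι-+ Y X))) (sym (ι-+ (Y ℕ.+ X) E))) ⟩
      b ℚ.* c ℚ.+ (ι Z ℚ.* η ℚ.+ ι (Y ℕ.+ X ℕ.+ E) ℚ.* θ)
        ≤⟨ ℚ.+-monoʳ-≤ (b ℚ.* c) (ℚ.+-mono-≤ Zη≤δ θ≤δ) ⟩
      b ℚ.* c ℚ.+ (δ ℚ.+ δ)
        ≡⟨ cong (b ℚ.* c ℚ.+_) (ι2 δ) ⟩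
      b ℚ.* c ℚ.+ ι 2 ℚ.* δ
        ≤⟨ ℚ.+-monoʳ-≤ (b ℚ.* c) 2δ≤ε ⟩
      b ℚ.* c ℚ.+ ε ∎
      where
      0≤w : 0ℚ ℚ.≤ b ℚ.- a ℚ.+ η
      0≤w = begin
        0ℚ                  ≡⟨ ℚ.+-inverseʳ a ⟨
        a ℚ.- a             ≤⟨ ℚ.+-monoˡ-≤ (ℚ.- a) a≤b ⟩
        b ℚ.+ η ℚ.- a       ≡⟨ solve 3 (λ a b η → b :+ η :- a := b :- a :+ η) refl a b η ⟩
        b ℚ.- a ℚ.+ η       ∎

  -- Division by m ≥ 1 does not enlarge the slack: δ ≤ δ m, so δ itself still serves after
  -- cancelling m.
  cancel-⅔ : ∀ {α m p} → 1 ℕ.≤ m → 3 ℕ.* p ℕ.≤ 2 ℕ.* m → α * fromℕ m ≤ fromℕ p → α ≤ fromℚ (+ 2 ℚ./ 3)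
  cancel-⅔ {α} {m} {p} 1≤m 3p≤2m h δ 0<δ with h δ 0<δ
  ... | N , hN = N , λ n N≤n → ℚ.*-cancelʳ-≤-pos (ι m) {{ℚ.positive 0<m}} (begin
    seq α n ℚ.* ι m                                ≤⟨ hN n N≤n ⟩
    ι p ℚ.+ δ
      ≡⟨ cong₂ ℚ._+_ (solve 1 (λ p → p := con (+ 1 ℚ./ 3) :* (con (ι 3) :* p)) refl (ι p)) (sym (ℚ.*-identityʳ δ)) ⟩
    (+ 1 ℚ./ 3) ℚ.* (ι 3 ℚ.* ι p) ℚ.+ δ ℚ.* ι 1
      ≤⟨ ℚ.+-mono-≤ (ℚ.*-monoˡ-≤-nonNeg (+ 1 ℚ./ 3) 3ιp≤2ιm)
           (ℚ.*-monoˡ-≤-nonNeg δ {{ℚ.nonNegative (ℚ.<⇒≤ 0<δ)}} (ι-mono 1≤m)) ⟩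
    (+ 1 ℚ./ 3) ℚ.* (ι 2 ℚ.* ι m) ℚ.+ δ ℚ.* ι m
      ≡⟨ solve 2 (λ m d → con (+ 1 ℚ./ 3) :* (con (ι 2) :* m) :+ d :* m := (con (+ 2 ℚ./ 3) :+ d) :* m) refl (ι m) δ ⟩
    ((+ 2 ℚ./ 3) ℚ.+ δ) ℚ.* ι m ∎)
    where
    open ℚ.≤-Reasoning
    open +-*-Solver
    0<m : 0ℚ ℚ.< ι m
    0<m = ℚ.<-≤-trans (ℚ.positive⁻¹ 1ℚ) (ι-mono 1≤m)
    3ιp≤2ιm : ι 3 ℚ.* ι p ℚ.≤ ι 2 ℚ.* ι m
    3ιp≤2ιm = begin
      ι 3 ℚ.* ι p    ≡⟨ ι-* 3 p ⟨
      ι (3 ℕ.* p)    ≤⟨ ι-mono 3p≤2m ⟩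
      ι (2 ℕ.* m)    ≡⟨ ι-* 2 m ⟩
      ι 2 ℚ.* ι m    ∎

≐⇒≼ : ∀ {x y} → x ≐ y → x ≼ y
≐⇒≼ {x} {y} eq = ≼-intro (eventually⇒≤ {x} {y} (0 , λ n _ → ℚ.≤-reflexive (at eq n)))

≼-preorder : Preorder 0ℓ 0ℓ 0ℓ
≼-preorder = record
  { Carrier = ℝ
  ; _≈_ = _≐_
  ; _≲_ = _≼_
  ; isPreorder = record
    { isEquivalence = ≐-isEquivalence
    ; reflexive = ≐⇒≼
    ; trans = λ {x} {y} {z} p q → ≼-intro (≤-trans {x} {y} {z} (≼⇒≤ p) (≼⇒≤ q))
    }
  }

module ≼ = Preorder ≼-preorder
module ≼-Reasoning = PreorderReasoning ≼-preorder

+-mono-≼ : ∀ {x y z w} → x ≼ y → z ≼ w → x + z ≼ y + w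
+-mono-≼ {x} {y} {z} {w} p q = ≼-intro (+-mono-≤ {x} {y} {z} {w} (≼⇒≤ p) (≼⇒≤ q))

*-monoʳ-≼ : ∀ {x y z} → 0ℝ ≼ z → x ≼ y → x * z ≼ y * z
*-monoʳ-≼ {x} {y} {z} p q = ≼-intro (*-monoʳ-≤ {x} {y} {z} (≼⇒≤ p) (≼⇒≤ q))

*-monoˡ-≼ : ∀ {x y z} → 0ℝ ≼ z → x ≼ y → z * x ≼ z * y
*-monoˡ-≼ {x} {y} {z} 0≼z x≼y = begin
  z * x   ≈⟨ ℛ.*-comm z x ⟩
  x * z   ≲⟨ *-monoʳ-≼ 0≼z x≼y ⟩
  y * z   ≈⟨ ℛ.*-comm y z ⟩
  z * y   ∎
  where open ≼-Reasoning

fromℕ-+ : ∀ m n → fromℕ (m ℕ.+ n) ≐ fromℕ m + fromℕ n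
fromℕ-+ m n = pointwise λ _ → ι-+ m n

fromℕ-* : ∀ m n → fromℕ (m ℕ.* n) ≐ fromℕ m * fromℕ n
fromℕ-* m n = pointwise λ _ → ι-* m n

fromℕ-mono : ∀ {m n} → m ℕ.≤ n → fromℕ m ≼ fromℕ n
fromℕ-mono {m} {n} m≤n = ≼-intro (eventually⇒≤ {fromℕ m} {fromℕ n} (0 , λ _ _ → ι-mono m≤n))

0≼fromℕ : ∀ n → 0ℝ ≼ fromℕ n
0≼fromℕ n = fromℕ-mono {0} {n} ℕ.z≤n

0≼* : ∀ {x y} → 0ℝ ≼ x → 0ℝ ≼ y → 0ℝ ≼ x * y
0≼* {x} {y} 0≼x 0≼y = begin
  0ℝ       ≈⟨ ℛ.zeroˡ y ⟨
  0ℝ * y   ≲⟨ *-monoʳ-≼ 0≼y 0≼x ⟩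
  x * y    ∎
  where open ≼-Reasoning

∑-mono : ∀ {A : Set} (xs : List A) {f g : A → ℝ} → (∀ a → f a ≼ g a) → ∑ xs f ≼ ∑ xs g
∑-mono []       h = ≼.refl
∑-mono (x ∷ xs) h = +-mono-≼ (h x) (∑-mono xs h)

0≼∑ : ∀ {A : Set} (xs : List A) {f : A → ℝ} → (∀ a → 0ℝ ≼ f a) → 0ℝ ≼ ∑ xs f
0≼∑ xs {f} h = begin
  0ℝ                ≈⟨ ℝΣ.Σ-zero xs ⟨
  ∑ xs (λ _ → 0ℝ)   ≲⟨ ∑-mono xs h ⟩
  ∑ xs f            ∎
  where open ≼-Reasoning

fromℕ-Σ : ∀ {A : Set} (xs : List A) (f : A → ℕ) → fromℕ (Σ[ xs ] f) ≐ ∑ xs (λ a → fromℕ (f a))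
fromℕ-Σ []       f = ℛ.refl
fromℕ-Σ (x ∷ xs) f = ℛ.trans (fromℕ-+ (f x) (Σ[ xs ] f)) (ℛ.+-congˡ (fromℕ-Σ xs f))

∑-const : ∀ {A : Set} (xs : List A) x → ∑ xs (λ _ → x) ≐ fromℕ (Σ[ xs ] (λ _ → 1)) * x
∑-const []       x = ℛ.sym (ℛ.zeroˡ x)
∑-const (a ∷ xs) x = begin
  x + ∑ xs (λ _ → x)                                ≈⟨ ℛ.+-cong (ℛ.sym (ℛ.*-identityˡ x)) (∑-const xs x) ⟩
  1ℝ * x + fromℕ (Σ[ xs ] (λ _ → 1)) * x            ≈⟨ ℛ.distribʳ x 1ℝ _ ⟨
  (1ℝ + fromℕ (Σ[ xs ] (λ _ → 1))) * x              ≈⟨ ℛ.*-congʳ (fromℕ-+ 1 (Σ[ xs ] (λ _ → 1))) ⟨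
  fromℕ (Σ[ a ∷ xs ] (λ _ → 1)) * x                 ∎
  where open ℛ-Reasoning

∑-filterᵇ : ∀ {A : Set} (S : A → Bool) (xs : List A) (f : A → ℝ) →
  ∑ (filterᵇ S xs) f ≐ ∑ xs (λ a → f a * fromℕ (ind (S a)))
∑-filterᵇ S []       f = ℛ.refl
∑-filterᵇ S (x ∷ xs) f with S x
... | true  = ℛ.+-cong (ℛ.sym (ℛ.*-identityʳ (f x))) (∑-filterᵇ S xs f)
... | false = ℛ.trans (∑-filterᵇ S xs f) (ℛ.trans (ℛ.sym (ℛ.+-identityˡ _)) (ℛ.+-congʳ (ℛ.sym (ℛ.zeroʳ (f x)))))

-- The exponential series

-- The coefficients of the Cauchy product of two power series.
conv : (ℕ → ℚ) → (ℕ → ℚ) → ℕ → ℚ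
conv a b zero    = a 0 ℚ.* b 0
conv a b (suc d) = a 0 ℚ.* b (suc d) ℚ.+ conv (a ∘ suc) b d

-- Sequences stand for power series: the binomial theorem for term follows from
-- the Leibniz rule, since term solves y′ = x y.
deriv : (ℕ → ℚ) → ℕ → ℚ
deriv a i = ι (suc i) ℚ.* a (suc i)

psum : (ℕ → ℚ) → ℕ → ℚ
psum a zero    = a 0
psum a (suc n) = psum a n ℚ.+ a (suc n)

opaque
  conv-cong : ∀ {a a′ b b′} → (∀ i → a i ≡ a′ i) → (∀ i → b i ≡ b′ i) → ∀ d → conv a b d ≡ conv a′ b′ d
  conv-cong p q zero    = cong₂ ℚ._*_ (p 0) (q 0)
  conv-cong p q (suc d) = cong₂ ℚ._+_ (cong₂ ℚ._*_ (p 0) (q (suc d))) (conv-cong (p ∘ suc) q d)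

  conv-+ˡ : ∀ a a′ b d → conv (λ i → a i ℚ.+ a′ i) b d ≡ conv a b d ℚ.+ conv a′ b d
  conv-+ˡ a a′ b zero    = ℚ.*-distribʳ-+ (b 0) (a 0) (a′ 0)
  conv-+ˡ a a′ b (suc d) = trans (cong ((a 0 ℚ.+ a′ 0) ℚ.* b (suc d) ℚ.+_) (conv-+ˡ (a ∘ suc) (a′ ∘ suc) b d))
    (solve 5 (λ x y z u v → (x :+ y) :* z :+ (u :+ v) := (x :* z :+ u) :+ (y :* z :+ v)) refl
      (a 0) (a′ 0) (b (suc d)) (conv (a ∘ suc) b d) (conv (a′ ∘ suc) b d))
    where open +-*-Solver

  conv-*ˡ : ∀ a b r d → conv (λ i → a i ℚ.* r) b d ≡ conv a b d ℚ.* r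
  conv-*ˡ a b r zero    = solve 3 (λ x y r → x :* r :* y := x :* y :* r) refl (a 0) (b 0) r
    where open +-*-Solver
  conv-*ˡ a b r (suc d) = trans (cong (a 0 ℚ.* r ℚ.* b (suc d) ℚ.+_) (conv-*ˡ (a ∘ suc) b r d))
    (solve 4 (λ x y r c → x :* r :* y :+ c :* r := (x :* y :+ c) :* r) refl
      (a 0) (b (suc d)) r (conv (a ∘ suc) b d))
    where open +-*-Solver

  conv-*ʳ : ∀ a b r d → conv a (λ i → b i ℚ.* r) d ≡ conv a b d ℚ.* r
  conv-*ʳ a b r zero    = sym (ℚ.*-assoc (a 0) (b 0) r)
  conv-*ʳ a b r (suc d) = trans (cong (a 0 ℚ.* (b (suc d) ℚ.* r) ℚ.+_) (conv-*ʳ (a ∘ suc) b r d))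
    (solve 4 (λ x y r c → x :* (y :* r) :+ c :* r := (x :* y :+ c) :* r) refl
      (a 0) (b (suc d)) r (conv (a ∘ suc) b d))
    where open +-*-Solver

  0≤conv : ∀ {a b} → (∀ i → 0ℚ ℚ.≤ a i) → (∀ i → 0ℚ ℚ.≤ b i) → ∀ d → 0ℚ ℚ.≤ conv a b d
  0≤conv p q zero    = 0≤* (p 0) (q 0)
  0≤conv p q (suc d) = ℚ.+-mono-≤ (0≤* (p 0) (q (suc d))) (0≤conv (p ∘ suc) q d)

  -- The polynomial identity behind the induction step of `leibniz`, with each convolution replaced
  -- by a variable. The hypotheses are i = j + 1, the recursion of `conv`, the induction hypothesis,
  -- and the product rule for the shifted factor.
  leibniz-step : ∀ i j x y x₁ y₁ C C₂ S P Q → i ≡ 1ℚ ℚ.+ j → C ≡ x₁ ℚ.* y₁ ℚ.+ C₂ → j ℚ.* C ≡ P ℚ.+ Q → S ≡ P ℚ.+ C₂ →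
    i ℚ.* (x ℚ.* y ℚ.+ C) ≡ (ι 1 ℚ.* x₁ ℚ.* y₁ ℚ.+ S) ℚ.+ (x ℚ.* (i ℚ.* y) ℚ.+ Q)
  leibniz-step i j x y x₁ y₁ C C₂ S P Q refl refl jC refl = trans
    (solve 6 (λ j x y x₁ y₁ C₂ → (con 1ℚ :+ j) :* (x :* y :+ (x₁ :* y₁ :+ C₂))
       := (x₁ :* y₁ :+ C₂ :+ (con 1ℚ :+ j) :* (x :* y)) :+ j :* (x₁ :* y₁ :+ C₂)) refl j x y x₁ y₁ C₂)
    (trans (cong (x₁ ℚ.* y₁ ℚ.+ C₂ ℚ.+ (1ℚ ℚ.+ j) ℚ.* (x ℚ.* y) ℚ.+_) jC)
      (solve 8 (λ i x y x₁ y₁ C₂ P Q → (x₁ :* y₁ :+ C₂ :+ i :* (x :* y)) :+ (P :+ Q)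
         := (con 1ℚ :* x₁ :* y₁ :+ (P :+ C₂)) :+ (x :* (i :* y) :+ Q)) refl (1ℚ ℚ.+ j) x y x₁ y₁ C₂ P Q))
    where open +-*-Solver

  leibniz : ∀ a b d → deriv (conv a b) d ≡ conv (deriv a) b d ℚ.+ conv a (deriv b) d
  leibniz a b zero    = solve 5 (λ i x x′ y y′ → i :* (x :* y′ :+ x′ :* y) := i :* x′ :* y :+ x :* (i :* y′)) refl
    (ι 1) (a 0) (a 1) (b 0) (b 1)
    where open +-*-Solver
  leibniz a b (suc d) = leibniz-step (ι (suc (suc d))) (ι (suc d)) (a 0) (b (suc (suc d))) (a 1) (b (suc d))
    (conv (a ∘ suc) b (suc d)) (conv (λ i → a (suc (suc i))) b d) (conv (deriv a ∘ suc) b d)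
    (conv (deriv (a ∘ suc)) b d) (conv (a ∘ suc) (deriv b) d)
    (ι-+ 1 (suc d)) refl (leibniz (a ∘ suc) b d) shifted
    where
    split : ∀ i → deriv a (suc i) ≡ deriv (a ∘ suc) i ℚ.+ a (suc (suc i))
    split i = trans (cong (ℚ._* a (suc (suc i))) (trans (ι-+ 1 (suc i)) (ℚ.+-comm 1ℚ (ι (suc i)))))
      (trans (ℚ.*-distribʳ-+ (a (suc (suc i))) (ι (suc i)) 1ℚ)
        (cong (deriv (a ∘ suc) i ℚ.+_) (ℚ.*-identityˡ (a (suc (suc i))))))
    shifted : conv (deriv a ∘ suc) b d ≡ conv (deriv (a ∘ suc)) b d ℚ.+ conv (λ i → a (suc (suc i))) b d
    shifted = trans (conv-cong {deriv a ∘ suc} {λ i → deriv (a ∘ suc) i ℚ.+ a (suc (suc i))} {b} {b} split (λ _ → refl) d)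
      (conv-+ˡ (deriv (a ∘ suc)) (λ i → a (suc (suc i))) b d)

  ι-cancel : ∀ n {p q} → ι (suc n) ℚ.* p ≡ ι (suc n) ℚ.* q → p ≡ q
  ι-cancel n {p} {q} eq = trans (sym (unscale p)) (trans (cong (inv n ℚ.*_) eq) (unscale q))
    where
    unscale : ∀ p → inv n ℚ.* (ι (suc n) ℚ.* p) ≡ p
    unscale p = trans (solve 3 (λ i m p → i :* (m :* p) := m :* i :* p) refl (inv n) (ι (suc n)) p)
      (trans (cong (ℚ._* p) (ι*inv n)) (ℚ.*-identityˡ p))
      where open +-*-Solver

  term-binomial : ∀ x y n → term n (x ℚ.+ y) ≡ conv (λ i → term i x) (λ j → term j y) n
  term-binomial x y zero    = refl
  term-binomial x y (suc n) = ι-cancel n (begin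
    ι (suc n) ℚ.* term (suc n) (x ℚ.+ y)          ≡⟨ term-step (x ℚ.+ y) n ⟨
    term n (x ℚ.+ y) ℚ.* (x ℚ.+ y)                ≡⟨ cong (ℚ._* (x ℚ.+ y)) (term-binomial x y n) ⟩
    conv tx ty n ℚ.* (x ℚ.+ y)                    ≡⟨ ℚ.*-distribˡ-+ (conv tx ty n) x y ⟩
    conv tx ty n ℚ.* x ℚ.+ conv tx ty n ℚ.* y
      ≡⟨ cong₂ ℚ._+_
           (trans (conv-cong {b = ty} (λ i → sym (term-step x i)) (λ _ → refl) n) (conv-*ˡ tx ty x n))
           (trans (conv-cong {a = tx} (λ _ → refl) (λ i → sym (term-step y i)) n) (conv-*ʳ tx ty y n)) ⟨
    conv (deriv tx) ty n ℚ.+ conv tx (deriv ty) n ≡⟨ leibniz tx ty n ⟨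
    ι (suc n) ℚ.* conv tx ty (suc n)              ∎)
    where
    open ≡-Reasoning
    tx ty : ℕ → ℚ
    tx i = term i x
    ty i = term i y

  psum-shift : ∀ a n → psum a (suc n) ≡ a 0 ℚ.+ psum (a ∘ suc) n
  psum-shift a zero    = refl
  psum-shift a (suc n) = trans (cong (ℚ._+ a (suc (suc n))) (psum-shift a n)) (ℚ.+-assoc (a 0) _ _)

  psum-cong : ∀ {a b} → (∀ i → a i ≡ b i) → ∀ n → psum a n ≡ psum b n
  psum-cong p zero    = p 0
  psum-cong p (suc n) = cong₂ ℚ._+_ (psum-cong p n) (p (suc n))

  -- The triangle of index pairs with sum at most n + 1 consists of its first row and a triangle of
  -- size n.
  psum-conv : ∀ a b n → psum (conv a b) (suc n) ≡ a 0 ℚ.* psum b (suc n) ℚ.+ psum (conv (a ∘ suc) b) n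
  psum-conv a b zero    = solve 4 (λ x x₁ y y₁ → x :* y :+ (x :* y₁ :+ x₁ :* y) := x :* (y :+ y₁) :+ x₁ :* y) refl
    (a 0) (a 1) (b 0) (b 1)
    where open +-*-Solver
  psum-conv a b (suc n) = trans (cong (ℚ._+ conv a b (suc (suc n))) (psum-conv a b n))
    (solve 5 (λ x s t y c → x :* s :+ t :+ (x :* y :+ c) := x :* (s :+ y) :+ (t :+ c)) refl
      (a 0) (psum b (suc n)) (psum (conv (a ∘ suc) b) n) (b (suc (suc n))) (conv (a ∘ suc) b (suc n)))
    where open +-*-Solver

  0≤psum : ∀ {a} → (∀ i → 0ℚ ℚ.≤ a i) → ∀ n → 0ℚ ℚ.≤ psum a n
  0≤psum p zero    = p 0
  0≤psum p (suc n) = ℚ.+-mono-≤ (0≤psum p n) (p (suc n))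

  p≤p+q : ∀ p {q} → 0ℚ ℚ.≤ q → p ℚ.≤ p ℚ.+ q
  p≤p+q p {q} 0≤q = subst (ℚ._≤ p ℚ.+ q) (ℚ.+-identityʳ p) (ℚ.+-monoʳ-≤ p 0≤q)

  psum-mono : ∀ {a} → (∀ i → 0ℚ ℚ.≤ a i) → ∀ m d → psum a m ℚ.≤ psum a (d ℕ.+ m)
  psum-mono p m zero    = ℚ.≤-refl
  psum-mono p m (suc d) = ℚ.≤-trans (psum-mono p m d) (p≤p+q _ (p (suc (d ℕ.+ m))))

  -- The rectangle of pairs (i, j) with i ≤ n and j ≤ m lies in the triangle i + j ≤ n + m, and all
  -- terms are nonnegative.
  psum-* : ∀ {a b} → (∀ i → 0ℚ ℚ.≤ a i) → (∀ i → 0ℚ ℚ.≤ b i) → ∀ n m →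
    psum a n ℚ.* psum b m ℚ.≤ psum (conv a b) (n ℕ.+ m)
  psum-* {a} {b} 0≤a 0≤b zero    zero    = ℚ.≤-refl
  psum-* {a} {b} 0≤a 0≤b zero    (suc m) = ℚ.≤-trans (p≤p+q _ (0≤psum (0≤conv (0≤a ∘ suc) 0≤b) m))
    (ℚ.≤-reflexive (sym (psum-conv a b m)))
  psum-* {a} {b} 0≤a 0≤b (suc n) m       = begin
    psum a (suc n) ℚ.* psum b m
      ≡⟨ cong (ℚ._* psum b m) (psum-shift a n) ⟩
    (a 0 ℚ.+ psum (a ∘ suc) n) ℚ.* psum b m
      ≡⟨ ℚ.*-distribʳ-+ (psum b m) (a 0) _ ⟩
    a 0 ℚ.* psum b m ℚ.+ psum (a ∘ suc) n ℚ.* psum b m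
      ≤⟨ ℚ.+-mono-≤ (ℚ.*-monoˡ-≤-nonNeg (a 0) {{ℚ.nonNegative (0≤a 0)}} (psum-mono 0≤b m (suc n)))
           (psum-* (0≤a ∘ suc) 0≤b n m) ⟩
    a 0 ℚ.* psum b (suc n ℕ.+ m) ℚ.+ psum (conv (a ∘ suc) b) (n ℕ.+ m)
      ≡⟨ psum-conv a b (n ℕ.+ m) ⟨
    psum (conv a b) (suc n ℕ.+ m) ∎
    where open ℚ.≤-Reasoning

  expSum-psum : ∀ n x → expSum n x ≡ psum (λ i → term i x) n
  expSum-psum zero    x = refl
  expSum-psum (suc n) x = cong (ℚ._+ term (suc n) x) (expSum-psum n x)

  0≤term′ : ∀ {x} → 0ℚ ℚ.≤ x → ∀ j → 0ℚ ℚ.≤ term j x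
  0≤term′ 0≤x zero    = 0≤ι 1
  0≤term′ 0≤x (suc j) = 0≤* (0≤* (0≤term′ 0≤x j) 0≤x) (0≤inv j)

  0≤expSum : ∀ {x} → 0ℚ ℚ.≤ x → ∀ n → 0ℚ ℚ.≤ expSum n x
  0≤expSum {x} 0≤x n = subst (0ℚ ℚ.≤_) (sym (expSum-psum n x)) (0≤psum (0≤term′ 0≤x) n)

  -- Half of the functional equation of exp, exact on truncations because the order is allowed to
  -- grow to n + m.
  expSum-* : ∀ {x y} → 0ℚ ℚ.≤ x → 0ℚ ℚ.≤ y → ∀ n m →
    expSum n x ℚ.* expSum m y ℚ.≤ expSum (n ℕ.+ m) (x ℚ.+ y)
  expSum-* {x} {y} 0≤x 0≤y n m = subst (ℚ._≤ expSum (n ℕ.+ m) (x ℚ.+ y))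
    (sym (cong₂ ℚ._*_ (expSum-psum n x) (expSum-psum m y)))
    (subst (psum tx n ℚ.* psum ty m ℚ.≤_) (sym eq) (psum-* {tx} {ty} (0≤term′ 0≤x) (0≤term′ 0≤y) n m))
    where
    tx ty : ℕ → ℚ
    tx i = term i x
    ty i = term i y
    eq : expSum (n ℕ.+ m) (x ℚ.+ y) ≡ psum (conv tx ty) (n ℕ.+ m)
    eq = trans (expSum-psum (n ℕ.+ m) (x ℚ.+ y))
      (psum-cong {λ i → term i (x ℚ.+ y)} {conv tx ty} (term-binomial x y) (n ℕ.+ m))

  term-mono : ∀ {x y} → 0ℚ ℚ.≤ x → x ℚ.≤ y → ∀ j → term j x ℚ.≤ term j y
  term-mono 0≤x x≤y zero    = ℚ.≤-refl
  term-mono {x} {y} 0≤x x≤y (suc j) = ℚ.*-monoʳ-≤-nonNeg (inv j) {{ℚ.nonNegative (0≤inv j)}}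
    (*-mono (0≤term′ 0≤x j) (ℚ.≤-trans 0≤x x≤y) (term-mono 0≤x x≤y j) x≤y)

  expSum-mono : ∀ {x y} → 0ℚ ℚ.≤ x → x ℚ.≤ y → ∀ n → expSum n x ℚ.≤ expSum n y
  expSum-mono 0≤x x≤y zero    = ℚ.≤-refl
  expSum-mono 0≤x x≤y (suc n) = ℚ.+-mono-≤ (expSum-mono 0≤x x≤y n) (term-mono 0≤x x≤y (suc n))

  x≤c*x : ∀ {c x} → 1ℚ ℚ.≤ c → 0ℚ ℚ.≤ x → x ℚ.≤ c ℚ.* x
  x≤c*x {c} {x} 1≤c 0≤x = ℚ.≤-trans (ℚ.≤-reflexive (sym (ℚ.*-identityˡ x)))
    (ℚ.*-monoʳ-≤-nonNeg x {{ℚ.nonNegative 0≤x}} 1≤c)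

  1≤ι : ∀ n → 1ℚ ℚ.≤ ι (suc n)
  1≤ι n = ι-mono {1} {suc n} (ℕ.s≤s ℕ.z≤n)

  term-super : ∀ q {x} → 0ℚ ℚ.≤ x → ∀ j → ι (suc q) ℚ.* term (suc j) x ℚ.≤ term (suc j) (ι (suc q) ℚ.* x)
  term-super q {x} 0≤x j = begin
    ι (suc q) ℚ.* (term j x ℚ.* x ℚ.* inv j)
      ≡⟨ solve 4 (λ q t x i → q :* (t :* x :* i) := t :* (q :* x) :* i) refl (ι (suc q)) (term j x) x (inv j) ⟩
    term j x ℚ.* (ι (suc q) ℚ.* x) ℚ.* inv j
      ≤⟨ ℚ.*-monoʳ-≤-nonNeg (inv j) {{ℚ.nonNegative (0≤inv j)}}
           (ℚ.*-monoʳ-≤-nonNeg (ι (suc q) ℚ.* x) {{ℚ.nonNegative (0≤* (0≤ι (suc q)) 0≤x)}}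
             (term-mono 0≤x (x≤c*x (1≤ι q) 0≤x) j)) ⟩
    term j (ι (suc q) ℚ.* x) ℚ.* (ι (suc q) ℚ.* x) ℚ.* inv j ∎
    where
    open ℚ.≤-Reasoning
    open +-*-Solver

  -- Convexity along the chord from 0 to (q + 1) x, multiplied by q + 1: the point x divides it in
  -- the ratio 1 : q, and the value at 0 is 1. Termwise it says that (q + 1) x^j ≤ ((q + 1) x)^j for
  -- j ≥ 1.
  expSum-convex : ∀ q {x} → 0ℚ ℚ.≤ x → ∀ n → ι (suc q) ℚ.* expSum n x ℚ.≤ ι q ℚ.+ expSum n (ι (suc q) ℚ.* x)
  expSum-convex q {x} 0≤x zero    = ℚ.≤-reflexive
    (trans (ℚ.*-identityʳ (ι (suc q))) (trans (ι-+ 1 q) (ℚ.+-comm 1ℚ (ι q))))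
  expSum-convex q {x} 0≤x (suc n) = begin
    ι (suc q) ℚ.* (expSum n x ℚ.+ term (suc n) x)
      ≡⟨ ℚ.*-distribˡ-+ (ι (suc q)) (expSum n x) (term (suc n) x) ⟩
    ι (suc q) ℚ.* expSum n x ℚ.+ ι (suc q) ℚ.* term (suc n) x
      ≤⟨ ℚ.+-mono-≤ (expSum-convex q 0≤x n) (term-super q 0≤x n) ⟩
    ι q ℚ.+ expSum n (ι (suc q) ℚ.* x) ℚ.+ term (suc n) (ι (suc q) ℚ.* x)
      ≡⟨ ℚ.+-assoc (ι q) _ _ ⟩
    ι q ℚ.+ expSum (suc n) (ι (suc q) ℚ.* x) ∎
    where open ℚ.≤-Reasoning

-- Powers of exp ε against k

infixr 8 _^_

_^_ : ℝ → ℕ → ℝ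
x ^ zero  = 1ℝ
x ^ suc n = x * x ^ n

opaque
  -- A product of D truncations of order n is dominated by one truncation of order D n at the D-fold
  -- argument.
  exp-^ : ∀ ε D n → 0ℚ ℚ.≤ seq ε n → seq (exp ε ^ D) n ℚ.≤ expSum (D ℕ.* n) (ι D ℚ.* seq ε n)
  exp-^ ε zero    n 0≤x = ℚ.≤-refl
  exp-^ ε (suc D) n 0≤x = begin
    expSum n (seq ε n) ℚ.* seq (exp ε ^ D) n
      ≤⟨ ℚ.*-monoˡ-≤-nonNeg (expSum n (seq ε n)) {{ℚ.nonNegative (0≤expSum 0≤x n)}} (exp-^ ε D n 0≤x) ⟩
    expSum n (seq ε n) ℚ.* expSum (D ℕ.* n) (ι D ℚ.* seq ε n)
      ≤⟨ expSum-* 0≤x (0≤* (0≤ι D) 0≤x) n (D ℕ.* n) ⟩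
    expSum (suc D ℕ.* n) (seq ε n ℚ.+ ι D ℚ.* seq ε n)
      ≡⟨ cong (expSum (suc D ℕ.* n)) (trans
           (solve 2 (λ x d → x :+ d :* x := (con 1ℚ :+ d) :* x) refl (seq ε n) (ι D))
           (cong (ℚ._* seq ε n) (sym (ι-+ 1 D)))) ⟩
    expSum (suc D ℕ.* n) (ι (suc D) ℚ.* seq ε n) ∎
    where
    open ℚ.≤-Reasoning
    open +-*-Solver

  0<⇒eventually : ∀ {ε} → 0ℝ < ε → ∃ λ δ → 0ℚ ℚ.< δ × ∃ λ N → ∀ n → N ℕ.≤ n → δ ℚ.≤ seq ε n
  0<⇒eventually {ε} (δ , 0<δ , N , h) = δ , 0<δ , N , λ n N≤n →
    subst (ℚ._≤ seq ε n) (ℚ.+-identityˡ δ) (h n N≤n)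

  0≤exp : ∀ {ε} → 0ℝ < ε → 0ℝ ≤ exp ε
  0≤exp {ε} 0<ε with 0<⇒eventually {ε} 0<ε
  ... | δ , 0<δ , N , h = eventually⇒≤ {0ℝ} {exp ε}
    (N , λ n N≤n → 0≤expSum (ℚ.≤-trans (ℚ.<⇒≤ 0<δ) (h n N≤n)) n)

  -- The additive slack of ε ≤ inv M * ℓ is absorbed into half of ε, which is
  -- bounded away from 0.
  scaled : ∀ {ε ℓ} M → 0ℝ < ε → ε ≤ fromℚ (inv M) * ℓ →
    ∃ λ N → ∀ n → N ℕ.≤ n → ∀ m → m ℕ.+ m ℕ.≤ suc M → ι m ℚ.* seq ε n ℚ.≤ seq ℓ n
  scaled {ε} {ℓ} M 0<ε ε≤cℓ with 0<⇒eventually {ε} 0<ε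
  ... | δ , 0<δ , N₁ , h₁ with shrink 0<δ 2
  ... | η , 0<η , 2η≤δ with ε≤cℓ η 0<η
  ... | N₂ , h₂ = N₁ ℕ.⊔ N₂ , λ n ≤n m 2m≤ →
    bound (seq ε n) (seq ℓ n) (h₁ n (ℕ.m⊔n≤o⇒m≤o N₁ N₂ ≤n)) (h₂ n (ℕ.m⊔n≤o⇒n≤o N₁ N₂ ≤n)) m 2m≤
    where
    open ℚ.≤-Reasoning
    open +-*-Solver
    bound : ∀ x l → δ ℚ.≤ x → x ℚ.≤ inv M ℚ.* l ℚ.+ η → ∀ m → m ℕ.+ m ℕ.≤ suc M → ι m ℚ.* x ℚ.≤ l
    bound x l δ≤x x≤ m 2m≤ = ℚ.*-cancelˡ-≤-pos (ι 2) (begin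
      ι 2 ℚ.* (ι m ℚ.* x)
        ≡⟨ solve 2 (λ m x → con (ι 2) :* (m :* x) := (m :+ m) :* x) refl (ι m) x ⟩
      (ι m ℚ.+ ι m) ℚ.* x
        ≡⟨ cong (ℚ._* x) (ι-+ m m) ⟨
      ι (m ℕ.+ m) ℚ.* x
        ≤⟨ ℚ.*-monoʳ-≤-nonNeg x {{ℚ.nonNegative (ℚ.≤-trans (ℚ.<⇒≤ 0<δ) δ≤x)}} (ι-mono 2m≤) ⟩
      ι (suc M) ℚ.* x
        ≤⟨ ℚ.*-monoˡ-≤-nonNeg (ι (suc M)) {{ℚ.nonNegative (0≤ι (suc M))}} x≤2cl ⟩
      ι (suc M) ℚ.* (ι 2 ℚ.* (inv M ℚ.* l))
        ≡⟨ solve 4 (λ K t i l → K :* (t :* (i :* l)) := t :* (K :* i :* l)) refl (ι (suc M)) (ι 2) (inv M) l ⟩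
      ι 2 ℚ.* (ι (suc M) ℚ.* inv M ℚ.* l)
        ≡⟨ cong (λ u → ι 2 ℚ.* (u ℚ.* l)) (ι*inv M) ⟩
      ι 2 ℚ.* (1ℚ ℚ.* l)
        ≡⟨ cong (ι 2 ℚ.*_) (ℚ.*-identityˡ l) ⟩
      ι 2 ℚ.* l ∎)
      where
      x≤2cl : x ℚ.≤ ι 2 ℚ.* (inv M ℚ.* l)
      x≤2cl = begin
        x
          ≡⟨ solve 2 (λ x e → x := con (ι 2) :* x :- x) refl x η ⟩
        ι 2 ℚ.* x ℚ.- x
          ≤⟨ ℚ.+-mono-≤ (ℚ.*-monoˡ-≤-nonNeg (ι 2) x≤) (ℚ.neg-antimono-≤ (ℚ.≤-trans 2η≤δ δ≤x)) ⟩
        ι 2 ℚ.* (inv M ℚ.* l ℚ.+ η) ℚ.- ι 2 ℚ.* η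
          ≡⟨ solve 2 (λ c e → con (ι 2) :* (c :+ e) :- con (ι 2) :* e := con (ι 2) :* c) refl (inv M ℚ.* l) η ⟩
        ι 2 ℚ.* (inv M ℚ.* l) ∎

  -- The chain (q + 1) e^(Dε) ≤ q + e^((q + 1)Dε) ≤ q + e^ℓ ≤ q + k on truncations. Here `e₃` and
  -- `e₄` are truncations of e^ℓ of different orders; `η` bounds both the tail between them and the
  -- error in e^ℓ ≤ k.
  exp-^-chain : ∀ s p e₁ e₂ e₃ e₄ q k η ζ → 0ℚ ℚ.≤ s → p ℚ.≤ e₁ → s ℚ.* e₁ ℚ.≤ q ℚ.+ e₂ → e₂ ℚ.≤ e₃ →
    e₃ ℚ.- e₄ ℚ.≤ η → e₄ ℚ.≤ k ℚ.+ η → η ℚ.+ η ℚ.≤ ζ → s ℚ.* p ℚ.≤ (q ℚ.+ k) ℚ.+ ζ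
  exp-^-chain s p e₁ e₂ e₃ e₄ q k η ζ 0≤s p≤ se≤ e₂≤ e₃≤ e₄≤ 2η≤ = begin
    s ℚ.* p                           ≤⟨ ℚ.*-monoˡ-≤-nonNeg s {{ℚ.nonNegative 0≤s}} p≤ ⟩
    s ℚ.* e₁                          ≤⟨ se≤ ⟩
    q ℚ.+ e₂                          ≤⟨ ℚ.+-monoʳ-≤ q e₂≤ ⟩
    q ℚ.+ e₃                          ≡⟨ solve 3 (λ q e f → q :+ e := q :+ (f :+ (e :- f))) refl q e₃ e₄ ⟩
    q ℚ.+ (e₄ ℚ.+ (e₃ ℚ.- e₄))        ≤⟨ ℚ.+-monoʳ-≤ q (ℚ.+-mono-≤ e₄≤ e₃≤) ⟩
    q ℚ.+ (k ℚ.+ η ℚ.+ η)             ≡⟨ solve 3 (λ q k e → q :+ (k :+ e :+ e) := (q :+ k) :+ (e :+ e)) refl q k η ⟩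
    (q ℚ.+ k) ℚ.+ (η ℚ.+ η)           ≤⟨ ℚ.+-monoʳ-≤ (q ℚ.+ k) 2η≤ ⟩
    (q ℚ.+ k) ℚ.+ ζ                   ∎
    where
    open ℚ.≤-Reasoning
    open +-*-Solver

  exp-^-estimate : ∀ ε ℓ q D k B η ζ → η ℚ.+ η ℚ.≤ ζ → ∀ n → 0ℚ ℚ.≤ seq ε n →
    ι (suc q ℕ.* suc D) ℚ.* seq ε n ℚ.≤ seq ℓ n → ∣ seq ℓ n ∣ ℚ.≤ ι B →
    expSum n (seq ℓ n) ℚ.≤ ι k ℚ.+ η → term n (ι B) ℚ.≤ η → B ℕ.+ B ℕ.≤ n →
    ι (suc q) ℚ.* seq (exp ε ^ suc D) n ℚ.≤ ι (q ℕ.+ k) ℚ.+ ζ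
  exp-^-estimate ε ℓ q D k B η ζ 2η≤ζ n 0≤x x≤l l≤B el≤k t≤η 2B≤n = subst
    (λ r → ι (suc q) ℚ.* seq (exp ε ^ suc D) n ℚ.≤ r ℚ.+ ζ) (sym (ι-+ q k))
    (exp-^-chain (ι (suc q)) (seq (exp ε ^ suc D) n) (expSum m (ι (suc D) ℚ.* x)) (expSum m (ι (suc q) ℚ.* (ι (suc D) ℚ.* x)))
      (expSum m l) (expSum n l) (ι q) (ι k) η ζ
      (0≤ι (suc q)) (exp-^ ε (suc D) n 0≤x) (expSum-convex q 0≤Dx m) (expSum-mono (0≤* (0≤ι (suc q)) 0≤Dx) x≤l′ m)
      (ℚ.≤-trans (p≤∣p∣ _) (ℚ.≤-trans tail-small t≤η)) el≤k
      2η≤ζ)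
    where
    x l : ℚ
    x = seq ε n
    l = seq ℓ n
    m : ℕ
    m = suc D ℕ.* n
    0≤Dx : 0ℚ ℚ.≤ ι (suc D) ℚ.* x
    0≤Dx = 0≤* (0≤ι (suc D)) 0≤x
    x≤l′ : ι (suc q) ℚ.* (ι (suc D) ℚ.* x) ℚ.≤ l
    x≤l′ = subst (ℚ._≤ l) (trans (cong (ℚ._* x) (ι-* (suc q) (suc D))) (ℚ.*-assoc (ι (suc q)) (ι (suc D)) x)) x≤l
    tail-small : dist (expSum m l) (expSum n l) ℚ.≤ term n (ι B)
    tail-small = subst (λ j → dist (expSum j l) (expSum n l) ℚ.≤ term n (ι B)) (ℕ.+-comm (D ℕ.* n) n)
      (tail′ B l≤B 2B≤n (D ℕ.* n))

  -- Convexity replaces k^(1/(q + 1)) by its linear majorant (q + k)/(q + 1). The product (q + 1)(D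
  -- + 1) occurs twice in the condition on `M` because `scaled` gives up a factor 2.
  exp-^-bound : ∀ {ε ℓ k} q D M → suc q ℕ.* suc D ℕ.+ suc q ℕ.* suc D ℕ.≤ suc M →
    IsLog ℓ (fromℕ k) → 0ℝ < ε → ε ≤ fromℚ (inv M) * ℓ →
    fromℕ (suc q) * exp ε ^ suc D ≤ fromℕ (q ℕ.+ k)
  exp-^-bound {ε} {ℓ} {k} q D M ≤M (logℓ , _) 0<ε ε≤cℓ ζ 0<ζ =
    go (0<⇒eventually {ε} 0<ε) (scaled {ε} {ℓ} M 0<ε ε≤cℓ) (bounded {seq ℓ} (cauchy ℓ)) (shrink 0<ζ 2)
    where
    go : (∃ λ δ → 0ℚ ℚ.< δ × ∃ λ N → ∀ n → N ℕ.≤ n → δ ℚ.≤ seq ε n) →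
      (∃ λ N → ∀ n → N ℕ.≤ n → ∀ m → m ℕ.+ m ℕ.≤ suc M → ι m ℚ.* seq ε n ℚ.≤ seq ℓ n) →
      (∃ λ B → ∃ λ N → ∀ n → N ℕ.≤ n → ∣ seq ℓ n ∣ ℚ.≤ ι B) →
      (∃ λ η → 0ℚ ℚ.< η × ι 2 ℚ.* η ℚ.≤ ζ) →
      ∃ λ N → ∀ n → N ℕ.≤ n → ι (suc q) ℚ.* seq (exp ε ^ suc D) n ℚ.≤ ι (q ℕ.+ k) ℚ.+ ζ
    go (δ , 0<δ , N₁ , h₁) (N₂ , h₂) (B , N₃ , h₃) (η , 0<η , 2η≤ζ) = go′ (logℓ η 0<η) (term-small B 0<η)
      where
      go′ : (∃ λ N → ∀ n → N ℕ.≤ n → expSum n (seq ℓ n) ℚ.≤ ι k ℚ.+ η) →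
        (∃ λ N → ∀ n → N ℕ.≤ n → term n (ι B) ℚ.≤ η) →
        ∃ λ N → ∀ n → N ℕ.≤ n → ι (suc q) ℚ.* seq (exp ε ^ suc D) n ℚ.≤ ι (q ℕ.+ k) ℚ.+ ζ
      go′ (N₄ , h₄) (N₅ , h₅) = N₁ ℕ.+ (N₂ ℕ.+ (N₃ ℕ.+ (N₄ ℕ.+ (N₅ ℕ.+ (B ℕ.+ B))))) , λ n r₁ →
        let
          r₂ = ℕ.m+n≤o⇒n≤o N₁ r₁
          r₃ = ℕ.m+n≤o⇒n≤o N₂ r₂
          r₄ = ℕ.m+n≤o⇒n≤o N₃ r₃
          r₅ = ℕ.m+n≤o⇒n≤o N₄ r₄
        in exp-^-estimate ε ℓ q D k B η ζ (ℚ.≤-trans (ℚ.≤-reflexive (ι2 η)) 2η≤ζ) n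
             (ℚ.≤-trans (ℚ.<⇒≤ 0<δ) (h₁ n (ℕ.m+n≤o⇒m≤o N₁ r₁)))
             (h₂ n (ℕ.m+n≤o⇒m≤o N₂ r₂) (suc q ℕ.* suc D) ≤M) (h₃ n (ℕ.m+n≤o⇒m≤o N₃ r₃))
             (h₄ n (ℕ.m+n≤o⇒m≤o N₄ r₄)) (h₅ n (ℕ.m+n≤o⇒m≤o N₅ r₅)) (ℕ.m+n≤o⇒n≤o N₅ r₅)

  1+x≤expSum : ∀ {x} → 0ℚ ℚ.≤ x → ∀ n → 1ℚ ℚ.+ x ℚ.≤ expSum (suc n) x
  1+x≤expSum {x} 0≤x zero    = ℚ.≤-reflexive
    (cong (1ℚ ℚ.+_) (sym (trans (ℚ.*-identityʳ (1ℚ ℚ.* x)) (ℚ.*-identityˡ x))))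
  1+x≤expSum 0≤x (suc n) = ℚ.≤-trans (1+x≤expSum 0≤x n) (p≤p+q _ (0≤term′ 0≤x (suc (suc n))))

  -- From ε ≤ c ℓ the logarithm is at least ε and so bounded away from 0, whereas 1 + ℓ ≤ e^ℓ = 1.
  -- The `suc M` makes c at most 1/2, as `scaled` requires for the multiple 1.
  log-one-impossible : ∀ {ε ℓ} M → IsLog ℓ (fromℕ 1) → 0ℝ < ε → ε ≤ fromℚ (inv (suc M)) * ℓ → ⊥
  log-one-impossible {ε} {ℓ} M (logℓ , _) 0<ε ε≤cℓ = go (0<⇒eventually {ε} 0<ε) (scaled {ε} {ℓ} (suc M) 0<ε ε≤cℓ)
    where
    collide : ∀ {δ η x l e} → 0ℚ ℚ.< η → η ℚ.+ η ℚ.≤ δ → δ ℚ.≤ x → 1ℚ ℚ.* x ℚ.≤ l → 1ℚ ℚ.+ l ℚ.≤ e → e ℚ.≤ 1ℚ ℚ.+ η → ⊥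
    collide {δ} {η} {x} {l} {e} 0<η 2η≤δ δ≤x x≤l l≤e e≤η = ℚ.<-irrefl refl (begin-strict
      1ℚ ℚ.+ l      ≤⟨ l≤e ⟩
      e             ≤⟨ e≤η ⟩
      1ℚ ℚ.+ η      <⟨ ℚ.+-monoʳ-< 1ℚ (begin-strict
        η             ≡⟨ ℚ.+-identityʳ η ⟨
        η ℚ.+ 0ℚ      <⟨ ℚ.+-monoʳ-< η 0<η ⟩
        η ℚ.+ η       ≤⟨ 2η≤δ ⟩
        δ             ≤⟨ δ≤x ⟩
        x             ≡⟨ ℚ.*-identityˡ x ⟨
        1ℚ ℚ.* x      ≤⟨ x≤l ⟩
        l             ∎) ⟩
      1ℚ ℚ.+ l      ∎)
      where open ℚ.≤-Reasoning
    go : (∃ λ δ → 0ℚ ℚ.< δ × ∃ λ N → ∀ n → N ℕ.≤ n → δ ℚ.≤ seq ε n) →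
      (∃ λ N → ∀ n → N ℕ.≤ n → ∀ m → m ℕ.+ m ℕ.≤ suc (suc M) → ι m ℚ.* seq ε n ℚ.≤ seq ℓ n) → ⊥
    go (δ , 0<δ , N₁ , h₁) (N₂ , h₂) = go′ (shrink 0<δ 2)
      where
      go′ : (∃ λ η → 0ℚ ℚ.< η × ι 2 ℚ.* η ℚ.≤ δ) → ⊥
      go′ (η , 0<η , 2η≤δ) = go″ (logℓ η 0<η)
        where
        go″ : (∃ λ N → ∀ n → N ℕ.≤ n → expSum n (seq ℓ n) ℚ.≤ ι 1 ℚ.+ η) → ⊥
        go″ (N₃ , h₃) = collide {δ} {η} {seq ε (suc N)} {seq ℓ (suc N)} {expSum (suc N) (seq ℓ (suc N))}
          0<η (ℚ.≤-trans (ℚ.≤-reflexive (ι2 η)) 2η≤δ) δ≤x x≤l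
          (1+x≤expSum (ℚ.≤-trans (ℚ.<⇒≤ 0<δ) (ℚ.≤-trans δ≤x
            (ℚ.≤-trans (ℚ.≤-reflexive (sym (ℚ.*-identityˡ (seq ε (suc N))))) x≤l))) N)
          (h₃ (suc N) (ℕ.m≤n⇒m≤1+n (ℕ.m+n≤o⇒n≤o N₂ r₂)))
          where
          N : ℕ
          N = N₁ ℕ.+ (N₂ ℕ.+ N₃)
          r₂ : N₂ ℕ.+ N₃ ℕ.≤ N
          r₂ = ℕ.m≤n+m (N₂ ℕ.+ N₃) N₁
          δ≤x : δ ℚ.≤ seq ε (suc N)
          δ≤x = h₁ (suc N) (ℕ.m≤n⇒m≤1+n (ℕ.m≤m+n N₁ (N₂ ℕ.+ N₃)))
          x≤l : 1ℚ ℚ.* seq ε (suc N) ℚ.≤ seq ℓ (suc N)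
          x≤l = h₂ (suc N) (ℕ.m≤n⇒m≤1+n (ℕ.m+n≤o⇒m≤o N₂ r₂)) 1 (ℕ.s≤s (ℕ.s≤s ℕ.z≤n))

-- Graphs made of copies of H

length-filter≤1 : ∀ {A : Set} {P : A → Set} (P? : Decidable P) {xs} → Unique xs →
  ∀ a → (∀ x → P x → x ≡ a) → length (filter P? xs) ℕ.≤ 1
length-filter≤1 {A} {P} P? {xs} uniq a only = go (filter P? xs) (filter⁺ P? uniq) (all-filter P? xs)
  where
  go : ∀ ys → Unique ys → All P ys → length ys ℕ.≤ 1
  go []           _                 _             = z≤n
  go (y ∷ [])     _                 _             = s≤s z≤n
  go (y ∷ z ∷ ys) ((y≢z ∷ _) ∷ _) (py ∷ pz ∷ _) = ⊥-elim (y≢z (trans (only y py) (sym (only z pz))))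

length-filter-none : ∀ {A : Set} {P : A → Set} (P? : Decidable P) {xs} → (∀ x → ¬ P x) → length (filter P? xs) ℕ.≤ 1
length-filter-none P? {xs} none = subst (λ ys → length ys ℕ.≤ 1) (sym (List.filter-none P? {xs} (All.universal none xs))) z≤n

opaque
  edgeList : ∀ {n} → Graph n → List (Fin n × Fin n)
  edgeList {n} G = filter (λ e → T? (adj G (proj₁ e) (proj₂ e))) (cartesianProduct (allFin n) (allFin n))

  ∈-edgeList⁺ : ∀ {n} (G : Graph n) {u v} → Adj G u v → (u , v) ∈ edgeList G
  ∈-edgeList⁺ G {u} {v} = ∈-filter⁺ (λ e → T? (adj G (proj₁ e) (proj₂ e))) (∈-cartesianProduct⁺ (∈-allFin u) (∈-allFin v))

  ∈-edgeList⁻ : ∀ {n} (G : Graph n) {u v} → (u , v) ∈ edgeList G → Adj G u v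
  ∈-edgeList⁻ {n} G uv∈ = proj₂
    (∈-filter⁻ (λ e → T? (adj G (proj₁ e) (proj₂ e))) {xs = cartesianProduct (allFin n) (allFin n)} uv∈)

≤max-filter : ∀ {P : ℕ → Set} (P? : Decidable P) {m n} → m ℕ.≤ n → P m → m ℕ.≤ max 0 (filter P? (upTo (suc n)))
≤max-filter P? {m} {n} m≤n p = v≤max⁺ 0 (filter P? (upTo (suc n)))
  (inj₂ (lose (∈-filter⁺ P? (∈-upTo⁺ (s≤s m≤n)) p) ℕ.≤-refl))

Packing⇒≤opt : ∀ {h n m} (H : Graph h) (G : Graph n) → m ℕ.≤ n → Packing H G m → m ℕ.≤ opt H G
Packing⇒≤opt H G = ≤max-filter (packing? H G)

size : ∀ {A : Set} → Maybe A → ℕ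
size (just _) = 1
size nothing  = 0

length-mapMaybe≤ : ∀ {A B : Set} (g : A → Maybe B) (F : A → ℕ) → (∀ a → size (g a) ℕ.≤ F a) → ∀ xs →
  length (mapMaybe g xs) ℕ.≤ Σ[ xs ] F
length-mapMaybe≤ g F g≤ []       = z≤n
length-mapMaybe≤ g F g≤ (x ∷ xs) with g x | g≤ x
... | just _  | 1≤ = ℕ.+-mono-≤ 1≤ (length-mapMaybe≤ g F g≤ xs)
... | nothing | _  = ℕ.≤-trans (length-mapMaybe≤ g F g≤ xs) (ℕ.m≤n+m _ (F x))

-- Charging the found colors to blocks

module _ {k m : ℕ} (p q : Fin m → Fin k) (S : Fin k → Bool) where

  hit : Fin m → Bool
  hit b = agree p q S b b

  -- Bounds what color i adds to the decoder's count: 1 if i is in `S`, and otherwise the number of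
  -- hit blocks of that color. Each hit block is charged to the single color `p b`, so the total
  -- counts hit blocks rather than colors.
  credit : Fin k → ℕ
  credit i = ind (S i) ℕ.+ Σ[ allFin m ] (λ b → ind (hit b) ℕ.* ⟦ p b ≟ i ⟧)

  Σ-credit : Σ[ allFin k ] credit ≡ Σ[ allFin k ] (ind ∘ S) ℕ.+ Σ[ allFin m ] (ind ∘ hit)
  Σ-credit = trans (ℕΣ.Σ-+ (allFin k) (ind ∘ S) (λ i → Σ[ allFin m ] (λ b → ind (hit b) ℕ.* ⟦ p b ≟ i ⟧)))
    (cong (Σ[ allFin k ] (ind ∘ S) ℕ.+_)
      (trans (ℕΣ.Σ-swap (allFin k) (allFin m) (λ i b → ind (hit b) ℕ.* ⟦ p b ≟ i ⟧))
        (ℕΣ.Σ-cong (allFin m) (λ b → trans (ℕΣ.Σ-*ˡ (allFin k) (ind (hit b)) (λ i → ⟦ p b ≟ i ⟧))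
          (trans (cong (ind (hit b) ℕ.*_) (Σ-⟦≟⟧ (p b))) (ℕ.*-identityʳ (ind (hit b))))))))

  credit≥1 : ∀ {i} → (∃ λ b → p b ≡ i × q b ≡ i) → 1 ℕ.≤ credit i
  credit≥1 (b , refl , qb≡pb) = begin
    1
      ≤⟨ excluded (S (p b)) ⟩
    ind (S (p b)) ℕ.+ ind (not (S (p b)))
      ≡⟨ cong (λ x → ind (S (p b)) ℕ.+ ind (x Bool.∧ not (S (p b)))) (dec-true (p b Fin.≟ q b) (sym qb≡pb)) ⟨
    ind (S (p b)) ℕ.+ ind (hit b)
      ≡⟨ cong (ind (S (p b)) ℕ.+_) (trans (cong (ind (hit b) ℕ.*_) (⟦≟⟧-refl (p b))) (ℕ.*-identityʳ (ind (hit b)))) ⟨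
    ind (S (p b)) ℕ.+ ind (hit b) ℕ.* ⟦ p b ≟ p b ⟧
      ≤⟨ ℕ.+-monoʳ-≤ (ind (S (p b))) (∈⇒≤Σ (λ b′ → ind (hit b′) ℕ.* ⟦ p b′ ≟ p b ⟧) (∈-allFin b)) ⟩
    credit (p b) ∎
    where
    open ℕ.≤-Reasoning
    excluded : ∀ x → 1 ℕ.≤ ind x ℕ.+ ind (not x)
    excluded true  = s≤s z≤n
    excluded false = s≤s z≤n

  decode≤ : ∀ {h n} (H : Graph h) (G : Graph n) (c : Coloring n k) →
    (∀ i → MonochromaticCopy H G c i → ∃ λ b → p b ≡ i × q b ≡ i) →
    length (decode H G c) ℕ.≤ Σ[ allFin k ] (ind ∘ S) ℕ.+ Σ[ allFin m ] (ind ∘ hit)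
  decode≤ H G c blocks-hit = ℕ.≤-trans
    (length-mapMaybe≤ _ credit (λ i → found≤ i (monochromaticCopy? H G c i)) (allFin k))
    (ℕ.≤-reflexive Σ-credit)
    where
    found≤ : ∀ i (d : Dec (MonochromaticCopy H G c i)) → size (Maybe.map proj₁ (dec⇒maybe d)) ℕ.≤ credit i
    found≤ i (yes copy) = credit≥1 (blocks-hit i copy)
    found≤ i (no _)     = z≤n

injective⇒surjective : ∀ {n} (f : Fin n → Fin n) → (∀ i j → f i ≡ f j → i ≡ j) → ∀ y → ∃ λ x → f x ≡ y
injective⇒surjective {suc n} f inj y with Fin.any? (λ x → f x Fin.≟ y)
... | yes hit  = hit
... | no  miss = ⊥-elim (Fin.<⇒notInjective (ℕ.n<1+n n)
    (λ {i} {j} eq → inj i j (Fin.punchOut-injective (y≢ i) (y≢ j) eq)))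
  where
  y≢ : ∀ x → y ≢ f x
  y≢ x eq = miss (x , sym eq)

-- Graphs given by lists of pairs

module _ {n : ℕ} where

  Joins : Fin n → Fin n → Fin n × Fin n → Set
  Joins x y (u , v) = (u ≡ x × v ≡ y) ⊎ (u ≡ y × v ≡ x)

  -- Entries are read as unordered pairs and may repeat, and x ≢ y excludes loops, so every list
  -- defines a simple graph and moving a block is an edit of a list.
  Edge : List (Fin n × Fin n) → Fin n → Fin n → Set
  Edge E x y = x ≢ y × Any (Joins x y) E

  joins? : ∀ x y → Decidable (Joins x y)
  joins? x y (u , v) = ((u Fin.≟ x) ×-dec (v Fin.≟ y)) ⊎-dec ((u Fin.≟ y) ×-dec (v Fin.≟ x))

  edge? : ∀ E x y → Dec (Edge E x y)
  edge? E x y = ¬? (x Fin.≟ y) ×-dec Any.any? (joins? x y) E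

  edge-sym : ∀ E {x y} → Edge E x y → Edge E y x
  edge-sym E (x≢y , e) = ≢-sym x≢y , Any.map swap e

  neighbors-at : (G G′ : Graph n) → ∀ e → (∀ x y → x Fin.< y → adj G x y ≢ adj G′ x y → (x , y) ≡ e) → Neighbors G G′
  neighbors-at G G′ e only = length-filter≤1 _ (cartesianProduct⁺ (allFin⁺ n) (allFin⁺ n)) e
    (λ { (x , y) (x<y , differ) → only x y x<y differ })

  neighbors-refl : (G : Graph n) → Neighbors G G
  neighbors-refl G = length-filter-none _ {cartesianProduct (allFin n) (allFin n)} (λ { (x , y) (_ , differ) → differ refl })

  ++-∷-edge : ∀ E₁ e E₂ {x y} → Edge (E₁ ++ E₂) x y → Edge (E₁ ++ e ∷ E₂) x y
  ++-∷-edge E₁ e E₂ (x≢y , p) = x≢y , [ ++⁺ˡ , ++⁺ʳ E₁ ∘ there ]′ (++⁻ E₁ p)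

  ++-∷-edge⁻ : ∀ E₁ e E₂ {x y} → ¬ Joins x y e → Edge (E₁ ++ e ∷ E₂) x y → Edge (E₁ ++ E₂) x y
  ++-∷-edge⁻ E₁ e E₂ ¬j (x≢y , p) = x≢y , [ ++⁺ˡ , ++⁺ʳ E₁ ∘ Any.tail ¬j ]′ (++⁻ E₁ p)

  sorted : Fin n × Fin n → Fin n × Fin n
  sorted (u , v) with u Fin.<? v
  ... | yes _ = u , v
  ... | no _  = v , u

  joins⇒sorted : ∀ {x y} e → x Fin.< y → Joins x y e → (x , y) ≡ sorted e
  joins⇒sorted (u , v) x<y j with u Fin.<? v | j
  ... | yes _   | inj₁ (refl , refl) = refl
  ... | no u≮v  | inj₁ (refl , refl) = ⊥-elim (u≮v x<y)
  ... | yes u<v | inj₂ (refl , refl) = ⊥-elim (Fin.<-asym u<v x<y)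
  ... | no _    | inj₂ (refl , refl) = refl

  opaque
    fromEdges : List (Fin n × Fin n) → Graph n
    fromEdges E = record
      { adj        = λ x y → does (edge? E x y)
      ; adj-sym    = λ x y → does-⇔ (mk⇔ (edge-sym E) (edge-sym E)) (edge? E x y) (edge? E y x)
      ; adj-irrefl = λ x → dec-false (edge? E x x) (λ e → proj₁ e refl)
      }

    adj⇒edge : ∀ E {x y} → Adj (fromEdges E) x y → Edge E x y
    adj⇒edge E {x} {y} = toWitness ∘ subst T (sym (isYes≗does (edge? E x y)))

    edge⇒adj : ∀ E {x y} → Edge E x y → Adj (fromEdges E) x y
    edge⇒adj E {x} {y} = subst T (isYes≗does (edge? E x y)) ∘ fromWitness

    adj-∷ : ∀ E₁ e E₂ x y → x Fin.< y → adj (fromEdges (E₁ ++ e ∷ E₂)) x y ≢ adj (fromEdges (E₁ ++ E₂)) x y →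
      (x , y) ≡ sorted e
    adj-∷ E₁ e E₂ x y x<y differ with joins? x y e
    ... | yes j = joins⇒sorted e x<y j
    ... | no ¬j = ⊥-elim (differ (does-⇔ (mk⇔ (++-∷-edge⁻ E₁ e E₂ ¬j) (++-∷-edge E₁ e E₂))
                    (edge? (E₁ ++ e ∷ E₂) x y) (edge? (E₁ ++ E₂) x y)))

  -- Only the pair joined by `e` can change. If another entry joins it as well, the graph stays the
  -- same, which `Neighbors` permits.
  delete-neighbors : ∀ E₁ e E₂ → Neighbors (fromEdges (E₁ ++ e ∷ E₂)) (fromEdges (E₁ ++ E₂))
  delete-neighbors E₁ e E₂ = neighbors-at (fromEdges (E₁ ++ e ∷ E₂)) (fromEdges (E₁ ++ E₂)) (sorted e) (adj-∷ E₁ e E₂)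

  insert-neighbors : ∀ E₁ e E₂ → Neighbors (fromEdges (E₁ ++ E₂)) (fromEdges (E₁ ++ e ∷ E₂))
  insert-neighbors E₁ e E₂ = neighbors-at (fromEdges (E₁ ++ E₂)) (fromEdges (E₁ ++ e ∷ E₂)) (sorted e)
    (λ x y x<y differ → adj-∷ E₁ e E₂ x y x<y (≢-sym differ))

-- Group privacy along edits of an edge list

module Privacy {n k : ℕ} (𝓔 : Encoder k) {ε : ℝ} (0≼e : 0ℝ ≼ exp ε) (dp : DifferentiallyPrivate ε 𝓔) where

  Close : ℕ → Graph n → Graph n → Set
  Close i G G′ = ∀ S → Pr (𝓔 n G) S ≼ exp ε ^ i * Pr (𝓔 n G′) S

  close-refl : ∀ G → Close 0 G G
  close-refl G S = ≐⇒≼ (ℛ.sym (ℛ.*-identityˡ (Pr (𝓔 n G) S)))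

  close-step : ∀ {i G G′ G″} → Neighbors G G′ → Close i G′ G″ → Close (suc i) G G″
  close-step {i} {G} {G′} {G″} nb close S = begin
    Pr (𝓔 n G) S                             ≲⟨ ≼-intro (dp n G G′ nb S) ⟩
    exp ε * Pr (𝓔 n G′) S                    ≲⟨ *-monoˡ-≼ 0≼e (close S) ⟩
    exp ε * (exp ε ^ i * Pr (𝓔 n G″) S)      ≈⟨ ℛ.*-assoc (exp ε) (exp ε ^ i) (Pr (𝓔 n G″) S) ⟨
    exp ε ^ suc i * Pr (𝓔 n G″) S            ∎
    where open ≼-Reasoning

  delete : ∀ E₁ L E₂ {j G} → Close j (fromEdges (E₁ ++ E₂)) G → Close (length L ℕ.+ j) (fromEdges (E₁ ++ L ++ E₂)) G
  delete E₁ []      E₂ close = close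
  delete E₁ (e ∷ L) E₂ {j} {G} close =
    close-step {length L ℕ.+ j} {fromEdges (E₁ ++ e ∷ L ++ E₂)} {fromEdges (E₁ ++ L ++ E₂)} {G}
      (delete-neighbors E₁ e (L ++ E₂)) (delete E₁ L E₂ {j} {G} close)

  insert : ∀ E₁ L E₂ → Close (length L) (fromEdges (E₁ ++ E₂)) (fromEdges (E₁ ++ L ++ E₂))
  insert E₁ []      E₂ = close-refl (fromEdges (E₁ ++ E₂))
  insert E₁ (e ∷ L) E₂ =
    close-step {length L} {fromEdges (E₁ ++ E₂)} {fromEdges (E₁ ++ e ∷ E₂)} {fromEdges (E₁ ++ e ∷ L ++ E₂)}
      (insert-neighbors E₁ e E₂)
      (subst (λ E → Close (length L) (fromEdges E) (fromEdges (E₁ ++ e ∷ L ++ E₂))) (List.++-assoc E₁ (e ∷ []) E₂)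
        (subst (λ E → Close (length L) (fromEdges ((E₁ ++ e ∷ []) ++ E₂)) (fromEdges E)) (List.++-assoc E₁ (e ∷ []) (L ++ E₂))
          (insert (E₁ ++ e ∷ []) L E₂)))

  replace : ∀ E₁ L L′ E₂ → Close (length L ℕ.+ length L′) (fromEdges (E₁ ++ L ++ E₂)) (fromEdges (E₁ ++ L′ ++ E₂))
  replace E₁ L L′ E₂ = delete E₁ L E₂ {length L′} {fromEdges (E₁ ++ L′ ++ E₂)} (insert E₁ L′ E₂)

-- The graph of blocks and its copies of H

module Blocks {h′ : ℕ} (H : Graph (suc (suc h′))) (N : ℕ) where

  private
    h : ℕ
    h = suc (suc h′)

  Cell : Set
  Cell = Fin N × Fin N

  place : Cell → Fin h → Fin (h ℕ.* N)
  place (x , y) zero    = combine {h} {N} zero x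
  place (x , y) (suc v) = combine {h} {N} (suc v) y

  block : Cell → List (Fin (h ℕ.* N) × Fin (h ℕ.* N))
  block z = map (λ e → place z (proj₁ e) , place z (proj₂ e)) (edgeList H)

  blocks : ∀ {m} → Vec Cell m → List (Fin (h ℕ.* N) × Fin (h ℕ.* N))
  blocks []      = []
  blocks (z ∷ f) = block z ++ blocks f

  blockGraph : ∀ {m} → Vec Cell m → Graph (h ℕ.* N)
  blockGraph f = fromEdges (blocks f)

  place-injective : ∀ z z′ u u′ → place z u ≡ place z′ u′ → u ≡ u′ × (proj₁ z ≡ proj₁ z′ ⊎ proj₂ z ≡ proj₂ z′)
  place-injective (x , y) (x′ , y′) zero    zero     eq = refl , inj₁ (Fin.combine-injectiveʳ {h} {N} zero x zero x′ eq)
  place-injective (x , y) (x′ , y′) (suc u) (suc u′) eq =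
    Fin.combine-injectiveˡ {h} {N} (suc u) y (suc u′) y′ eq , inj₂ (Fin.combine-injectiveʳ {h} {N} (suc u) y (suc u′) y′ eq)
  place-injective (x , y) (x′ , y′) zero    (suc u′) eq with () ← Fin.combine-injectiveˡ {h} {N} zero x (suc u′) y′ eq
  place-injective (x , y) (x′ , y′) (suc u) zero     eq with () ← Fin.combine-injectiveˡ {h} {N} (suc u) y zero x′ eq

  blocks⁺ : ∀ {m} (f : Vec Cell m) b {u v} → Adj H u v → (place (lookup f b) u , place (lookup f b) v) ∈ blocks f
  blocks⁺ (z ∷ f) zero    a = ∈-++⁺ˡ (∈-map⁺ (λ e → place z (proj₁ e) , place z (proj₂ e)) (∈-edgeList⁺ H a))
  blocks⁺ (z ∷ f) (suc b) a = ∈-++⁺ʳ (block z) (blocks⁺ f b a)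

  blocks⁻ : ∀ {m} (f : Vec Cell m) {e} → e ∈ blocks f →
    ∃ λ b → ∃ λ u → ∃ λ v → Adj H u v × e ≡ (place (lookup f b) u , place (lookup f b) v)
  blocks⁻ (z ∷ f) e∈ with ∈-++⁻ (block z) e∈
  ... | inj₁ e∈z with ∈-map⁻ (λ e → place z (proj₁ e) , place z (proj₂ e)) e∈z
  ...   | (u , v) , uv∈ , refl = zero , u , v , ∈-edgeList⁻ H uv∈ , refl
  blocks⁻ (z ∷ f) e∈ | inj₂ e∈f with blocks⁻ f e∈f
  ... | b , u , v , a , eq = suc b , u , v , a , eq

  blockGraph-adj⁺ : ∀ {m} (f : Vec Cell m) b {u v} → Adj H u v →
    Adj (blockGraph f) (place (lookup f b) u) (place (lookup f b) v)
  blockGraph-adj⁺ f b {u} {v} a = edge⇒adj (blocks f)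
    ( (λ eq → subst T (trans (cong (adj H u) (sym (proj₁ (place-injective (lookup f b) (lookup f b) u v eq))))
        (adj-irrefl H u)) a)
    , lose (blocks⁺ f b a) (inj₁ (refl , refl)))

  blockGraph-adj⁻ : ∀ {m} (f : Vec Cell m) {x y} → Adj (blockGraph f) x y →
    ∃ λ b → ∃ λ u → ∃ λ v → x ≡ place (lookup f b) u × y ≡ place (lookup f b) v
  blockGraph-adj⁻ f a with find (proj₂ (adj⇒edge (blocks f) a))
  ... | e , e∈ , j with blocks⁻ f e∈ | j
  ... | b , u , v , _ , refl | inj₁ (refl , refl) = b , u , v , refl , refl
  ... | b , u , v , _ , refl | inj₂ (refl , refl) = b , v , u , refl , refl

  Separated : ∀ {m} → Vec Cell m → Set
  Separated f = ∀ b b′ →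
    proj₁ (lookup f b) ≡ proj₁ (lookup f b′) ⊎ proj₂ (lookup f b) ≡ proj₂ (lookup f b′) → b ≡ b′

  packing : ∀ {m} (f : Vec Cell m) → Separated f → Packing H (blockGraph f) m
  packing {m} f sep = φs , copies , disjoint
    where
    φs : Vec (Vec (Fin (h ℕ.* N)) h) m
    φs = tabulate (λ b → tabulate (place (lookup f b)))
    φs≡ : ∀ b u → lookup (lookup φs b) u ≡ place (lookup f b) u
    φs≡ b u = trans (cong (λ φ → lookup φ u) (Vec.lookup∘tabulate (λ b → tabulate (place (lookup f b))) b))
      (Vec.lookup∘tabulate (place (lookup f b)) u)
    copies : ∀ b → IsCopy H (blockGraph f) (lookup φs b)
    copies b =
      (λ u v eq → proj₁ (place-injective (lookup f b) (lookup f b) u v (trans (sym (φs≡ b u)) (trans eq (φs≡ b v))))) ,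
      (λ u v a → subst (λ x → Adj (blockGraph f) x (lookup (lookup φs b) v)) (sym (φs≡ b u))
        (subst (Adj (blockGraph f) (place (lookup f b) u)) (sym (φs≡ b v)) (blockGraph-adj⁺ f b a)))
    disjoint : VertexDisjoint φs
    disjoint b b′ b≢b′ u v eq = b≢b′ (sep b b′
      (proj₂ (place-injective (lookup f b) (lookup f b′) u v (trans (sym (φs≡ b u)) (trans eq (φs≡ b′ v))))))

  first second : ∀ {k} → Coloring (h ℕ.* N) k → Fin N → Fin k
  first  c x = lookup c (combine {h} {N} zero x)
  second c y = lookup c (combine {h} {N} (suc zero) y)

  module _ (connected : Connected H) where

    has-neighbor : ∃ λ w → Adj H zero w
    has-neighbor with connected zero (suc zero)
    ... | a Star.◅ _ = _ , a

    -- The image of vertex `zero` lies on an edge, hence in some block. Both ends of an edge lie in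
    -- a common block, and a vertex lies in only one block when coordinates are not shared; so the
    -- block is kept along every path of H.
    copy-in-block : ∀ {m} (f : Vec Cell m) → Separated f → ∀ φ → IsCopy H (blockGraph f) φ →
      ∃ λ b → ∀ u → ∃ λ v → lookup φ u ≡ place (lookup f b) v
    copy-in-block f sep φ (_ , hom) with has-neighbor
    ... | w , a₀ with blockGraph-adj⁻ f (hom zero w a₀)
    ... | b , v₀ , _ , eq₀ , _ = b , λ u → along (connected zero u) (v₀ , eq₀)
      where
      along : ∀ {u u′} → Star (Adj H) u u′ →
        (∃ λ v → lookup φ u ≡ place (lookup f b) v) → ∃ λ v → lookup φ u′ ≡ place (lookup f b) v
      along Star.ε                   start       = start
      along {u} (Star._◅_ {j = w} a path) (v , φu≡) with blockGraph-adj⁻ f (hom u w a)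
      ... | b′ , v₁ , v₂ , φu≡′ , φw≡
        with sep b b′ (proj₂ (place-injective (lookup f b) (lookup f b′) v v₁ (trans (sym φu≡) φu≡′)))
      ... | refl = along path (v₂ , φw≡)

    -- A copy may permute the vertices of H inside its block. By counting it is onto, so it still
    -- contains the first two vertices of the block, whose colors are the ones tested.
    copy-covers-block : ∀ {m} (f : Vec Cell m) → Separated f → ∀ φ → IsCopy H (blockGraph f) φ →
      ∃ λ b → ∀ v → ∃ λ u → lookup φ u ≡ place (lookup f b) v
    copy-covers-block f sep φ copy with copy-in-block f sep φ copy
    ... | b , inside = b , λ v → let (u , σu≡v) = onto v in u , trans (proj₂ (inside u)) (cong (place (lookup f b)) σu≡v)
      where
      onto : ∀ v → ∃ λ u → proj₁ (inside u) ≡ v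
      onto = injective⇒surjective (proj₁ ∘ inside) (λ u u′ eq → proj₁ copy u u′
        (trans (proj₂ (inside u)) (trans (cong (place (lookup f b)) eq) (sym (proj₂ (inside u′))))))

    monochromatic-block : ∀ {k m} (f : Vec Cell m) → Separated f → (c : Coloring (h ℕ.* N) k) → ∀ i →
      MonochromaticCopy H (blockGraph f) c i →
      ∃ λ b → first c (proj₁ (lookup f b)) ≡ i × second c (proj₂ (lookup f b)) ≡ i
    monochromatic-block f sep c i (φ , copy , mono) = proj₁ covered , color zero , color (suc zero)
      where
      covered : ∃ λ b → ∀ v → ∃ λ u → lookup φ u ≡ place (lookup f b) v
      covered = copy-covers-block f sep φ copy
      color : ∀ v → lookup c (place (lookup f (proj₁ covered)) v) ≡ i
      color v = trans (cong (lookup c) (sym (proj₂ (proj₂ covered v)))) (mono (proj₁ (proj₂ covered v)))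

  module _ {k : ℕ} (𝓔 : Encoder k) {ε : ℝ} (0≼e : 0ℝ ≼ exp ε) (dp : DifferentiallyPrivate ε 𝓔) where
    open Privacy {h ℕ.* N} 𝓔 {ε} 0≼e dp

    -- `edgeList` contains each edge in both orientations; one length is for deleting the old block,
    -- the other for inserting the new one.
    distance : ℕ
    distance = length (edgeList H) ℕ.+ length (edgeList H)

    -- This covers overlapping blocks as well, since entries are edited one at a time and may
    -- repeat; the average runs over all positions, colliding ones included. The list `E₁` collects
    -- the blocks in front of the moved one.
    move-block : ∀ {m} E₁ (f : Vec Cell m) b z →
      Close distance (fromEdges (E₁ ++ blocks f)) (fromEdges (E₁ ++ blocks (f [ b ]≔ z)))
    move-block E₁ (z′ ∷ f) zero    z = subst
      (λ i → Close i (fromEdges (E₁ ++ block z′ ++ blocks f)) (fromEdges (E₁ ++ block z ++ blocks f)))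
      (cong₂ ℕ._+_ (List.length-map _ (edgeList H)) (List.length-map _ (edgeList H))) (replace E₁ (block z′) (block z) (blocks f))
    move-block E₁ (z′ ∷ f) (suc b) z =
      subst (λ E → Close distance (fromEdges E) (fromEdges (E₁ ++ block z′ ++ blocks (f [ b ]≔ z))))
        (List.++-assoc E₁ (block z′) (blocks f))
        (subst (λ E → Close distance (fromEdges ((E₁ ++ block z′) ++ blocks f)) (fromEdges E))
          (List.++-assoc E₁ (block z′) (blocks (f [ b ]≔ z)))
          (move-block (E₁ ++ block z′) f b z))

    blockGraph-close : ∀ {m} (f : Vec Cell m) b z → Close (suc distance) (blockGraph f) (blockGraph (f [ b ]≔ z))
    -- An idle step from the graph to itself turns the exponent into a successor, the form it has in
    -- `exp-^-bound`.
    blockGraph-close f b z = close-step {distance} {blockGraph f} {blockGraph f} {blockGraph (f [ b ]≔ z)}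
      (neighbors-refl (blockGraph f)) (move-block [] f b z)

-- Averaging over the positions of the blocks

-- Exchanging coordinate b of f with the fresh z is an involution on the pairs (f, z), so the pair
-- (moved arrangement, old cell) is distributed like (arrangement, independent cell).
Σ-vecs-resample : ∀ {A : Set} (Z : List A) {m} (b : Fin m) (F : Vec A m → A → ℝ) →
  ∑ (vecs Z m) (λ f → ∑ Z (λ z → F (f [ b ]≔ z) (lookup f b))) ≐ ∑ (vecs Z m) (λ f → ∑ Z (F f))
Σ-vecs-resample Z {suc m} zero F = begin
  ∑ (vecs Z (suc m)) (λ f → ∑ Z (λ z → F (f [ zero ]≔ z) (lookup f zero)))
    ≈⟨ ℝΣ.Σ-product _∷_ Z (vecs Z m) _ ⟩
  ∑ Z (λ x → ∑ (vecs Z m) (λ f → ∑ Z (λ z → F (z ∷ f) x)))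
    ≈⟨ ℝΣ.Σ-cong Z (λ x → ℝΣ.Σ-swap (vecs Z m) Z (λ f z → F (z ∷ f) x)) ⟩
  ∑ Z (λ x → ∑ Z (λ z → ∑ (vecs Z m) (λ f → F (z ∷ f) x)))
    ≈⟨ ℝΣ.Σ-swap Z Z (λ x z → ∑ (vecs Z m) (λ f → F (z ∷ f) x)) ⟩
  ∑ Z (λ z → ∑ Z (λ x → ∑ (vecs Z m) (λ f → F (z ∷ f) x)))
    ≈⟨ ℝΣ.Σ-cong Z (λ z → ℝΣ.Σ-swap Z (vecs Z m) (λ x f → F (z ∷ f) x)) ⟩
  ∑ Z (λ z → ∑ (vecs Z m) (λ f → ∑ Z (F (z ∷ f))))
    ≈⟨ ℝΣ.Σ-product _∷_ Z (vecs Z m) _ ⟨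
  ∑ (vecs Z (suc m)) (λ f → ∑ Z (F f)) ∎
  where open ℛ-Reasoning
Σ-vecs-resample Z {suc m} (suc b) F = begin
  ∑ (vecs Z (suc m)) (λ f → ∑ Z (λ z → F (f [ suc b ]≔ z) (lookup f (suc b))))
    ≈⟨ ℝΣ.Σ-product _∷_ Z (vecs Z m) _ ⟩
  ∑ Z (λ x → ∑ (vecs Z m) (λ f → ∑ Z (λ z → F (x ∷ f [ b ]≔ z) (lookup f b))))
    ≈⟨ ℝΣ.Σ-cong Z (λ x → Σ-vecs-resample Z b (λ f → F (x ∷ f))) ⟩
  ∑ Z (λ x → ∑ (vecs Z m) (λ f → ∑ Z (F (x ∷ f))))
    ≈⟨ ℝΣ.Σ-product _∷_ Z (vecs Z m) _ ⟨
  ∑ (vecs Z (suc m)) (λ f → ∑ Z (F f)) ∎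
  where open ℛ-Reasoning

module Averaging
  {A C : Set} (Z : List A) (cs : List C) {k : ℕ} (w : Vec A k → C → ℝ)
  (0≼w : ∀ f c → 0ℝ ≼ w f c) (total : ∀ f → ∑ cs (w f) ≼ 1ℝ)
  where

  Ω : List (Vec A k)
  Ω = vecs Z k

  -- The expectation over uniform positions and over the encoder, times the number of positions.
  -- Leaving it unnormalized keeps all constants natural numbers.
  I : (Vec A k → C → ℕ) → ℝ
  I F = ∑ Ω (λ f → ∑ cs (λ c → w f c * fromℕ (F f c)))

  I-mono : ∀ {F G} → (∀ f c → F f c ℕ.≤ G f c) → I F ≼ I G
  I-mono F≤G = ∑-mono Ω (λ f → ∑-mono cs (λ c → *-monoˡ-≼ (0≼w f c) (fromℕ-mono (F≤G f c))))

  I-+ : ∀ F G → I (λ f c → F f c ℕ.+ G f c) ≐ I F + I G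
  I-+ F G = ℛ.trans (ℝΣ.Σ-cong Ω (λ f → ℛ.trans
      (ℝΣ.Σ-cong cs (λ c → ℛ.trans (ℛ.*-congˡ (fromℕ-+ (F f c) (G f c))) (ℛ.distribˡ (w f c) _ _)))
      (ℝΣ.Σ-+ cs (λ c → w f c * fromℕ (F f c)) (λ c → w f c * fromℕ (G f c)))))
    (ℝΣ.Σ-+ Ω (λ f → ∑ cs (λ c → w f c * fromℕ (F f c))) (λ f → ∑ cs (λ c → w f c * fromℕ (G f c))))

  I-* : ∀ m F → I (λ f c → m ℕ.* F f c) ≐ fromℕ m * I F
  I-* m F = ℛ.trans (ℝΣ.Σ-cong Ω (λ f → ℛ.trans
      (ℝΣ.Σ-cong cs (λ c → ℛ.trans (ℛ.*-congˡ (fromℕ-* m (F f c))) (x[yz]≐y[xz] (w f c) (fromℕ m) (fromℕ (F f c)))))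
      (ℝΣ.Σ-*ˡ cs (fromℕ m) (λ c → w f c * fromℕ (F f c)))))
    (ℝΣ.Σ-*ˡ Ω (fromℕ m) (λ f → ∑ cs (λ c → w f c * fromℕ (F f c))))
    where
    x[yz]≐y[xz] : ∀ x y z → x * (y * z) ≐ y * (x * z)
    x[yz]≐y[xz] x y z = ℛ.trans (ℛ.sym (ℛ.*-assoc x y z)) (ℛ.trans (ℛ.*-congʳ (ℛ.*-comm x y)) (ℛ.*-assoc y x z))

  I-Σ : ∀ {B : Set} (bs : List B) (F : B → Vec A k → C → ℕ) → I (λ f c → Σ[ bs ] (λ b → F b f c)) ≐ ∑ bs (λ b → I (F b))
  I-Σ []       F = ℛ.trans (ℝΣ.Σ-cong Ω (λ f → ℛ.trans (ℝΣ.Σ-cong cs (λ c → ℛ.zeroʳ (w f c))) (ℝΣ.Σ-zero cs))) (ℝΣ.Σ-zero Ω)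
  I-Σ (b ∷ bs) F = ℛ.trans (I-+ (F b) (λ f c → Σ[ bs ] (λ b → F b f c))) (ℛ.+-congˡ (I-Σ bs F))

  I-const : ∀ m → I (λ _ _ → m) ≼ fromℕ (m ℕ.* Σ[ Ω ] (λ _ → 1))
  I-const m = begin
    ∑ Ω (λ f → ∑ cs (λ c → w f c * fromℕ m))   ≈⟨ ℝΣ.Σ-cong Ω (λ f → ℝΣ.Σ-*ʳ cs (fromℕ m) (w f)) ⟩
    ∑ Ω (λ f → ∑ cs (w f) * fromℕ m)           ≲⟨ ∑-mono Ω (λ f → *-monoʳ-≼ (0≼fromℕ m) (total f)) ⟩
    ∑ Ω (λ f → 1ℝ * fromℕ m)                   ≈⟨ ∑-const Ω (1ℝ * fromℕ m) ⟩
    fromℕ V * (1ℝ * fromℕ m)                   ≈⟨ ℛ.*-congˡ (ℛ.*-identityˡ (fromℕ m)) ⟩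
    fromℕ V * fromℕ m                          ≈⟨ fromℕ-* V m ⟨
    fromℕ (V ℕ.* m)                            ≡⟨ cong fromℕ (ℕ.*-comm V m) ⟩
    fromℕ (m ℕ.* V)                            ∎
    where
    open ≼-Reasoning
    V : ℕ
    V = Σ[ Ω ] (λ _ → 1)

  module _ (Y : A → C → Bool) where

    -- The probability of the event of cell z on the graph built from f, whether or not z is one of
    -- the positions in f.
    P : Vec A k → A → ℝ
    P f z = ∑ cs (λ c → w f c * fromℕ (ind (Y z c)))

    -- Moving block b to every cell z in turn makes its old cell independent of
    -- the rest of the graph.
    resampled : ∀ q r b → (∀ f z z′ → fromℕ q * P f z′ ≼ fromℕ r * P (f [ b ]≔ z) z′) →
      fromℕ (q ℕ.* Σ[ Z ] (λ _ → 1)) * I (λ f c → ind (Y (lookup f b) c)) ≼ fromℕ r * I (λ _ c → Σ[ Z ] (λ z → ind (Y z c)))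
    resampled q r b close = begin
      fromℕ (q ℕ.* M) * ∑ Ω (λ f → P f (lookup f b))
        ≡⟨ cong (λ m → fromℕ m * ∑ Ω (λ f → P f (lookup f b))) (ℕ.*-comm q M) ⟩
      fromℕ (M ℕ.* q) * ∑ Ω (λ f → P f (lookup f b))
        ≈⟨ ℝΣ.Σ-*ˡ Ω (fromℕ (M ℕ.* q)) (λ f → P f (lookup f b)) ⟨
      ∑ Ω (λ f → fromℕ (M ℕ.* q) * P f (lookup f b))
        ≈⟨ ℝΣ.Σ-cong Ω (λ f → ℛ.trans (ℛ.*-congʳ (fromℕ-* M q)) (ℛ.*-assoc (fromℕ M) (fromℕ q) (P f (lookup f b)))) ⟩
      ∑ Ω (λ f → fromℕ M * (fromℕ q * P f (lookup f b)))
        ≈⟨ ℝΣ.Σ-cong Ω (λ f → ∑-const Z (fromℕ q * P f (lookup f b))) ⟨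
      ∑ Ω (λ f → ∑ Z (λ z → fromℕ q * P f (lookup f b)))
        ≲⟨ ∑-mono Ω (λ f → ∑-mono Z (λ z → close f z (lookup f b))) ⟩
      ∑ Ω (λ f → ∑ Z (λ z → fromℕ r * P (f [ b ]≔ z) (lookup f b)))
        ≈⟨ Σ-vecs-resample Z b (λ f z → fromℕ r * P f z) ⟩
      ∑ Ω (λ f → ∑ Z (λ z → fromℕ r * P f z))
        ≈⟨ ℝΣ.Σ-cong Ω (λ f → ℝΣ.Σ-*ˡ Z (fromℕ r) (P f)) ⟩
      ∑ Ω (λ f → fromℕ r * ∑ Z (P f))
        ≈⟨ ℝΣ.Σ-*ˡ Ω (fromℕ r) (λ f → ∑ Z (P f)) ⟩
      fromℕ r * ∑ Ω (λ f → ∑ Z (P f))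
        ≈⟨ ℛ.*-congˡ (ℝΣ.Σ-cong Ω (λ f → ℛ.trans (ℝΣ.Σ-swap Z cs (λ z c → w f c * fromℕ (ind (Y z c))))
             (ℝΣ.Σ-cong cs (λ c → ℛ.trans (ℝΣ.Σ-*ˡ Z (w f c) (λ z → fromℕ (ind (Y z c))))
               (ℛ.*-congˡ (ℛ.sym (fromℕ-Σ Z (λ z → ind (Y z c))))))))) ⟩
      fromℕ r * I (λ _ c → Σ[ Z ] (λ z → ind (Y z c))) ∎
      where
      open ≼-Reasoning
      M : ℕ
      M = Σ[ Z ] (λ _ → 1)

    -- Here r/q is the privacy factor, `s` counts the colors taken outright, and `good` marks the
    -- positions for which the ratio is assumed in full. Linearity over the k blocks, together with
    -- `resampled`, replaces each block by an independent cell.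
    averaged : ∀ q r B (s : C → ℕ) (good : Vec A k → ℕ) (α : ℝ) →
      (∀ f b z z′ → fromℕ q * P f z′ ≼ fromℕ r * P (f [ b ]≔ z) z′) →
      (∀ c → q ℕ.* Σ[ Z ] (λ _ → 1) ℕ.* s c ℕ.+ k ℕ.* r ℕ.* Σ[ Z ] (λ z → ind (Y z c)) ℕ.≤ B) →
      (∀ f → α * fromℕ (k ℕ.* good f) ≼ ∑ cs (λ c → w f c * fromℕ (s c ℕ.+ Σ[ allFin k ] (λ b → ind (Y (lookup f b) c))))) →
      α * fromℕ (q ℕ.* Σ[ Z ] (λ _ → 1) ℕ.* (k ℕ.* Σ[ Ω ] good)) ≼ fromℕ (B ℕ.* Σ[ Ω ] (λ _ → 1))
    averaged q r B s good α close bound ratio = begin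
      α * fromℕ (qM ℕ.* (k ℕ.* Σ[ Ω ] good))
        ≈⟨ ℛ.*-congˡ (fromℕ-* qM (k ℕ.* Σ[ Ω ] good)) ⟩
      α * (fromℕ qM * fromℕ (k ℕ.* Σ[ Ω ] good))
        ≈⟨ ℛ.trans (ℛ.sym (ℛ.*-assoc α _ _)) (ℛ.trans (ℛ.*-congʳ (ℛ.*-comm α (fromℕ qM))) (ℛ.*-assoc (fromℕ qM) α _)) ⟩
      fromℕ qM * (α * fromℕ (k ℕ.* Σ[ Ω ] good))
        ≈⟨ ℛ.*-congˡ (ℛ.*-congˡ (ℛ.trans (ℛ.reflexive (cong fromℕ (sym (ℕΣ.Σ-*ˡ Ω k good)))) (fromℕ-Σ Ω (λ f → k ℕ.* good f)))) ⟩
      fromℕ qM * (α * ∑ Ω (λ f → fromℕ (k ℕ.* good f)))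
        ≈⟨ ℛ.*-congˡ (ℝΣ.Σ-*ˡ Ω α (λ f → fromℕ (k ℕ.* good f))) ⟨
      fromℕ qM * ∑ Ω (λ f → α * fromℕ (k ℕ.* good f))
        ≲⟨ *-monoˡ-≼ (0≼fromℕ qM) (∑-mono Ω ratio) ⟩
      fromℕ qM * I (λ f c → s c ℕ.+ Σ[ allFin k ] (λ b → ind (Y (lookup f b) c)))
        ≈⟨ ℛ.*-congˡ (ℛ.trans (I-+ (λ _ c → s c) (λ f c → Σ[ allFin k ] (λ b → ind (Y (lookup f b) c))))
             (ℛ.+-congˡ (I-Σ (allFin k) (λ b f c → ind (Y (lookup f b) c))))) ⟩
      fromℕ qM * (I (λ _ c → s c) + ∑ (allFin k) (λ b → I (λ f c → ind (Y (lookup f b) c))))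
        ≈⟨ ℛ.distribˡ (fromℕ qM) _ _ ⟩
      fromℕ qM * I (λ _ c → s c) + fromℕ qM * ∑ (allFin k) (λ b → I (λ f c → ind (Y (lookup f b) c)))
        ≈⟨ ℛ.+-congˡ (ℝΣ.Σ-*ˡ (allFin k) (fromℕ qM) (λ b → I (λ f c → ind (Y (lookup f b) c)))) ⟨
      fromℕ qM * I (λ _ c → s c) + ∑ (allFin k) (λ b → fromℕ qM * I (λ f c → ind (Y (lookup f b) c)))
        ≲⟨ +-mono-≼ ≼.refl (∑-mono (allFin k) (λ b → resampled q r b (λ f → close f b))) ⟩
      fromℕ qM * I (λ _ c → s c) + ∑ (allFin k) (λ b → fromℕ r * I W)
        ≈⟨ ℛ.+-congˡ (∑-const (allFin k) (fromℕ r * I W)) ⟩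
      fromℕ qM * I (λ _ c → s c) + fromℕ (Σ[ allFin k ] (λ _ → 1)) * (fromℕ r * I W)
        ≡⟨ cong (λ m → fromℕ qM * I (λ _ c → s c) + fromℕ m * (fromℕ r * I W)) (trans (Σ-allFin-const k 1) (ℕ.*-identityʳ k)) ⟩
      fromℕ qM * I (λ _ c → s c) + fromℕ k * (fromℕ r * I W)
        ≈⟨ ℛ.+-congˡ (ℛ.trans (ℛ.sym (ℛ.*-assoc (fromℕ k) (fromℕ r) (I W))) (ℛ.*-congʳ (ℛ.sym (fromℕ-* k r)))) ⟩
      fromℕ qM * I (λ _ c → s c) + fromℕ (k ℕ.* r) * I W
        ≈⟨ ℛ.+-cong (I-* qM (λ _ c → s c)) (I-* (k ℕ.* r) W) ⟨
      I (λ _ c → qM ℕ.* s c) + I (λ f c → k ℕ.* r ℕ.* W f c)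
        ≈⟨ I-+ (λ _ c → qM ℕ.* s c) (λ f c → k ℕ.* r ℕ.* W f c) ⟨
      I (λ f c → qM ℕ.* s c ℕ.+ k ℕ.* r ℕ.* W f c)
        -- The blocks now enter only through the number of cells satisfying `Y`, so the estimate is
        -- applied to one coloring at a time; this allows the set of colors to depend on the
        -- coloring.
        ≲⟨ I-mono (λ _ → bound) ⟩
      I (λ _ _ → B)
        ≲⟨ I-const B ⟩
      fromℕ (B ℕ.* Σ[ Ω ] (λ _ → 1)) ∎
      where
      open ≼-Reasoning
      qM : ℕ
      qM = q ℕ.* Σ[ Z ] (λ _ → 1)
      W : Vec A k → C → ℕ
      W _ c = Σ[ Z ] (λ z → ind (Y z c))

-- The bound for a fixed k ≥ 2

1≤Σ-vecs : ∀ {N} → 1 ℕ.≤ N → ∀ m → 1 ℕ.≤ Σ[ vecs (cells N) m ] (λ _ → 1)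
1≤Σ-vecs 1≤N zero    = s≤s z≤n
1≤Σ-vecs {N} 1≤N (suc m) = subst (1 ℕ.≤_) (sym (Σ-vecs-const {N} m 1))
  (ℕ.*-mono-≤ (ℕ.*-mono-≤ 1≤N 1≤N) (1≤Σ-vecs 1≤N m))

HasRatio⇒≼hits : ∀ {h n k m} (H : Graph h) (𝓔 : Encoder k) {α} → HasRatio H 𝓔 α →
  (G : Graph n) → k ℕ.≤ n → Packing H G k →
  (p q : Coloring n k → Fin m → Fin k) (S : Coloring n k → Fin k → Bool) →
  (∀ c i → MonochromaticCopy H G c i → ∃ λ b → p c b ≡ i × q c b ≡ i) →
  α * fromℕ k ≼ ∑ (colorings n k) (λ c →
    mass (𝓔 n G) c * fromℕ (Σ[ allFin k ] (ind ∘ S c) ℕ.+ Σ[ allFin m ] (ind ∘ hit (p c) (q c) (S c))))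
HasRatio⇒≼hits {n = n} {k} H 𝓔 hasRatio G k≤n packing p q S blocks-hit = ≼.trans
  (≼-intro (hasRatio n G (Packing⇒≤opt H G k≤n packing)))
  (∑-mono (colorings n k) (λ c → *-monoˡ-≼ (≼-intro (mass≥0 (𝓔 n G) c))
    (fromℕ-mono (decode≤ (p c) (q c) (S c) H G c (blocks-hit c)))))

module RatioBound {h′ : ℕ} (H : Graph (suc (suc h′))) (connected : Connected H) {k : ℕ} (2≤k : 2 ℕ.≤ k)
  (𝓔 : Encoder k) {ε : ℝ} (0≼e : 0ℝ ≼ exp ε) (dp : DifferentiallyPrivate ε 𝓔)
  (e^D : fromℕ 50 * exp ε ^ suc (length (edgeList H) ℕ.+ length (edgeList H)) ≼ fromℕ (49 ℕ.+ k))
  (N : ℕ) (1≤N : 1 ℕ.≤ N) (k≤n : k ℕ.≤ suc (suc h′) ℕ.* N)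
  (free : 9 ℕ.* Σ[ vecs (cells N) k ] (λ _ → 1) ℕ.≤ 10 ℕ.* Σ[ vecs (cells N) k ] collision-free)
  where

  open Blocks H N

  n : ℕ
  n = suc (suc h′) ℕ.* N

  law : Vec Cell k → Distribution n k
  law f = 𝓔 n (blockGraph f)

  few : ∀ c → ∃ λ (S : Fin k → Bool) →
    50 ℕ.* (N ℕ.* N) ℕ.* Σ[ allFin k ] (ind ∘ S) ℕ.+
    k ℕ.* (49 ℕ.+ k) ℕ.* Σ[ allFin N ] (λ x → Σ[ allFin N ] (λ y → ind (agree (first c) (second c) S x y)))
      ℕ.≤ 30 ℕ.* k ℕ.* (N ℕ.* N)
  few c = few-colors-or-agreements (first c) (second c) 2≤k

  S : Coloring n k → Fin k → Bool
  S c = proj₁ (few c)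

  -- For fixed z this is a set of colorings, even though `S` is chosen from the coloring itself, so
  -- privacy applies to it as to any event.
  Y : Cell → Coloring n k → Bool
  Y z c = agree (first c) (second c) (S c) (proj₁ z) (proj₂ z)

  s : Coloring n k → ℕ
  s c = Σ[ allFin k ] (ind ∘ S c)

  0≼law : ∀ f c → 0ℝ ≼ mass (law f) c
  0≼law f c = ≼-intro (mass≥0 (law f) c)

  open Averaging (cells N) (colorings n k) (λ f → mass (law f)) 0≼law (λ f → ≼-intro (proj₁ (total≃1 (law f))))

  P≐Pr : ∀ f z → P Y f z ≐ Pr (law f) (Y z)
  P≐Pr f z = ℛ.sym (∑-filterᵇ (Y z) (colorings n k) (mass (law f)))

  0≼P : ∀ f z → 0ℝ ≼ P Y f z
  0≼P f z = 0≼∑ (colorings n k) (λ c → 0≼* (0≼law f c) (0≼fromℕ (ind (Y z c))))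

  a : ℝ
  a = exp ε ^ suc (length (edgeList H) ℕ.+ length (edgeList H))

  close : ∀ f b z z′ → fromℕ 50 * P Y f z′ ≼ fromℕ (49 ℕ.+ k) * P Y (f [ b ]≔ z) z′
  close f b z z′ = begin
    fromℕ 50 * P Y f z′                            ≈⟨ ℛ.*-congˡ (P≐Pr f z′) ⟩
    fromℕ 50 * Pr (law f) (Y z′)                   ≲⟨ *-monoˡ-≼ (0≼fromℕ 50) (blockGraph-close 𝓔 {ε} 0≼e dp f b z (Y z′)) ⟩
    fromℕ 50 * (a * Pr (law (f [ b ]≔ z)) (Y z′))  ≈⟨ ℛ.*-congˡ (ℛ.*-congˡ (P≐Pr (f [ b ]≔ z) z′)) ⟨
    fromℕ 50 * (a * P Y (f [ b ]≔ z) z′)           ≈⟨ ℛ.*-assoc (fromℕ 50) a (P Y (f [ b ]≔ z) z′) ⟨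
    fromℕ 50 * a * P Y (f [ b ]≔ z) z′             ≲⟨ *-monoʳ-≼ (0≼P (f [ b ]≔ z) z′) e^D ⟩
    fromℕ (49 ℕ.+ k) * P Y (f [ b ]≔ z) z′         ∎
    where open ≼-Reasoning

  bound : ∀ c → 50 ℕ.* Σ[ cells N ] (λ _ → 1) ℕ.* s c ℕ.+ k ℕ.* (49 ℕ.+ k) ℕ.* Σ[ cells N ] (λ z → ind (Y z c))
    ℕ.≤ 30 ℕ.* k ℕ.* (N ℕ.* N)
  bound c = subst₂ (λ M W → 50 ℕ.* M ℕ.* s c ℕ.+ k ℕ.* (49 ℕ.+ k) ℕ.* W ℕ.≤ 30 ℕ.* k ℕ.* (N ℕ.* N))
    (sym (trans (Σ-cells-const N 1) (ℕ.*-identityʳ (N ℕ.* N)))) (sym (Σ-cells N (λ z → ind (Y z c)))) (proj₂ (few c))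

  hits : Vec Cell k → Coloring n k → ℕ
  hits f c = s c ℕ.+ Σ[ allFin k ] (λ b → ind (Y (lookup f b) c))

  αk≼hits : ∀ {α} → HasRatio H 𝓔 α → (f : Vec Cell k) → Separated f →
    α * fromℕ k ≼ ∑ (colorings n k) (λ c → mass (law f) c * fromℕ (hits f c))
  αk≼hits {α} hasRatio f separated = HasRatio⇒≼hits H 𝓔 {α} hasRatio (blockGraph f) k≤n (packing f separated)
    (λ c b → first c (proj₁ (lookup f b))) (λ c b → second c (proj₂ (lookup f b))) S
    (monochromatic-block connected f separated)

  ratio : ∀ {α} → HasRatio H 𝓔 α → ∀ f →
    α * fromℕ (k ℕ.* collision-free f) ≼ ∑ (colorings n k) (λ c → mass (law f) c * fromℕ (hits f c))
  ratio {α} hasRatio f = go (collisions f ℕ.≟ 0)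
    where
    open ≼-Reasoning
    go : (d : Dec (collisions f ≡ 0)) →
      α * fromℕ (k ℕ.* ind (does d)) ≼ ∑ (colorings n k) (λ c → mass (law f) c * fromℕ (hits f c))
    -- For colliding positions the blocks need not form a packing, and the ratio yields nothing; the
    -- left side is 0 and the right side a sum of nonnegative terms.
    go (no _) = begin
      α * fromℕ (k ℕ.* 0)     ≡⟨ cong (λ m → α * fromℕ m) (ℕ.*-zeroʳ k) ⟩
      α * 0ℝ                  ≈⟨ ℛ.zeroʳ α ⟩
      0ℝ                      ≲⟨ 0≼∑ (colorings n k) (λ c → 0≼* (0≼law f c) (0≼fromℕ (hits f c))) ⟩
      ∑ (colorings n k) (λ c → mass (law f) c * fromℕ (hits f c)) ∎
    go (yes none) = subst (λ m → α * fromℕ m ≼ ∑ (colorings n k) (λ c → mass (law f) c * fromℕ (hits f c)))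
      (sym (ℕ.*-identityʳ k)) (αk≼hits {α} hasRatio f separated)
      where
      separated : Separated f
      separated = collisions≡0⇒injective f none

  α≤⅔ : ∀ {α} → HasRatio H 𝓔 α → α ≤ fromℚ (+ 2 ℚ./ 3)
  α≤⅔ {α} hasRatio = cancel-⅔ {α} {50 ℕ.* M ℕ.* (k ℕ.* g)} {30 ℕ.* k ℕ.* (N ℕ.* N) ℕ.* V} 1≤m 3p≤2m
    (≼⇒≤ (averaged Y 50 (49 ℕ.+ k) (30 ℕ.* k ℕ.* (N ℕ.* N)) s collision-free α close bound (ratio {α} hasRatio)))
    where
    open ℕ.≤-Reasoning
    M g V : ℕ
    M = Σ[ cells N ] (λ _ → 1)
    g = Σ[ vecs (cells N) k ] collision-free
    V = Σ[ vecs (cells N) k ] (λ _ → 1)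
    M≡ : M ≡ N ℕ.* N
    M≡ = trans (Σ-cells-const N 1) (ℕ.*-identityʳ (N ℕ.* N))
    1≤g : 1 ℕ.≤ g
    1≤g = ℕ.*-cancelˡ-< 10 0 g (begin
      1          ≤⟨ s≤s z≤n ⟩
      9          ≤⟨ ℕ.*-monoʳ-≤ 9 (1≤Σ-vecs 1≤N k) ⟩
      9 ℕ.* V    ≤⟨ free ⟩
      10 ℕ.* g   ∎)
    1≤m : 1 ℕ.≤ 50 ℕ.* M ℕ.* (k ℕ.* g)
    1≤m = ℕ.*-mono-≤ {1} {50 ℕ.* M} {1} {k ℕ.* g}
      (ℕ.*-mono-≤ {1} {50} {1} {M} (s≤s z≤n) (subst (1 ℕ.≤_) (sym M≡) (ℕ.*-mono-≤ 1≤N 1≤N)))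
      (ℕ.*-mono-≤ {1} {k} {1} {g} (ℕ.≤-trans (s≤s z≤n) 2≤k) 1≤g)
    3p≤2m : 3 ℕ.* (30 ℕ.* k ℕ.* (N ℕ.* N) ℕ.* V) ℕ.≤ 2 ℕ.* (50 ℕ.* M ℕ.* (k ℕ.* g))
    3p≤2m = subst (λ M → 3 ℕ.* (30 ℕ.* k ℕ.* (N ℕ.* N) ℕ.* V) ℕ.≤ 2 ℕ.* (50 ℕ.* M ℕ.* (k ℕ.* g))) (sym M≡)
      (scale k (N ℕ.* N) V g free)
      where
      scale : ∀ k M V g → 9 ℕ.* V ℕ.≤ 10 ℕ.* g → 3 ℕ.* (30 ℕ.* k ℕ.* M ℕ.* V) ℕ.≤ 2 ℕ.* (50 ℕ.* M ℕ.* (k ℕ.* g))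
      scale k M V g 9V≤10g = begin
        3 ℕ.* (30 ℕ.* k ℕ.* M ℕ.* V)         ≡⟨ eq₁ k M V ⟩
        10 ℕ.* (k ℕ.* M) ℕ.* (9 ℕ.* V)       ≤⟨ ℕ.*-monoʳ-≤ (10 ℕ.* (k ℕ.* M)) 9V≤10g ⟩
        10 ℕ.* (k ℕ.* M) ℕ.* (10 ℕ.* g)      ≡⟨ eq₂ k M g ⟩
        2 ℕ.* (50 ℕ.* M ℕ.* (k ℕ.* g))       ∎
        where
        eq₁ : ∀ k M V → 3 ℕ.* (30 ℕ.* k ℕ.* M ℕ.* V) ≡ 10 ℕ.* (k ℕ.* M) ℕ.* (9 ℕ.* V)
        eq₁ = solve-∀
        eq₂ : ∀ k M g → 10 ℕ.* (k ℕ.* M) ℕ.* (10 ℕ.* g) ≡ 2 ℕ.* (50 ℕ.* M ℕ.* (k ℕ.* g))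
        eq₂ = solve-∀

0<fromℚ-inv : ∀ M → 0ℝ < fromℚ (inv M)
0<fromℚ-inv M = inv M , 0<inv M , 0 , λ _ _ → ℚ.≤-reflexive (ℚ.+-identityˡ (inv M))

theorem33 : ∀ {h} (H : Graph h) → Connected H → 2 ℕ.≤ h →
    ∃ λ (c : ℝ) → 0ℝ < c ×
    (∀ (k : ℕ) → 1 ℕ.≤ k →
    ∀ (log-k : ℝ) → IsLog log-k (fromℕ k) →
    ∀ (ε : ℝ) → 0ℝ < ε → ε ≤ c * log-k →
    ∀ (𝓔 : Encoder k) → DifferentiallyPrivate ε 𝓔 →
    ∀ (α : ℝ) → HasRatio H 𝓔 α → α ≤ fromℚ (+ 2 ℚ./ 3))
theorem33 H connected (s≤s (s≤s {n = h′} z≤n)) = fromℚ (inv M) , 0<fromℚ-inv M , bound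
  where
  D M : ℕ
  D = suc (length (edgeList H) ℕ.+ length (edgeList H))
  -- Thus c = 1/(100 D + 2): the factor 50 is that of the chord bound, doubled for the slack in ε ≤
  -- c log k, and the added 2 covers the case k = 1.
  M = suc (50 ℕ.* D ℕ.+ 50 ℕ.* D)
  bound : ∀ k → 1 ℕ.≤ k → ∀ log-k → IsLog log-k (fromℕ k) → ∀ ε → 0ℝ < ε → ε ≤ fromℚ (inv M) * log-k →
    (𝓔 : Encoder k) → DifferentiallyPrivate ε 𝓔 → ∀ α → HasRatio H 𝓔 α → α ≤ fromℚ (+ 2 ℚ./ 3)
  bound (suc zero) _ log-k isLog ε 0<ε ε≤ _ _ _ _ =
    ⊥-elim (log-one-impossible {ε} {log-k} (50 ℕ.* D ℕ.+ 50 ℕ.* D) isLog 0<ε ε≤)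
  bound k@(suc (suc _)) 1≤k log-k isLog ε 0<ε ε≤ 𝓔 dp α hasRatio =
    RatioBound.α≤⅔ H connected (s≤s (s≤s z≤n)) 𝓔 {ε} (≼-intro (0≤exp {ε} 0<ε)) dp
      (≼-intro (exp-^-bound {ε} {log-k} {k} 49 (length (edgeList H) ℕ.+ length (edgeList H)) M
        (ℕ.m≤n⇒m≤1+n (ℕ.n≤1+n (50 ℕ.* D ℕ.+ 50 ℕ.* D))) isLog 0<ε ε≤))
      (10 ℕ.* (k ℕ.* k)) (ℕ.≤-trans 1≤k k≤N) (ℕ.≤-trans k≤N (ℕ.m≤m+n _ _)) (mostly-collision-free k 1≤k)
      {α} hasRatio
    where
    k≤N : k ℕ.≤ 10 ℕ.* (k ℕ.* k)
    k≤N = ℕ.≤-trans (ℕ.m≤m*n k k) (ℕ.m≤n*m (k ℕ.* k) 10)
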